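{- Let $p\ge 5$ be a prime and let $\rho=(a,2t,b)$ be a positive definite binary quadratic form of discriminant $(2t)^2-4ab=-16p$. Suppose that either $\rho$ is primitive and not in the principal genus, or $\rho=4\rho'$ with $\rho'$ primitive. Then $\rho$ is properly represented by a primitive ternary quadratic form $f$ with invariants $\Omega=2p$ and $\Delta=1$, and any two primitive ternary forms with these invariants properly representing $\rho$ are equivalent. Moreover the reciprocal $F$ of $f$ is improperly primitive with discriminant $\det(A_F)/2=p$.
   Context: A ternary quadratic form is $f=a_{11}x^2+a_{22}y^2+a_{33}z^2+2a_{23}yz+2a_{13}xz+2a_{12}xy$ with integer $a_{ij}$ and symmetric matrix $A_f=(a_{ij})$; its discriminant is $\det(A_f)/2$. With $\tau=\gcd(a_{ij})$ and $\sigma=\gcd(a_{11},a_{22},a_{33},2a_{23},2a_{13},2a_{12})$, $f$ is primitive if $\tau=1$, improperly primitive if $\tau=1,\sigma=2$. With $A_{ij}$ the cofactors, $\Omega=\gcd(A_{ij})$ and $\det(A_f)=\Delta\Omega^2$ define the invariants $\Omega,\Delta$; the reciprocal is $F=\frac1\Omega\sum A_{ij}X_iX_j$. Two ternary forms $f,g$ are equivalent if $A_g=UA_fU^t$ for some integer $U$ with $\det U=\pm1$. A binary form with matrix $B$ is properly represented by $f$ if $M^tA_fM=B$ for an integer $3\times2$ matrix $M$ whose $2\times 2$ minors are coprime. The form $(a,2t,b)$ is $ax^2+2txy+by^2$ with matrix $\begin{pmatrix}a&t\\t&b\end{pmatrix}$. The principal genus of discriminant $-16p$ is the genus containing $x^2+4py^2$.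 -}

module Defs where

import Algebra.Properties.CommutativeMonoid.Sum
open import Data.Fin.Base using (Fin; zero; suc; toℕ; punchIn)
open import Data.Integer.Base
  using (ℤ; +_; -_; _+_; _-_; _*_; _^_; _<_; 0ℤ; 1ℤ; -1ℤ)
open import Data.Integer.Coprimality using (Coprime)
open import Data.Integer.Divisibility using (_∣_)
open import Data.Integer.GCD using (gcd)
open import Data.Integer.Properties using (+-0-commutativeMonoid)
open import Data.Nat.Base as ℕ using (ℕ; zero; suc)
open import Data.Product.Base using (_×_; ∃-syntax)
open import Data.Rational.Base as ℚ using (ℚ)
open import Data.Sum.Base using (_⊎_)
open import Data.Vec.Functional using (Vector; []; _∷_; foldr)
open import Function.Bundles using (_⇔_)
open import Relation.Binary.PropositionalEquality.Core using (_≡_)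
open import Relation.Nullary.Negation.Core using (¬_)

open Algebra.Properties.CommutativeMonoid.Sum +-0-commutativeMonoid
  using (sum-syntax)

infix  4 _≐_
infixl 7 _⊗_
infixl 9 _ᵗ

gcds : ∀ {n} → Vector ℤ n → ℤ
gcds = foldr gcd 0ℤ

------------------------------------------------------------------------
-- Integer matrices

Matrix : ℕ → ℕ → Set
Matrix m n = Fin m → Fin n → ℤ

_≐_ : ∀ {m n} → Matrix m n → Matrix m n → Set
A ≐ B = ∀ i j → A i j ≡ B i j

_ᵗ : ∀ {m n} → Matrix m n → Matrix n m
(A ᵗ) i j = A j i

_⊗_ : ∀ {l m n} → Matrix l m → Matrix m n → Matrix l n
_⊗_ {m = m} A B i j = ∑[ k < m ] (A i k * B k j)

deleteRow : ∀ {m n} → Fin (suc m) → Matrix (suc m) n → Matrix m n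
deleteRow i A k = A (punchIn i k)

deleteColumn : ∀ {m n} → Fin (suc n) → Matrix m (suc n) → Matrix m n
deleteColumn j A k l = A k (punchIn j l)

-- Laplace expansion along the first row.
det : ∀ {n} → Matrix n n → ℤ
det {zero}  A = 1ℤ
det {suc n} A =
  ∑[ j < suc n ]
    (-1ℤ ^ toℕ j * A zero j * det (deleteRow zero (deleteColumn j A)))

cofactor : ∀ {n} → Matrix (suc n) (suc n) → Matrix (suc n) (suc n)
cofactor A i j =
  -1ℤ ^ (toℕ i ℕ.+ toℕ j) * det (deleteRow i (deleteColumn j A))

------------------------------------------------------------------------
-- Binary quadratic forms

-- The form α x² + β x y + γ y²; the middle coefficient may be odd.
record BinaryForm : Set where
  constructor binary
  field
    α β γ : ℤ

module _ (ρ : BinaryForm) where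
  open BinaryForm ρ

  value : ℤ → ℤ → ℤ
  value x y = α * x * x + β * x * y + γ * y * y

  discriminant₂ : ℤ
  discriminant₂ = β * β - + 4 * α * γ

  Primitive₂ : Set
  Primitive₂ = gcds (α ∷ β ∷ γ ∷ []) ≡ 1ℤ

  PositiveDefinite : Set
  PositiveDefinite = ∀ x y → ¬ (x ≡ 0ℤ × y ≡ 0ℤ) → 0ℤ < value x y

  scale : ℤ → BinaryForm
  scale c = binary (c * α) (c * β) (c * γ)

RepresentsMod : ℤ → BinaryForm → ℤ → Set
RepresentsMod D ρ r = ∃[ x ] ∃[ y ] D ∣ value ρ x y - r

-- Two primitive positive definite forms of the same discriminant D belong
-- to the same genus when they represent the same values in (ℤ/Dℤ)*.
SameGenus : BinaryForm → BinaryForm → Set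
SameGenus ρ ρ′ =
  discriminant₂ ρ ≡ discriminant₂ ρ′ ×
  (∀ r → Coprime r (discriminant₂ ρ) →
    RepresentsMod (discriminant₂ ρ) ρ r ⇔ RepresentsMod (discriminant₂ ρ) ρ′ r)

-- The genus of x² + 4py², for forms of discriminant -16p.
InPrincipalGenus : ℕ → BinaryForm → Set
InPrincipalGenus p ρ = SameGenus ρ (binary 1ℤ 0ℤ (+ (4 ℕ.* p)))

-- The matrix of the form (a, 2t, b).
matrix₂ : (a t b : ℤ) → Matrix 2 2
matrix₂ a t b = (a ∷ t ∷ []) ∷ (t ∷ b ∷ []) ∷ []

------------------------------------------------------------------------
-- Ternary quadratic forms

-- The form a₁₁x² + a₂₂y² + a₃₃z² + 2a₂₃yz + 2a₁₃xz + 2a₁₂xy.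
record TernaryForm : Set where
  constructor ternary
  field
    a₁₁ a₂₂ a₃₃ a₂₃ a₁₃ a₁₂ : ℤ

module _ (f : TernaryForm) where
  open TernaryForm f

  matrix : Matrix 3 3
  matrix = (a₁₁ ∷ a₁₂ ∷ a₁₃ ∷ [])
         ∷ (a₁₂ ∷ a₂₂ ∷ a₂₃ ∷ [])
         ∷ (a₁₃ ∷ a₂₃ ∷ a₃₃ ∷ [])
         ∷ []

  -- Half of an integer, hence possibly not an integer.
  discriminant : ℚ
  discriminant = det matrix ℚ./ 2

  τ : ℤ
  τ = gcds (λ i → gcds (matrix i))

  σ : ℤ
  σ = gcds (a₁₁ ∷ a₂₂ ∷ a₃₃ ∷ + 2 * a₂₃ ∷ + 2 * a₁₃ ∷ + 2 * a₁₂ ∷ [])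

  Primitive : Set
  Primitive = τ ≡ 1ℤ

  ImproperlyPrimitive : Set
  ImproperlyPrimitive = τ ≡ 1ℤ × σ ≡ + 2

  Ω : ℤ
  Ω = gcds (λ i → gcds (cofactor matrix i))

  HasInvariants : (ω δ : ℤ) → Set
  HasInvariants ω δ = Ω ≡ ω × det matrix ≡ δ * ω ^ 2

-- F = (1/Ω) Σ Aᵢⱼ Xᵢ Xⱼ; this determines F when Ω ≠ 0.
_IsReciprocalOf_ : TernaryForm → TernaryForm → Set
F IsReciprocalOf f = ∀ i j → Ω f * matrix F i j ≡ cofactor (matrix f) i j

Equivalent : TernaryForm → TernaryForm → Set
Equivalent f g =
  ∃[ U ] (det U ≡ 1ℤ ⊎ det U ≡ -1ℤ) × matrix g ≐ U ⊗ matrix f ⊗ U ᵗ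

ProperlyRepresents : TernaryForm → Matrix 2 2 → Set
ProperlyRepresents f B =
  ∃[ M ] gcds {3} (λ i → det (deleteRow i M)) ≡ 1ℤ × M ᵗ ⊗ matrix f ⊗ M ≐ B

{-# OPTIONS --safe #-}
module Submission where

-- Let A be the matrix of a form with invariants (2p, 1) and F that of its
-- reciprocal: adj A = 2p F and adj F = A, so the two determine each other.  In a
-- basis extending a proper representation of ρ, A has upper left block ρ and F
-- has last diagonal entry 2; the equation adj F = A then expresses all of F
-- through ρ and its last column (u, v).  The parities of u and v are those of b
-- and a, and a shear shifts them by arbitrary even integers: this gives
-- uniqueness, and existence by reading the equations backwards.
--
-- F has even diagonal as soon as 4 ∣ a + v² and 4 ∣ b + u², which is immediate for
-- ρ = 4ρ′.  For primitive ρ it holds when the values of ρ prime to 2p are 3 mod 4.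
-- A value m ≡ 1 mod 4 would make -p a square mod m, hence m a square mod p by
-- quadratic reciprocity for the Jacobi symbol (Gauss's lemma for the composite
-- modulus m, Eisenstein's lattice points, and Euler's criterion mod p); then ρ
-- and x² + 4py² take the same unit values mod 16p.

open import Defs
open import Algebra.Bundles using (CommutativeMonoid; CommutativeRing)
import Algebra.Properties.CommutativeMonoid.Sum as Summation
import Algebra.Properties.Semiring.Sum
open import Data.Fin.Base using (Fin; zero; suc; toℕ; fromℕ<)
open import Data.Fin.Patterns using (0F; 1F; 2F)
open import Data.Fin.Permutation using (Permutation′; permutation)
import Data.Fin.Properties as Fin
open import Data.Integer.Base using
  (ℤ; +_; -[1+_]; -_; _+_; _-_; _*_; _^_; ∣_∣; _◃_; _%ℕ_; _/ℕ_; NonZero; 0ℤ; 1ℤ; -1ℤ)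
import Data.Integer.Base as ℤ
open import Data.Integer.Coprimality using (Coprime)
import Data.Integer.Divisibility as Unsigned
open import Data.Integer.Divisibility.Signed
import Data.Integer.DivMod as ℤ
open import Data.Integer.GCD using (gcd; gcd-comm; gcd[i,j]∣i; gcd[i,j]∣j; gcd-greatest)
import Data.Integer.Properties as ℤ
open import Data.Integer.Tactic.RingSolver using (solve-∀)
open import Data.Nat.Base as ℕ using (ℕ; zero; suc; s≤s; z≤n; _≤_; _<_; _∸_)
import Data.Nat.Coprimality as ℕ
import Data.Nat.Divisibility as ℕ
import Data.Nat.DivMod as ℕ
import Data.Nat.GCD as ℕ
open import Data.Nat.Primality using
  (Prime; prime[2]; ¬prime[1]; euclidsLemma; irreducible[2]; prime⇒irreducible; prime⇒nonZero)
import Data.Nat.Properties as ℕ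
open import Data.Nat.Tactic.RingSolver using () renaming (solve-∀ to ℕ-solve-∀)
open import Data.Product.Base using (_×_; _,_; ∃-syntax; Σ-syntax; proj₁; proj₂)
open import Data.Rational.Base as ℚ using (ℚ)
import Data.Rational.Properties as ℚ
open import Data.Rational.Unnormalised.Base using (mkℚᵘ; *≡*)
open import Data.Sign.Base as Sign using (Sign)
import Data.Sign.Properties as Sign
open import Data.Sum.Base as ⊎ using (_⊎_; inj₁; inj₂; [_,_]′)
open import Data.Vec.Base as Vec using (Vec; replicate)
open import Data.Vec.Functional using (Vector; []; _∷_)
open import Function.Base using (_∘_; id; case_of_)
open import Function.Bundles using (mk⇔)
open import Relation.Binary.Bundles using (Setoid)
open import Relation.Binary.Definitions using (tri<; tri≈; tri>)
open import Relation.Binary.PropositionalEquality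
  using (_≡_; _≢_; refl; sym; trans; cong; cong₂; subst; subst₂; module ≡-Reasoning)
import Relation.Binary.Reasoning.Setoid as SetoidReasoning
open import Relation.Nullary.Decidable.Core using (Dec; yes; no)
open import Relation.Nullary.Negation.Core using (¬_; contradiction)

-- Whether `F` can have even diagonal is a question about ρ modulo 4. If `F` has rows (2x, y, u),
-- (y, 2z, v), (u, v, 2), the upper left block of its cofactors is a = 4z - v², t = uv - 2y, b = 4x
-- - u². Hence -ρ(X, Y) ≡ (vX - uY)² mod 4, and ρ takes no value congruent to 1 or 2.
--
-- For primitive forms of discriminant -16p the genus is described by two characters of the values
-- prime to 2p: the residue mod 4 and the quadratic character mod p. Reciprocity ties the two
-- together, so that a single value 1 mod 4 already forces the principal genus.
--
-- The obstacle is that a value m of ρ need not be prime, and choosing a prime one would take a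
-- theorem on primes represented by binary forms. Gauss's product of signs is therefore formed for
-- every odd modulus. Neither a factorisation of m nor multiplicativity of the symbol enters: the
-- symbol is evaluated directly on negated squares, reversed by counting lattice points, and
-- interpreted through squares only for the prime modulus p. With m ≡ 1 mod 4 the number h = (m -
-- 1)/2 is even, which removes all signs (-1)^h.

module Σℤ = Algebra.Properties.Semiring.Sum (CommutativeRing.semiring ℤ.+-*-commutativeRing)

-- Matrices

private variable
  d₁ d₂ d₃ d₄ : ℕ

≐-setoid : (m n : ℕ) → Setoid _ _
≐-setoid m n = record
  { Carrier       = Matrix m n
  ; _≈_           = _≐_
  ; isEquivalence = record
    { refl  = λ _ _ → refl
    ; sym   = λ e i j → sym (e i j)
    ; trans = λ e e′ i j → trans (e i j) (e′ i j)
    }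
  }

module ≐-Reasoning {m n : ℕ} = SetoidReasoning (≐-setoid m n)

≐-refl : {A : Matrix d₂ d₃} → A ≐ A
≐-refl _ _ = refl

≐-sym : {A B : Matrix d₂ d₃} → A ≐ B → B ≐ A
≐-sym e i j = sym (e i j)

≐-trans : {A B C : Matrix d₂ d₃} → A ≐ B → B ≐ C → A ≐ C
≐-trans e e′ i j = trans (e i j) (e′ i j)

ᵗ-cong : {A B : Matrix d₂ d₃} → A ≐ B → A ᵗ ≐ B ᵗ
ᵗ-cong e i j = e j i

⊗-cong : {A A′ : Matrix d₁ d₂} {B B′ : Matrix d₂ d₃} → A ≐ A′ → B ≐ B′ → A ⊗ B ≐ A′ ⊗ B′
⊗-cong e e′ i j = Σℤ.sum-cong-≗ λ k → cong₂ _*_ (e i k) (e′ k j)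

⊗-congˡ : (A : Matrix d₁ d₂) {B B′ : Matrix d₂ d₃} → B ≐ B′ → A ⊗ B ≐ A ⊗ B′
⊗-congˡ A = ⊗-cong {A = A} ≐-refl

⊗-congʳ : {A A′ : Matrix d₁ d₂} (B : Matrix d₂ d₃) → A ≐ A′ → A ⊗ B ≐ A′ ⊗ B
⊗-congʳ B e = ⊗-cong {B = B} e ≐-refl

⊗-assoc : (A : Matrix d₁ d₂) (B : Matrix d₂ d₃) (C : Matrix d₃ d₄) → (A ⊗ B) ⊗ C ≐ A ⊗ (B ⊗ C)
⊗-assoc A B C i j = begin
  Σℤ.sum (λ k → Σℤ.sum (λ h → A i h * B h k) * C k j)
    ≡⟨ Σℤ.sum-cong-≗ (λ k → Σℤ.*-distribʳ-sum (C k j) (λ h → A i h * B h k)) ⟩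
  Σℤ.sum (λ k → Σℤ.sum (λ h → A i h * B h k * C k j))
    ≡⟨ Σℤ.∑-comm (λ k h → A i h * B h k * C k j) ⟩
  Σℤ.sum (λ h → Σℤ.sum (λ k → A i h * B h k * C k j))
    ≡⟨ Σℤ.sum-cong-≗ (λ h → Σℤ.sum-cong-≗ λ k → ℤ.*-assoc (A i h) (B h k) (C k j)) ⟩
  Σℤ.sum (λ h → Σℤ.sum (λ k → A i h * (B h k * C k j)))
    ≡⟨ Σℤ.sum-cong-≗ (λ h → Σℤ.*-distribˡ-sum (A i h) (λ k → B h k * C k j)) ⟨
  Σℤ.sum (λ h → A i h * Σℤ.sum (λ k → B h k * C k j)) ∎
  where open ≡-Reasoning

ᵗ-⊗ : (A : Matrix d₁ d₂) (B : Matrix d₂ d₃) → (A ⊗ B) ᵗ ≐ B ᵗ ⊗ A ᵗ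
ᵗ-⊗ A B i j = Σℤ.sum-cong-≗ λ k → ℤ.*-comm (A j k) (B k i)

infixl 7 _∙_

_∙_ : ℤ → Matrix d₂ d₃ → Matrix d₂ d₃
(c ∙ A) i j = c * A i j

∙-cong : (c : ℤ) {A B : Matrix d₂ d₃} → A ≐ B → c ∙ A ≐ c ∙ B
∙-cong c e i j = cong (c *_) (e i j)

∙-⊗ : (c : ℤ) (A : Matrix d₁ d₂) (B : Matrix d₂ d₃) → (c ∙ A) ⊗ B ≐ c ∙ (A ⊗ B)
∙-⊗ c A B i j = begin
  Σℤ.sum (λ k → c * A i k * B k j)   ≡⟨ Σℤ.sum-cong-≗ (λ k → ℤ.*-assoc c (A i k) (B k j)) ⟩
  Σℤ.sum (λ k → c * (A i k * B k j)) ≡⟨ Σℤ.*-distribˡ-sum c (λ k → A i k * B k j) ⟨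
  c * Σℤ.sum (λ k → A i k * B k j)   ∎
  where open ≡-Reasoning

⊗-∙ : (c : ℤ) (A : Matrix d₁ d₂) (B : Matrix d₂ d₃) → A ⊗ (c ∙ B) ≐ c ∙ (A ⊗ B)
⊗-∙ c A B i j = begin
  Σℤ.sum (λ k → A i k * (c * B k j)) ≡⟨ Σℤ.sum-cong-≗ (λ k → lemma (A i k) c (B k j)) ⟩
  Σℤ.sum (λ k → c * (A i k * B k j)) ≡⟨ Σℤ.*-distribˡ-sum c (λ k → A i k * B k j) ⟨
  c * Σℤ.sum (λ k → A i k * B k j)   ∎
  where
  open ≡-Reasoning
  lemma : ∀ x y z → x * (y * z) ≡ y * (x * z)
  lemma = solve-∀

-- The Gram matrix of the rows of `P`; for unimodular `P` these rows are the new basis.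
congruence : (P : Matrix d₂ d₃) → Matrix d₃ d₃ → Matrix d₂ d₂
congruence P A = P ⊗ A ⊗ P ᵗ

congruence-cong : (P : Matrix d₂ d₃) {A B : Matrix d₃ d₃} → A ≐ B → congruence P A ≐ congruence P B
congruence-cong P e = ⊗-congʳ (P ᵗ) (⊗-congˡ P e)

congruence-∘ : (P : Matrix d₁ d₂) (Q : Matrix d₂ d₃) (A : Matrix d₃ d₃) →
               congruence (P ⊗ Q) A ≐ congruence P (congruence Q A)
congruence-∘ P Q A = begin
  P ⊗ Q ⊗ A ⊗ (P ⊗ Q) ᵗ     ≈⟨ ⊗-cong (⊗-assoc P Q A) (ᵗ-⊗ P Q) ⟩
  P ⊗ (Q ⊗ A) ⊗ (Q ᵗ ⊗ P ᵗ) ≈⟨ ⊗-assoc (P ⊗ (Q ⊗ A)) (Q ᵗ) (P ᵗ) ⟨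
  P ⊗ (Q ⊗ A) ⊗ Q ᵗ ⊗ P ᵗ   ≈⟨ ⊗-congʳ (P ᵗ) (⊗-assoc P (Q ⊗ A) (Q ᵗ)) ⟩
  P ⊗ (Q ⊗ A ⊗ Q ᵗ) ⊗ P ᵗ   ∎
  where open ≐-Reasoning

congruence-∙ : (c : ℤ) (P : Matrix d₂ d₃) (A : Matrix d₃ d₃) → congruence P (c ∙ A) ≐ c ∙ congruence P A
congruence-∙ c P A = ≐-trans (⊗-congʳ (P ᵗ) (⊗-∙ c P A)) (∙-⊗ c (P ⊗ A) (P ᵗ))

Symmetric : Matrix d₃ d₃ → Set
Symmetric A = A ᵗ ≐ A

congruence-sym : (P : Matrix d₂ d₃) {A : Matrix d₃ d₃} → Symmetric A → Symmetric (congruence P A)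
congruence-sym P {A} s = begin
  (P ⊗ A ⊗ P ᵗ) ᵗ ≈⟨ ᵗ-⊗ (P ⊗ A) (P ᵗ) ⟩
  P ⊗ (P ⊗ A) ᵗ   ≈⟨ ⊗-congˡ P (ᵗ-⊗ P A) ⟩
  P ⊗ (A ᵗ ⊗ P ᵗ) ≈⟨ ⊗-assoc P (A ᵗ) (P ᵗ) ⟨
  P ⊗ A ᵗ ⊗ P ᵗ   ≈⟨ congruence-cong P s ⟩
  P ⊗ A ⊗ P ᵗ     ∎
  where open ≐-Reasoning

𝟙 : Matrix 3 3
𝟙 = (1ℤ ∷ 0ℤ ∷ 0ℤ ∷ []) ∷ (0ℤ ∷ 1ℤ ∷ 0ℤ ∷ []) ∷ (0ℤ ∷ 0ℤ ∷ 1ℤ ∷ []) ∷ []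

⊗-identityˡ : (A : Matrix 3 d₃) → 𝟙 ⊗ A ≐ A
⊗-identityˡ A i j = lemma i
  where
  e₀ : ∀ x y z → 1ℤ * x + (0ℤ * y + (0ℤ * z + 0ℤ)) ≡ x
  e₀ = solve-∀
  e₁ : ∀ x y z → 0ℤ * x + (1ℤ * y + (0ℤ * z + 0ℤ)) ≡ y
  e₁ = solve-∀
  e₂ : ∀ x y z → 0ℤ * x + (0ℤ * y + (1ℤ * z + 0ℤ)) ≡ z
  e₂ = solve-∀
  lemma : ∀ i → (𝟙 ⊗ A) i j ≡ A i j
  lemma 0F = e₀ (A 0F j) (A 1F j) (A 2F j)
  lemma 1F = e₁ (A 0F j) (A 1F j) (A 2F j)
  lemma 2F = e₂ (A 0F j) (A 1F j) (A 2F j)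

𝟙-sym : Symmetric 𝟙
𝟙-sym 0F 0F = refl
𝟙-sym 0F 1F = refl
𝟙-sym 0F 2F = refl
𝟙-sym 1F 0F = refl
𝟙-sym 1F 1F = refl
𝟙-sym 1F 2F = refl
𝟙-sym 2F 0F = refl
𝟙-sym 2F 1F = refl
𝟙-sym 2F 2F = refl

⊗-identityʳ : (A : Matrix d₃ 3) → A ⊗ 𝟙 ≐ A
⊗-identityʳ A = ᵗ-cong (begin
  (A ⊗ 𝟙) ᵗ   ≈⟨ ᵗ-⊗ A 𝟙 ⟩
  𝟙 ᵗ ⊗ A ᵗ   ≈⟨ ⊗-congʳ (A ᵗ) 𝟙-sym ⟩
  𝟙 ⊗ A ᵗ     ≈⟨ ⊗-identityˡ (A ᵗ) ⟩
  A ᵗ         ∎)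
  where open ≐-Reasoning

congruence-𝟙 : (A : Matrix 3 3) → congruence 𝟙 A ≐ A
congruence-𝟙 A = ≐-trans (⊗-cong (⊗-identityˡ A) 𝟙-sym) (⊗-identityʳ A)

next : Fin 3 → Fin 3
next 0F = 1F
next 1F = 2F
next 2F = 0F

next³ : ∀ i → next (next (next i)) ≡ i
next³ 0F = refl
next³ 1F = refl
next³ 2F = refl

-- Indexing the minors cyclically absorbs the sign of the cofactor.
cofactor-cyclic : ∀ A i j → cofactor A i j ≡
  A (next i) (next j) * A (next (next i)) (next (next j)) -
  A (next i) (next (next j)) * A (next (next i)) (next j)
cofactor-cyclic A = λ where
    0F 0F → e₁ (A 1F 1F) (A 1F 2F) (A 2F 1F) (A 2F 2F)
    0F 1F → e₂ (A 1F 0F) (A 1F 2F) (A 2F 0F) (A 2F 2F)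
    0F 2F → e₁ (A 1F 0F) (A 1F 1F) (A 2F 0F) (A 2F 1F)
    1F 0F → e₃ (A 0F 1F) (A 0F 2F) (A 2F 1F) (A 2F 2F)
    1F 1F → e₄ (A 0F 0F) (A 0F 2F) (A 2F 0F) (A 2F 2F)
    1F 2F → e₃ (A 0F 0F) (A 0F 1F) (A 2F 0F) (A 2F 1F)
    2F 0F → e₁ (A 0F 1F) (A 0F 2F) (A 1F 1F) (A 1F 2F)
    2F 1F → e₂ (A 0F 0F) (A 0F 2F) (A 1F 0F) (A 1F 2F)
    2F 2F → e₁ (A 0F 0F) (A 0F 1F) (A 1F 0F) (A 1F 1F)
  where
  e₁ : ∀ a b c d → 1ℤ * (1ℤ * a * (1ℤ * d * 1ℤ + 0ℤ) + (-1ℤ * b * (1ℤ * c * 1ℤ + 0ℤ) + 0ℤ)) ≡ a * d - b * c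
  e₁ = solve-∀
  e₂ : ∀ a b c d → -1ℤ * (1ℤ * a * (1ℤ * d * 1ℤ + 0ℤ) + (-1ℤ * b * (1ℤ * c * 1ℤ + 0ℤ) + 0ℤ)) ≡ b * c - a * d
  e₂ = solve-∀
  e₃ : ∀ a b c d → -1ℤ * (1ℤ * a * (1ℤ * d * 1ℤ + 0ℤ) + (-1ℤ * b * (1ℤ * c * 1ℤ + 0ℤ) + 0ℤ)) ≡ c * b - d * a
  e₃ = solve-∀
  e₄ : ∀ a b c d → 1ℤ * (1ℤ * a * (1ℤ * d * 1ℤ + 0ℤ) + (-1ℤ * b * (1ℤ * c * 1ℤ + 0ℤ) + 0ℤ)) ≡ d * a - c * b
  e₄ = solve-∀

cofactor-cong : {A B : Matrix 3 3} → A ≐ B → cofactor A ≐ cofactor B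
cofactor-cong {A} {B} e i j = begin
  cofactor A i j                                            ≡⟨ cofactor-cyclic A i j ⟩
  A i₁ j₁ * A i₂ j₂ - A i₁ j₂ * A i₂ j₁
    ≡⟨ cong₂ _-_ (cong₂ _*_ (e i₁ j₁) (e i₂ j₂)) (cong₂ _*_ (e i₁ j₂) (e i₂ j₁)) ⟩
  B i₁ j₁ * B i₂ j₂ - B i₁ j₂ * B i₂ j₁                     ≡⟨ cofactor-cyclic B i j ⟨
  cofactor B i j                                            ∎
  where
  open ≡-Reasoning
  i₁ = next i
  i₂ = next i₁
  j₁ = next j
  j₂ = next j₁

cofactor-ᵗ : (A : Matrix 3 3) → cofactor (A ᵗ) ≐ cofactor A ᵗ
cofactor-ᵗ A i j = begin
  cofactor (A ᵗ) i j                     ≡⟨ cofactor-cyclic (A ᵗ) i j ⟩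
  A j₁ i₁ * A j₂ i₂ - A j₂ i₁ * A j₁ i₂
    ≡⟨ cong (λ x → A j₁ i₁ * A j₂ i₂ - x) (ℤ.*-comm (A j₂ i₁) (A j₁ i₂)) ⟩
  A j₁ i₁ * A j₂ i₂ - A j₁ i₂ * A j₂ i₁  ≡⟨ cofactor-cyclic A j i ⟨
  cofactor A j i                         ∎
  where
  open ≡-Reasoning
  i₁ = next i
  i₂ = next i₁
  j₁ = next j
  j₂ = next j₁

cofactor-sym : {A : Matrix 3 3} → Symmetric A → Symmetric (cofactor A)
cofactor-sym {A} s = ≐-trans (≐-sym (cofactor-ᵗ A)) (cofactor-cong s)

cofactor-∙ : (c : ℤ) (A : Matrix 3 3) → cofactor (c ∙ A) ≐ c * c ∙ cofactor A
cofactor-∙ c A i j = begin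
  cofactor (c ∙ A) i j                                    ≡⟨ cofactor-cyclic (c ∙ A) i j ⟩
  c * A i₁ j₁ * (c * A i₂ j₂) - c * A i₁ j₂ * (c * A i₂ j₁)
    ≡⟨ lemma c (A i₁ j₁) (A i₂ j₂) (A i₁ j₂) (A i₂ j₁) ⟩
  c * c * (A i₁ j₁ * A i₂ j₂ - A i₁ j₂ * A i₂ j₁)
    ≡⟨ cong (c * c *_) (cofactor-cyclic A i j) ⟨
  c * c * cofactor A i j                                  ∎
  where
  open ≡-Reasoning
  i₁ = next i
  i₂ = next i₁
  j₁ = next j
  j₂ = next j₁
  lemma : ∀ c x y z w → c * x * (c * y) - c * z * (c * w) ≡ c * c * (x * y - z * w)
  lemma = solve-∀

-- Cauchy-Binet for the 2 × 2 minors. With cyclic indices it is Lagrange's identity (a · c)(b · d) -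
-- (a · d)(b · c) = (a × b) · (c × d), which is `binet`.
cofactor-⊗ : (A B : Matrix 3 3) → cofactor (A ⊗ B) ≐ cofactor A ⊗ cofactor B
cofactor-⊗ A B i j = begin
  cofactor (A ⊗ B) i j
    ≡⟨ cofactor-cyclic (A ⊗ B) i j ⟩
  (A ⊗ B) i₁ j₁ * (A ⊗ B) i₂ j₂ - (A ⊗ B) i₁ j₂ * (A ⊗ B) i₂ j₁
    ≡⟨ binet (A i₁ 0F) (A i₁ 1F) (A i₁ 2F) (A i₂ 0F) (A i₂ 1F) (A i₂ 2F)
             (B 0F j₁) (B 1F j₁) (B 2F j₁) (B 0F j₂) (B 1F j₂) (B 2F j₂) ⟩
  Σℤ.sum (λ k →
    (A i₁ (next k) * A i₂ (next (next k)) - A i₁ (next (next k)) * A i₂ (next k)) *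
    (B (next k) j₁ * B (next (next k)) j₂ - B (next k) j₂ * B (next (next k)) j₁))
    ≡⟨ Σℤ.sum-cong-≗ (λ k → cong₂ _*_ (cofactor-cyclic A i k) (cofactor-cyclic B k j)) ⟨
  Σℤ.sum (λ k → cofactor A i k * cofactor B k j)
    ∎
  where
  open ≡-Reasoning
  i₁ = next i
  i₂ = next i₁
  j₁ = next j
  j₂ = next j₁
  binet : ∀ a₀ a₁ a₂ b₀ b₁ b₂ c₀ c₁ c₂ d₀ d₁ d₂ →
    (a₀ * c₀ + (a₁ * c₁ + (a₂ * c₂ + 0ℤ))) * (b₀ * d₀ + (b₁ * d₁ + (b₂ * d₂ + 0ℤ))) -
    (a₀ * d₀ + (a₁ * d₁ + (a₂ * d₂ + 0ℤ))) * (b₀ * c₀ + (b₁ * c₁ + (b₂ * c₂ + 0ℤ)))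
    ≡ (a₁ * b₂ - a₂ * b₁) * (c₁ * d₂ - d₁ * c₂) +
      ((a₂ * b₀ - a₀ * b₂) * (c₂ * d₀ - d₂ * c₀) +
      ((a₀ * b₁ - a₁ * b₀) * (c₀ * d₁ - d₀ * c₁) + 0ℤ))
  binet = solve-∀

-- The reciprocal form transforms by `cofactor P`, which is the inverse transpose of `P` when det P
-- = 1.
cofactor-congruence : (P A : Matrix 3 3) →
                      cofactor (congruence P A) ≐ congruence (cofactor P) (cofactor A)
cofactor-congruence P A = begin
  cofactor (P ⊗ A ⊗ P ᵗ)                      ≈⟨ cofactor-⊗ (P ⊗ A) (P ᵗ) ⟩
  cofactor (P ⊗ A) ⊗ cofactor (P ᵗ)           ≈⟨ ⊗-cong (cofactor-⊗ P A) (cofactor-ᵗ P) ⟩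
  cofactor P ⊗ cofactor A ⊗ cofactor P ᵗ      ∎
  where open ≐-Reasoning

det-expand : (A : Matrix 3 3) → det A ≡
  A 0F 0F * (A 1F 1F * A 2F 2F - A 1F 2F * A 2F 1F) +
  (A 0F 1F * (A 1F 2F * A 2F 0F - A 1F 0F * A 2F 2F) +
   A 0F 2F * (A 1F 0F * A 2F 1F - A 1F 1F * A 2F 0F))
det-expand A = lemma (A 0F 0F) (A 0F 1F) (A 0F 2F) (A 1F 0F) (A 1F 1F) (A 1F 2F) (A 2F 0F) (A 2F 1F) (A 2F 2F)
  where
  lemma : ∀ a b c d e f g h i →
    1ℤ * a * (1ℤ * e * (1ℤ * i * 1ℤ + 0ℤ) + (-1ℤ * f * (1ℤ * h * 1ℤ + 0ℤ) + 0ℤ)) +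
    (-1ℤ * b * (1ℤ * d * (1ℤ * i * 1ℤ + 0ℤ) + (-1ℤ * f * (1ℤ * g * 1ℤ + 0ℤ) + 0ℤ)) +
    (1ℤ * c * (1ℤ * d * (1ℤ * h * 1ℤ + 0ℤ) + (-1ℤ * e * (1ℤ * g * 1ℤ + 0ℤ) + 0ℤ)) + 0ℤ))
    ≡ a * (e * i - f * h) + (b * (f * g - d * i) + c * (d * h - e * g))
  lemma = solve-∀

det-cong : {A B : Matrix 3 3} → A ≐ B → det A ≡ det B
det-cong {A} {B} e = begin
  det A ≡⟨ det-expand A ⟩
  _     ≡⟨ cong₂ _+_ (term 0F 1F 2F) (cong₂ _+_ (term 1F 2F 0F) (term 2F 0F 1F)) ⟩
  _     ≡⟨ det-expand B ⟨
  det B ∎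
  where
  open ≡-Reasoning
  term : ∀ i j k → A 0F i * (A 1F j * A 2F k - A 1F k * A 2F j) ≡ B 0F i * (B 1F j * B 2F k - B 1F k * B 2F j)
  term i j k = cong₂ _*_ (e 0F i) (cong₂ _-_ (cong₂ _*_ (e 1F j) (e 2F k)) (cong₂ _*_ (e 1F k) (e 2F j)))

-- The cyclic sum may start at any column `j`, because that is the shape in which
-- `cofactor-cofactor` meets it.
laplace : (A : Matrix 3 3) → ∀ i j →
  A i j * cofactor A i j +
  (A i (next j) * cofactor A i (next j) +
   A i (next (next j)) * cofactor A i (next (next j))) ≡ det A
laplace A = λ where
    i 0F → along i
    i 1F → trans (rotate (A i 0F * cofactor A i 0F) (A i 1F * cofactor A i 1F) (A i 2F * cofactor A i 2F)) (along i)
    i 2F → trans (rotate (A i 1F * cofactor A i 1F) (A i 2F * cofactor A i 2F) (A i 0F * cofactor A i 0F))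
          (trans (rotate (A i 0F * cofactor A i 0F) (A i 1F * cofactor A i 1F) (A i 2F * cofactor A i 2F)) (along i))
  where
  open ≡-Reasoning
  rotate : ∀ x y z → y + (z + x) ≡ x + (y + z)
  rotate = solve-∀
  rows : ∀ a b c d e f g h i →
    d * (h * c - i * b) + (e * (i * a - g * c) + f * (g * b - h * a))
    ≡ a * (e * i - f * h) + (b * (f * g - d * i) + c * (d * h - e * g))
  rows = solve-∀
  rows′ : ∀ a b c d e f g h i →
    g * (b * f - c * e) + (h * (c * d - a * f) + i * (a * e - b * d))
    ≡ a * (e * i - f * h) + (b * (f * g - d * i) + c * (d * h - e * g))
  rows′ = solve-∀
  cyclic : ∀ i → A i 0F * cofactor A i 0F + (A i 1F * cofactor A i 1F + A i 2F * cofactor A i 2F) ≡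
    A i 0F * (A (next i) 1F * A (next (next i)) 2F - A (next i) 2F * A (next (next i)) 1F) +
    (A i 1F * (A (next i) 2F * A (next (next i)) 0F - A (next i) 0F * A (next (next i)) 2F) +
     A i 2F * (A (next i) 0F * A (next (next i)) 1F - A (next i) 1F * A (next (next i)) 0F))
  cyclic i = cong₂ _+_ (cong (A i 0F *_) (cofactor-cyclic A i 0F))
            (cong₂ _+_ (cong (A i 1F *_) (cofactor-cyclic A i 1F))
                       (cong (A i 2F *_) (cofactor-cyclic A i 2F)))
  along : ∀ i → A i 0F * cofactor A i 0F + (A i 1F * cofactor A i 1F + A i 2F * cofactor A i 2F) ≡ det A
  along 0F = trans (cyclic 0F) (sym (det-expand A))
  along 1F = trans (cyclic 1F) (trans
    (rows (A 0F 0F) (A 0F 1F) (A 0F 2F) (A 1F 0F) (A 1F 1F) (A 1F 2F) (A 2F 0F) (A 2F 1F) (A 2F 2F))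
    (sym (det-expand A)))
  along 2F = trans (cyclic 2F) (trans
    (rows′ (A 0F 0F) (A 0F 1F) (A 0F 2F) (A 1F 0F) (A 1F 1F) (A 1F 2F) (A 2F 0F) (A 2F 1F) (A 2F 2F))
    (sym (det-expand A)))

⊗-cofactor : (A : Matrix 3 3) → A ⊗ cofactor A ᵗ ≐ det A ∙ 𝟙
⊗-cofactor A = λ where
    0F 0F → diagonal 0F
    1F 1F → diagonal 1F
    2F 2F → diagonal 2F
    0F 1F → vanish₂ 1F
    1F 2F → vanish₂ 2F
    2F 0F → vanish₂ 0F
    1F 0F → vanish₁ 0F
    2F 1F → vanish₁ 1F
    0F 2F → vanish₁ 2F
  where
  open ≡-Reasoning
  unit : ∀ x y z → x + (y + (z + 0ℤ)) ≡ (x + (y + z)) * 1ℤ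
  unit = solve-∀
  diagonal : ∀ i → (A ⊗ cofactor A ᵗ) i i ≡ det A * 1ℤ
  diagonal i = trans
    (unit (A i 0F * cofactor A i 0F) (A i 1F * cofactor A i 1F) (A i 2F * cofactor A i 2F))
    (cong (_* 1ℤ) (laplace A i 0F))
  cyclic : ∀ i j → (A ⊗ cofactor A ᵗ) i j ≡ Σℤ.sum (λ k → A i k *
    (A (next j) (next k) * A (next (next j)) (next (next k)) -
     A (next j) (next (next k)) * A (next (next j)) (next k)))
  cyclic i j = Σℤ.sum-cong-≗ λ k → cong (A i k *_) (cofactor-cyclic A j k)
  e₁ : ∀ w a b c x y z →
    a * (b * z - c * y) + (b * (c * x - a * z) + (c * (a * y - b * x) + 0ℤ)) ≡ w * 0ℤ
  e₁ = solve-∀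
  e₂ : ∀ w a b c x y z →
    a * (y * c - z * b) + (b * (z * a - x * c) + (c * (x * b - y * a) + 0ℤ)) ≡ w * 0ℤ
  e₂ = solve-∀
  vanish₁ : ∀ j → (A ⊗ cofactor A ᵗ) (next j) j ≡ det A * 0ℤ
  vanish₁ j = trans (cyclic (next j) j)
    (e₁ (det A) (A (next j) 0F) (A (next j) 1F) (A (next j) 2F)
                (A (next (next j)) 0F) (A (next (next j)) 1F) (A (next (next j)) 2F))
  vanish₂ : ∀ j → (A ⊗ cofactor A ᵗ) (next (next j)) j ≡ det A * 0ℤ
  vanish₂ j = trans (cyclic (next (next j)) j)
    (e₂ (det A) (A (next (next j)) 0F) (A (next (next j)) 1F) (A (next (next j)) 2F)
                (A (next j) 0F) (A (next j) 1F) (A (next j) 2F))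

det-ᵗ : (A : Matrix 3 3) → det (A ᵗ) ≡ det A
det-ᵗ A = trans (det-expand (A ᵗ)) (trans
  (lemma (A 0F 0F) (A 0F 1F) (A 0F 2F) (A 1F 0F) (A 1F 1F) (A 1F 2F) (A 2F 0F) (A 2F 1F) (A 2F 2F))
  (sym (det-expand A)))
  where
  lemma : ∀ a b c d e f g h i →
    a * (e * i - h * f) + (d * (h * c - b * i) + g * (b * f - e * c))
    ≡ a * (e * i - f * h) + (b * (f * g - d * i) + c * (d * h - e * g))
  lemma = solve-∀

ᵗ-⊗-cofactor : (A : Matrix 3 3) → A ᵗ ⊗ cofactor A ≐ det A ∙ 𝟙
ᵗ-⊗-cofactor A = begin
  A ᵗ ⊗ cofactor A           ≈⟨ ⊗-congˡ (A ᵗ) (ᵗ-cong (cofactor-ᵗ A)) ⟨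
  A ᵗ ⊗ cofactor (A ᵗ) ᵗ     ≈⟨ ⊗-cofactor (A ᵗ) ⟩
  det (A ᵗ) ∙ 𝟙              ≈⟨ (λ i j → cong (_* 𝟙 i j) (det-ᵗ A)) ⟩
  det A ∙ 𝟙                  ∎
  where open ≐-Reasoning

-- Since adj(AB) = adj B adj A, the product AB adj(AB) collapses from the inside to det B · det A ·
-- 𝟙, and one diagonal entry gives the claim. This avoids a polynomial identity in eighteen
-- variables.
det-⊗ : (A B : Matrix 3 3) → det (A ⊗ B) ≡ det A * det B
det-⊗ A B = trans (trans (sym (ℤ.*-identityʳ _)) (product 0F 0F)) (lemma (det B) (det A))
  where
  open ≐-Reasoning
  lemma : ∀ x y → x * (y * 1ℤ) ≡ y * x
  lemma = solve-∀
  product : det (A ⊗ B) ∙ 𝟙 ≐ det B ∙ (det A ∙ 𝟙)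
  product = begin
    det (A ⊗ B) ∙ 𝟙
      ≈⟨ ⊗-cofactor (A ⊗ B) ⟨
    A ⊗ B ⊗ cofactor (A ⊗ B) ᵗ
      ≈⟨ ⊗-congˡ (A ⊗ B) (≐-trans (ᵗ-cong (cofactor-⊗ A B)) (ᵗ-⊗ (cofactor A) (cofactor B))) ⟩
    A ⊗ B ⊗ (cofactor B ᵗ ⊗ cofactor A ᵗ)
      ≈⟨ ⊗-assoc (A ⊗ B) (cofactor B ᵗ) (cofactor A ᵗ) ⟨
    A ⊗ B ⊗ cofactor B ᵗ ⊗ cofactor A ᵗ
      ≈⟨ ⊗-congʳ (cofactor A ᵗ) (⊗-assoc A B (cofactor B ᵗ)) ⟩
    A ⊗ (B ⊗ cofactor B ᵗ) ⊗ cofactor A ᵗ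
      ≈⟨ ⊗-congʳ (cofactor A ᵗ) (⊗-congˡ A (⊗-cofactor B)) ⟩
    A ⊗ (det B ∙ 𝟙) ⊗ cofactor A ᵗ
      ≈⟨ ⊗-congʳ (cofactor A ᵗ) (≐-trans (⊗-∙ (det B) A 𝟙) (∙-cong (det B) (⊗-identityʳ A))) ⟩
    det B ∙ A ⊗ cofactor A ᵗ
      ≈⟨ ∙-⊗ (det B) A (cofactor A ᵗ) ⟩
    det B ∙ (A ⊗ cofactor A ᵗ)
      ≈⟨ ∙-cong (det B) (⊗-cofactor A) ⟩
    det B ∙ (det A ∙ 𝟙) ∎

-- Jacobi's identity on minors of the adjugate, proved as a polynomial identity and not by
-- cancelling det A. The second factor det A is recognised as a Laplace expansion along row `i`.
cofactor-cofactor : (A : Matrix 3 3) → cofactor (cofactor A) ≐ det A ∙ A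
cofactor-cofactor A i j = begin
  cofactor C i j
    ≡⟨ cofactor-cyclic C i j ⟩
  C i₁ j₁ * C i₂ j₂ - C i₁ j₂ * C i₂ j₁
    ≡⟨ cong₂ _-_ (cong₂ _*_ c₁₁ c₂₂) (cong₂ _*_ c₁₂ c₂₁) ⟩
  (A i₂ j₂ * A i j - A i₂ j * A i j₂) * (A i j * A i₁ j₁ - A i j₁ * A i₁ j) -
  (A i₂ j * A i j₁ - A i₂ j₁ * A i j) * (A i j₂ * A i₁ j - A i j * A i₁ j₂)
    ≡⟨ lemma (A i j) (A i j₁) (A i j₂) (A i₁ j) (A i₁ j₁) (A i₁ j₂) (A i₂ j) (A i₂ j₁) (A i₂ j₂) ⟩
  (A i j * (A i₁ j₁ * A i₂ j₂ - A i₁ j₂ * A i₂ j₁) +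
  (A i j₁ * (A i₁ j₂ * A i₂ j - A i₁ j * A i₂ j₂) +
   A i j₂ * (A i₁ j * A i₂ j₁ - A i₁ j₁ * A i₂ j))) * A i j
    ≡⟨ cong (_* A i j) (cong₂ _+_ (cong (A i j *_) (cofactor-cyclic A i j))
                       (cong₂ _+_ (cong (A i j₁ *_) c₀₁) (cong (A i j₂ *_) c₀₂))) ⟨
  (A i j * C i j + (A i j₁ * C i j₁ + A i j₂ * C i j₂)) * A i j
    ≡⟨ cong (_* A i j) (laplace A i j) ⟩
  det A * A i j ∎
  where
  open ≡-Reasoning
  C = cofactor A
  i₁ = next i
  i₂ = next i₁
  j₁ = next j
  j₂ = next j₁
  -- The shifted indices come with equations because `next (next (next i))` does not reduce to `i`
  -- for a variable `i`.
  cyc : ∀ i j {i₁ i₂ j₁ j₂} → next i ≡ i₁ → next i₁ ≡ i₂ → next j ≡ j₁ → next j₁ ≡ j₂ →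
        C i j ≡ A i₁ j₁ * A i₂ j₂ - A i₁ j₂ * A i₂ j₁
  cyc i j refl refl refl refl = cofactor-cyclic A i j
  c₁₁ = cyc i₁ j₁ refl (next³ i) refl (next³ j)
  c₁₂ = cyc i₁ j₂ refl (next³ i) (next³ j) refl
  c₂₁ = cyc i₂ j₁ (next³ i) refl refl (next³ j)
  c₂₂ = cyc i₂ j₂ (next³ i) refl (next³ j) refl
  c₀₁ = cyc i j₁ refl refl refl (next³ j)
  c₀₂ = cyc i j₂ refl refl (next³ j) refl
  lemma : ∀ a b c d e f g h k →
    (k * a - g * c) * (a * e - b * d) - (g * b - h * a) * (c * d - a * f)
    ≡ (a * (e * k - f * h) + (b * (f * g - d * k) + c * (d * h - e * g))) * a
  lemma = solve-∀

-- Divisibility and greatest common divisors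

∣i∣-multiple : ∀ i → ∃[ s ] + ∣ i ∣ ≡ s * i
∣i∣-multiple (+ n)      = 1ℤ , sym (ℤ.*-identityˡ (+ n))
∣i∣-multiple i@(-[1+ _ ]) = -1ℤ , sym (ℤ.-1*i≡-i i)

bézout : ∀ i j → ∃[ x ] ∃[ y ] x * i + y * j ≡ gcd i j
bézout i j with ∣i∣-multiple i | ∣i∣-multiple j | ℕ.Bézout.identity (ℕ.gcd-GCD ∣ i ∣ ∣ j ∣)
... | s , ∣i∣≡ | r , ∣j∣≡ | ℕ.Bézout.+- x y eq = + x * s , - (+ y * r) , (begin
  + x * s * i + - (+ y * r) * j ≡⟨ lemma (+ x) s i (+ y) r j ⟩
  + x * (s * i) - + y * (r * j) ≡⟨ cong₂ (λ a b → + x * a - + y * b) ∣i∣≡ ∣j∣≡ ⟨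
  + x * + ∣ i ∣ - + y * + ∣ j ∣
    ≡⟨ cong (λ e → e - + y * + ∣ j ∣) (trans (sym (ℤ.pos-* x ∣ i ∣)) (trans (cong +_ (sym eq))
         (trans (ℤ.pos-+ d (y ℕ.* ∣ j ∣)) (cong (λ b → + d + b) (ℤ.pos-* y ∣ j ∣))))) ⟩
  + d + + y * + ∣ j ∣ - + y * + ∣ j ∣ ≡⟨ cancel (+ d) (+ y * + ∣ j ∣) ⟩
  + d ∎)
  where
  open ≡-Reasoning
  d = ℕ.gcd ∣ i ∣ ∣ j ∣
  lemma : ∀ x s i y r j → x * s * i + - (y * r) * j ≡ x * (s * i) - y * (r * j)
  lemma = solve-∀
  cancel : ∀ x y → x + y - y ≡ x
  cancel = solve-∀
... | s , ∣i∣≡ | r , ∣j∣≡ | ℕ.Bézout.-+ x y eq = - (+ x * s) , + y * r , (begin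
  - (+ x * s) * i + + y * r * j ≡⟨ lemma (+ x) s i (+ y) r j ⟩
  + y * (r * j) - + x * (s * i) ≡⟨ cong₂ (λ a b → + y * b - + x * a) ∣i∣≡ ∣j∣≡ ⟨
  + y * + ∣ j ∣ - + x * + ∣ i ∣
    ≡⟨ cong (λ e → e - + x * + ∣ i ∣) (trans (sym (ℤ.pos-* y ∣ j ∣)) (trans (cong +_ (sym eq))
         (trans (ℤ.pos-+ d (x ℕ.* ∣ i ∣)) (cong (λ b → + d + b) (ℤ.pos-* x ∣ i ∣))))) ⟩
  + d + + x * + ∣ i ∣ - + x * + ∣ i ∣ ≡⟨ cancel (+ d) (+ x * + ∣ i ∣) ⟩
  + d ∎)
  where
  open ≡-Reasoning
  d = ℕ.gcd ∣ i ∣ ∣ j ∣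
  lemma : ∀ x s i y r j → - (x * s) * i + y * r * j ≡ y * (r * j) - x * (s * i)
  lemma = solve-∀
  cancel : ∀ x y → x + y - y ≡ x
  cancel = solve-∀

gcds-bézout : (v : Vector ℤ d₃) → Σ[ w ∈ Vector ℤ d₃ ] Σℤ.sum (λ i → w i * v i) ≡ gcds v
gcds-bézout {zero}  v = [] , refl
gcds-bézout {suc _} v = (x ∷ λ i → y * w i) , (begin
  x * v zero + Σℤ.sum (λ i → y * w i * v (suc i))
    ≡⟨ cong (λ e → x * v zero + e) (Σℤ.sum-cong-≗ λ i → ℤ.*-assoc y (w i) (v (suc i))) ⟩
  x * v zero + Σℤ.sum (λ i → y * (w i * v (suc i)))
    ≡⟨ cong (λ e → x * v zero + e) (Σℤ.*-distribˡ-sum y (λ i → w i * v (suc i))) ⟨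
  x * v zero + y * Σℤ.sum (λ i → w i * v (suc i))
    ≡⟨ cong (λ d → x * v zero + y * d) (proj₂ tail-bézout) ⟩
  x * v zero + y * gcds (v ∘ suc)
    ≡⟨ proj₂ (proj₂ head-bézout) ⟩
  gcds v ∎)
  where
  open ≡-Reasoning
  tail-bézout = gcds-bézout (v ∘ suc)
  w = proj₁ tail-bézout
  head-bézout = bézout (v zero) (gcds (v ∘ suc))
  x = proj₁ head-bézout
  y = proj₁ (proj₂ head-bézout)

gcds-∣ : (v : Vector ℤ d₃) → ∀ i → gcds v ∣ v i
gcds-∣ v zero    = ∣ᵤ⇒∣ (gcd[i,j]∣i (v zero) (gcds (v ∘ suc)))
gcds-∣ v (suc i) = ∣-trans (∣ᵤ⇒∣ (gcd[i,j]∣j (v zero) (gcds (v ∘ suc)))) (gcds-∣ (v ∘ suc) i)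

gcds-greatest : (v : Vector ℤ d₃) {c : ℤ} → (∀ i → c ∣ v i) → c ∣ gcds v
gcds-greatest {zero}  v c∣v = divides 0ℤ refl
gcds-greatest {suc _} v {c} c∣v = ∣ᵤ⇒∣ (gcd-greatest {v zero} {gcds (v ∘ suc)} {c}
  (∣⇒∣ᵤ (c∣v zero)) (∣⇒∣ᵤ (gcds-greatest (v ∘ suc) (c∣v ∘ suc))))

gcds-nonNegative : (v : Vector ℤ d₃) → gcds v ≡ + ∣ gcds v ∣
gcds-nonNegative {zero}  v = refl
gcds-nonNegative {suc _} v = refl

gcds-unique : (v : Vector ℤ d₃) (d : ℕ) → gcds v ∣ + d → (∀ i → + d ∣ v i) → gcds v ≡ + d
gcds-unique v d v∣d d∣v = trans (gcds-nonNegative v)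
  (cong +_ (ℕ.∣-antisym (∣⇒∣ᵤ v∣d) (∣⇒∣ᵤ (gcds-greatest v d∣v))))

gcds²-∣ : (A : Matrix d₂ d₃) → ∀ i j → gcds (λ i → gcds (A i)) ∣ A i j
gcds²-∣ A i j = ∣-trans (gcds-∣ (λ i → gcds (A i)) i) (gcds-∣ (A i) j)

gcds²-greatest : (A : Matrix d₂ d₃) {c : ℤ} → (∀ i j → c ∣ A i j) → c ∣ gcds (λ i → gcds (A i))
gcds²-greatest A c∣A = gcds-greatest _ λ i → gcds-greatest (A i) (c∣A i)

gcds²-unique : (A : Matrix d₂ d₃) (d : ℕ) → gcds (λ i → gcds (A i)) ∣ + d → (∀ i j → + d ∣ A i j) →
               gcds (λ i → gcds (A i)) ≡ + d
gcds²-unique A d A∣d d∣A = gcds-unique _ d A∣d λ i → gcds-greatest (A i) (d∣A i)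

euclid : ∀ {p} → Prime p → ∀ i j → + p ∣ i * j → (+ p ∣ i) ⊎ (+ p ∣ j)
euclid {p} pr i j p∣ij = ⊎.map ∣ᵤ⇒∣ ∣ᵤ⇒∣
  (euclidsLemma ∣ i ∣ ∣ j ∣ pr (subst (p ℕ.∣_) (ℤ.abs-* i j) (∣⇒∣ᵤ p∣ij)))

∣2⇒ : ∀ c → c ∣ + 2 → ∣ c ∣ ≡ 1 ⊎ ∣ c ∣ ≡ 2
∣2⇒ c c∣2 = irreducible[2] (∣⇒∣ᵤ c∣2)

∣c∣≡1⇒c∣1 : ∀ c → ∣ c ∣ ≡ 1 → c ∣ 1ℤ
∣c∣≡1⇒c∣1 c eq = ∣ᵤ⇒∣ (ℕ.∣-reflexive eq)

2∤prime : ∀ {p} → Prime p → 3 ℕ.≤ p → ¬ (+ 2 ∣ + p)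
2∤prime {p} pr 3≤p 2∣p with prime⇒irreducible pr (∣⇒∣ᵤ 2∣p)
... | inj₁ ()
... | inj₂ refl = case 3≤p of λ { (s≤s (s≤s ())) }

prime∤2 : ∀ {p} → Prime p → 3 ℕ.≤ p → ¬ (+ p ∣ + 2)
prime∤2 {p} pr 3≤p p∣2 = ℕ.<⇒≱ 3≤p (ℕ.∣⇒≤ (∣⇒∣ᵤ p∣2))

even-difference : ∀ i j → + 2 ∣ i * i - j * j → + 2 ∣ i - j
even-difference i j 2∣ with euclid prime[2] (i - j) (i + j) (subst (+ 2 ∣_) (lemma i j) 2∣)
  where
  lemma : ∀ i j → i * i - j * j ≡ (i - j) * (i + j)
  lemma = solve-∀
... | inj₁ 2∣i-j = 2∣i-j
... | inj₂ 2∣i+j = subst (+ 2 ∣_) (lemma i j) (∣m∣n⇒∣m-n 2∣i+j (∣n⇒∣m*n j ∣-refl))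
  where
  lemma : ∀ i j → i + j - j * + 2 ≡ i - j
  lemma = solve-∀

-- Reciprocal forms

∙-cancel : ∀ {m n} (c : ℤ) .{{_ : NonZero c}} {A B : Matrix m n} → c ∙ A ≐ c ∙ B → A ≐ B
∙-cancel c e i j = ℤ.*-cancelˡ-≡ c _ _ (e i j)

∙-assoc : ∀ {m n} (c d : ℤ) (A : Matrix m n) → c ∙ (d ∙ A) ≐ c * d ∙ A
∙-assoc c d A i j = sym (ℤ.*-assoc c d (A i j))

matrix-sym : (f : TernaryForm) → Symmetric (matrix f)
matrix-sym f = λ where
    0F 0F → refl
    0F 1F → refl
    0F 2F → refl
    1F 0F → refl
    1F 1F → refl
    1F 2F → refl
    2F 0F → refl
    2F 1F → refl
    2F 2F → refl

form : Matrix 3 3 → TernaryForm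
form A = ternary (A 0F 0F) (A 1F 1F) (A 2F 2F) (A 1F 2F) (A 0F 2F) (A 0F 1F)

matrix-form : {A : Matrix 3 3} → Symmetric A → matrix (form A) ≐ A
matrix-form s = λ where
    0F 0F → refl
    0F 1F → refl
    0F 2F → refl
    1F 0F → s 1F 0F
    1F 1F → refl
    1F 2F → refl
    2F 0F → s 2F 0F
    2F 1F → s 2F 1F
    2F 2F → refl

-- F is the matrix of the reciprocal of a form with matrix A and invariants (k, 1).
record Reciprocal (k : ℤ) (A F : Matrix 3 3) : Set where
  field
    symmetric  : Symmetric A
    cofactor-A : cofactor A ≐ k ∙ F
    det-A      : det A ≡ k * k

module _ {k : ℤ} .{{_ : NonZero k}} {A F : Matrix 3 3} (r : Reciprocal k A F) where
  open Reciprocal r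

  -- Take cofactors in adj A = kF: one side becomes k² adj F, the other det A · A = k² A.
  reciprocal-cofactor : cofactor F ≐ A
  reciprocal-cofactor = ∙-cancel k (∙-cancel k (begin
    k ∙ (k ∙ cofactor F)    ≈⟨ ∙-assoc k k (cofactor F) ⟩
    k * k ∙ cofactor F      ≈⟨ cofactor-∙ k F ⟨
    cofactor (k ∙ F)        ≈⟨ cofactor-cong cofactor-A ⟨
    cofactor (cofactor A)   ≈⟨ cofactor-cofactor A ⟩
    det A ∙ A               ≈⟨ (λ i j → cong (_* A i j) det-A) ⟩
    k * k ∙ A               ≈⟨ ∙-assoc k k A ⟨
    k ∙ (k ∙ A)             ∎))
    where open ≐-Reasoning

  reciprocal-sym : Symmetric F
  reciprocal-sym = ∙-cancel k (begin
    k ∙ F ᵗ        ≈⟨ ᵗ-cong cofactor-A ⟨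
    cofactor A ᵗ   ≈⟨ cofactor-sym symmetric ⟩
    cofactor A     ≈⟨ cofactor-A ⟩
    k ∙ F          ∎)
    where open ≐-Reasoning

  -- det F is the (0, 0) entry of F adj F, hence of A F because adj F = A; and k times A F is A adj
  -- A = k² 𝟙.
  reciprocal-det : det F ≡ k
  reciprocal-det = begin
    det F
      ≡⟨ ℤ.*-identityʳ (det F) ⟨
    det F * 1ℤ
      ≡⟨ ⊗-cofactor F 0F 0F ⟨
    Σℤ.sum (λ i → F 0F i * cofactor F 0F i)
      ≡⟨ Σℤ.sum-cong-≗ (λ i → trans (cong (F 0F i *_) (reciprocal-cofactor 0F i)) (ℤ.*-comm (F 0F i) (A 0F i))) ⟩
    Σℤ.sum (λ i → A 0F i * F 0F i)
      ≡⟨ ℤ.*-cancelˡ-≡ k _ _ scaled ⟩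
    k ∎
    where
    open ≡-Reasoning
    scaled : k * Σℤ.sum (λ i → A 0F i * F 0F i) ≡ k * k
    scaled = begin
      k * Σℤ.sum (λ i → A 0F i * F 0F i)          ≡⟨ ⊗-∙ k A (F ᵗ) 0F 0F ⟨
      Σℤ.sum (λ i → A 0F i * (k * F 0F i))
        ≡⟨ Σℤ.sum-cong-≗ (λ i → cong (A 0F i *_) (cofactor-A 0F i)) ⟨
      Σℤ.sum (λ i → A 0F i * cofactor A 0F i)     ≡⟨ ⊗-cofactor A 0F 0F ⟩
      det A * 1ℤ                                  ≡⟨ ℤ.*-identityʳ (det A) ⟩
      det A                                       ≡⟨ det-A ⟩
      k * k                                       ∎

  reciprocal-congruence : (P : Matrix 3 3) → det P ≡ 1ℤ →
                          Reciprocal k (congruence P A) (congruence (cofactor P) F)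
  reciprocal-congruence P det-P = record
    { symmetric  = congruence-sym P symmetric
    ; cofactor-A = begin
        cofactor (congruence P A)               ≈⟨ cofactor-congruence P A ⟩
        congruence (cofactor P) (cofactor A)    ≈⟨ congruence-cong (cofactor P) cofactor-A ⟩
        congruence (cofactor P) (k ∙ F)         ≈⟨ congruence-∙ k (cofactor P) F ⟩
        k ∙ congruence (cofactor P) F           ∎
    ; det-A      = det-congruence
    }
    where
    open ≐-Reasoning
    lemma : ∀ x → 1ℤ * x * 1ℤ ≡ x
    lemma = solve-∀
    det-congruence : det (congruence P A) ≡ k * k
    det-congruence =
      trans (det-⊗ (P ⊗ A) (P ᵗ))
      (trans (cong₂ _*_ (trans (det-⊗ P A) (cong (_* det A) det-P)) (trans (det-ᵗ P) det-P))
      (trans (lemma (det A)) det-A))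

-- Expand along the new row: its cofactors are, up to alternating sign, the three minors of `M`, so
-- Bézout coefficients of these minors with the middle sign reversed make the determinant equal to
-- their gcd.
extend : (M : Matrix 3 2) → gcds {3} (λ i → det (deleteRow i M)) ≡ 1ℤ →
         Σ[ r ∈ Vector ℤ 3 ] det ((λ i → M i 0F) ∷ (λ i → M i 1F) ∷ r ∷ []) ≡ 1ℤ
extend M coprime = r , (begin
  det ((λ i → M i 0F) ∷ (λ i → M i 1F) ∷ r ∷ [])
    ≡⟨ det-expand ((λ i → M i 0F) ∷ (λ i → M i 1F) ∷ r ∷ []) ⟩
  _
    ≡⟨ lemma (M 0F 0F) (M 1F 0F) (M 2F 0F) (M 0F 1F) (M 1F 1F) (M 2F 1F) (w 0F) (w 1F) (w 2F) ⟩
  Σℤ.sum (λ i → w i * det (deleteRow i M))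
    ≡⟨ proj₂ relation ⟩
  gcds {3} (λ i → det (deleteRow i M))
    ≡⟨ coprime ⟩
  1ℤ ∎)
  where
  open ≡-Reasoning
  relation = gcds-bézout {3} (λ i → det (deleteRow i M))
  w = proj₁ relation
  r : Vector ℤ 3
  r = w 0F ∷ - w 1F ∷ w 2F ∷ []
  lemma : ∀ a b c d e f x y z →
    a * (e * z - f * - y) + (b * (f * x - d * z) + c * (d * - y - e * x))
    ≡ x * (1ℤ * b * (1ℤ * f * 1ℤ + 0ℤ) + (-1ℤ * e * (1ℤ * c * 1ℤ + 0ℤ) + 0ℤ)) +
      (y * (1ℤ * a * (1ℤ * f * 1ℤ + 0ℤ) + (-1ℤ * d * (1ℤ * c * 1ℤ + 0ℤ) + 0ℤ)) +
      (z * (1ℤ * a * (1ℤ * e * 1ℤ + 0ℤ) + (-1ℤ * d * (1ℤ * b * 1ℤ + 0ℤ) + 0ℤ)) + 0ℤ))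
  lemma = solve-∀

HasBlock : (a t b : ℤ) → Matrix 3 3 → Set
HasBlock a t b A = A 0F 0F ≡ a × A 0F 1F ≡ t × A 1F 1F ≡ b

module _ {k a t b : ℤ} .{{_ : NonZero k}} (ab-t²≡2k : a * b - t * t ≡ + 2 * k)
         {A F : Matrix 3 3} (r : Reciprocal k A F) (block : HasBlock a t b A) where
  open Reciprocal r

  private
    A₀₀ : A 0F 0F ≡ a
    A₀₀ = proj₁ block
    A₀₁ : A 0F 1F ≡ t
    A₀₁ = proj₁ (proj₂ block)
    A₁₁ : A 1F 1F ≡ b
    A₁₁ = proj₂ (proj₂ block)
    open ≡-Reasoning

  -- The (2, 2) entry of adj A = kF. Here the discriminant of ρ meets the invariant Ω: the minor ab
  -- - t² = 4p is twice k = 2p.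
  reciprocal-22 : F 2F 2F ≡ + 2
  reciprocal-22 = ℤ.*-cancelˡ-≡ k _ _ (begin
    k * F 2F 2F                             ≡⟨ cofactor-A 2F 2F ⟨
    cofactor A 2F 2F                        ≡⟨ cofactor-cyclic A 2F 2F ⟩
    A 0F 0F * A 1F 1F - A 0F 1F * A 1F 0F
      ≡⟨ cong₂ _-_ (cong₂ _*_ A₀₀ A₁₁) (cong₂ _*_ A₀₁ (trans (symmetric 0F 1F) A₀₁)) ⟩
    a * b - t * t                           ≡⟨ ab-t²≡2k ⟩
    + 2 * k                                 ≡⟨ ℤ.*-comm (+ 2) k ⟩
    k * + 2                                 ∎)

  -- The (1, 1) entry of adj F = A, with 2 put for F₂₂. The next two lemmas read the entries (0, 0)
  -- and (0, 1) in the same way; F₀₀ is thus paired with `b`, and F₁₁ with `a`.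
  reciprocal-00 : + 2 * F 0F 0F ≡ b + F 0F 2F * F 0F 2F
  reciprocal-00 = begin
    + 2 * F 0F 0F
      ≡⟨ lemma (F 0F 0F) (F 0F 2F) ⟩
    + 2 * F 0F 0F - F 0F 2F * F 0F 2F + F 0F 2F * F 0F 2F
      ≡⟨ cong (λ c → c + F 0F 2F * F 0F 2F) (cong₂ (λ c d → c * F 0F 0F - d * F 0F 2F)
           reciprocal-22 (reciprocal-sym r 0F 2F)) ⟨
    F 2F 2F * F 0F 0F - F 2F 0F * F 0F 2F + F 0F 2F * F 0F 2F
      ≡⟨ cong (λ c → c + F 0F 2F * F 0F 2F) (cofactor-cyclic F 1F 1F) ⟨
    cofactor F 1F 1F + F 0F 2F * F 0F 2F
      ≡⟨ cong (λ c → c + F 0F 2F * F 0F 2F) (trans (reciprocal-cofactor r 1F 1F) A₁₁) ⟩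
    b + F 0F 2F * F 0F 2F ∎
    where
    lemma : ∀ x u → + 2 * x ≡ + 2 * x - u * u + u * u
    lemma = solve-∀

  reciprocal-11 : + 2 * F 1F 1F ≡ a + F 1F 2F * F 1F 2F
  reciprocal-11 = begin
    + 2 * F 1F 1F
      ≡⟨ lemma (F 1F 1F) (F 1F 2F) ⟩
    F 1F 1F * + 2 - F 1F 2F * F 1F 2F + F 1F 2F * F 1F 2F
      ≡⟨ cong (λ c → c + F 1F 2F * F 1F 2F) (cong₂ (λ c d → F 1F 1F * c - F 1F 2F * d)
           reciprocal-22 (reciprocal-sym r 1F 2F)) ⟨
    F 1F 1F * F 2F 2F - F 1F 2F * F 2F 1F + F 1F 2F * F 1F 2F
      ≡⟨ cong (λ c → c + F 1F 2F * F 1F 2F) (cofactor-cyclic F 0F 0F) ⟨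
    cofactor F 0F 0F + F 1F 2F * F 1F 2F
      ≡⟨ cong (λ c → c + F 1F 2F * F 1F 2F) (trans (reciprocal-cofactor r 0F 0F) A₀₀) ⟩
    a + F 1F 2F * F 1F 2F ∎
    where
    lemma : ∀ x u → + 2 * x ≡ x * + 2 - u * u + u * u
    lemma = solve-∀

  reciprocal-01 : + 2 * F 0F 1F ≡ F 0F 2F * F 1F 2F - t
  reciprocal-01 = begin
    + 2 * F 0F 1F
      ≡⟨ lemma (F 0F 1F) (F 0F 2F) (F 1F 2F) ⟩
    F 0F 2F * F 1F 2F - (F 1F 2F * F 0F 2F - F 0F 1F * + 2)
      ≡⟨ cong (λ c → F 0F 2F * F 1F 2F - (F 1F 2F * F 0F 2F - c))
           (cong₂ _*_ (reciprocal-sym r 0F 1F) reciprocal-22) ⟨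
    F 0F 2F * F 1F 2F - (F 1F 2F * F 0F 2F - F 1F 0F * F 2F 2F)
      ≡⟨ cong (λ c → F 0F 2F * F 1F 2F - (F 1F 2F * c - F 1F 0F * F 2F 2F)) (reciprocal-sym r 0F 2F) ⟨
    F 0F 2F * F 1F 2F - (F 1F 2F * F 2F 0F - F 1F 0F * F 2F 2F)
      ≡⟨ cong (λ c → F 0F 2F * F 1F 2F - c)
           (trans (sym (cofactor-cyclic F 0F 1F)) (trans (reciprocal-cofactor r 0F 1F) A₀₁)) ⟩
    F 0F 2F * F 1F 2F - t ∎
    where
    lemma : ∀ y u v → + 2 * y ≡ u * v - (v * u - y * + 2)
    lemma = solve-∀

  -- `F′` is constrained by equations and not by `Reciprocal`, so that `F₀` can be inserted by
  -- polynomial identities alone. The factors 2 are cancelled in ℤ.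
  reciprocal-unique : ∀ {F′} → Symmetric F′ → F′ 2F 2F ≡ + 2 →
    + 2 * F′ 0F 0F ≡ b + F′ 0F 2F * F′ 0F 2F →
    + 2 * F′ 1F 1F ≡ a + F′ 1F 2F * F′ 1F 2F →
    + 2 * F′ 0F 1F ≡ F′ 0F 2F * F′ 1F 2F - t →
    F 0F 2F ≡ F′ 0F 2F → F 1F 2F ≡ F′ 1F 2F → F ≐ F′
  reciprocal-unique {F′} s e₂₂ e₀₀ e₁₁ e₀₁ e₀₂ e₁₂ = λ where
      0F 0F → c₀₀
      0F 1F → c₀₁
      0F 2F → e₀₂
      1F 0F → flip 0F 1F c₀₁
      1F 1F → c₁₁
      1F 2F → e₁₂
      2F 0F → flip 0F 2F e₀₂
      2F 1F → flip 1F 2F e₁₂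
      2F 2F → trans reciprocal-22 (sym e₂₂)
    where
    flip : ∀ i j → F i j ≡ F′ i j → F j i ≡ F′ j i
    flip i j e = trans (reciprocal-sym r i j) (trans e (sym (s i j)))
    c₀₀ : F 0F 0F ≡ F′ 0F 0F
    c₀₀ = ℤ.*-cancelˡ-≡ (+ 2) _ _ (trans reciprocal-00 (trans (cong (λ c → b + c * c) e₀₂) (sym e₀₀)))
    c₁₁ : F 1F 1F ≡ F′ 1F 1F
    c₁₁ = ℤ.*-cancelˡ-≡ (+ 2) _ _ (trans reciprocal-11 (trans (cong (λ c → a + c * c) e₁₂) (sym e₁₁)))
    c₀₁ : F 0F 1F ≡ F′ 0F 1F
    c₀₁ = ℤ.*-cancelˡ-≡ (+ 2) _ _ (trans reciprocal-01 (trans (cong₂ (λ c d → c * d - t) e₀₂ e₁₂) (sym e₀₁)))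

-- Shears of the third basis vector

shear : ℤ → ℤ → Matrix 3 3
shear i j = (1ℤ ∷ 0ℤ ∷ 0ℤ ∷ []) ∷ (0ℤ ∷ 1ℤ ∷ 0ℤ ∷ []) ∷ (i ∷ j ∷ 1ℤ ∷ []) ∷ []

det-shear : ∀ i j → det (shear i j) ≡ 1ℤ
det-shear i j = trans (det-expand (shear i j)) (lemma i j)
  where
  lemma : ∀ i j → 1ℤ * (1ℤ * 1ℤ - 0ℤ * j) + (0ℤ * (0ℤ * i - 0ℤ * 1ℤ) + 0ℤ * (0ℤ * j - 1ℤ * i)) ≡ 1ℤ
  lemma = solve-∀

cofactor-shear : ∀ i j → cofactor (shear i j) ≐
  (1ℤ ∷ 0ℤ ∷ - i ∷ []) ∷ (0ℤ ∷ 1ℤ ∷ - j ∷ []) ∷ (0ℤ ∷ 0ℤ ∷ 1ℤ ∷ []) ∷ []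
cofactor-shear i j = λ where
    0F 0F → trans (cofactor-cyclic S 0F 0F) (lemma₁ i j)
    0F 1F → trans (cofactor-cyclic S 0F 1F) (lemma₂ i j)
    0F 2F → trans (cofactor-cyclic S 0F 2F) (lemma₃ i j)
    1F 0F → trans (cofactor-cyclic S 1F 0F) (lemma₄ i j)
    1F 1F → trans (cofactor-cyclic S 1F 1F) (lemma₅ i j)
    1F 2F → trans (cofactor-cyclic S 1F 2F) (lemma₆ i j)
    2F 0F → refl
    2F 1F → refl
    2F 2F → refl
  where
  S = shear i j
  lemma₁ : ∀ i j → 1ℤ * 1ℤ - 0ℤ * j ≡ 1ℤ
  lemma₁ = solve-∀
  lemma₂ : ∀ i j → 0ℤ * i - 0ℤ * 1ℤ ≡ 0ℤ
  lemma₂ = solve-∀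
  lemma₃ : ∀ i j → 0ℤ * j - 1ℤ * i ≡ - i
  lemma₃ = solve-∀
  lemma₄ : ∀ i j → j * 0ℤ - 1ℤ * 0ℤ ≡ 0ℤ
  lemma₄ = solve-∀
  lemma₅ : ∀ i j → 1ℤ * 1ℤ - i * 0ℤ ≡ 1ℤ
  lemma₅ = solve-∀
  lemma₆ : ∀ i j → i * 0ℤ - j * 1ℤ ≡ - j
  lemma₆ = solve-∀

shear-block : ∀ {a t b} i j {A} → HasBlock a t b A → HasBlock a t b (congruence (shear i j) A)
shear-block i j {A} (A₀₀ , A₀₁ , A₁₁) =
  trans (e₀ (A 0F 0F) (A 0F 1F) (A 0F 2F) (A 1F 0F) (A 1F 1F) (A 1F 2F) (A 2F 0F) (A 2F 1F) (A 2F 2F)) A₀₀ ,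
  trans (e₁ (A 0F 0F) (A 0F 1F) (A 0F 2F) (A 1F 0F) (A 1F 1F) (A 1F 2F) (A 2F 0F) (A 2F 1F) (A 2F 2F)) A₀₁ ,
  trans (e₂ (A 0F 0F) (A 0F 1F) (A 0F 2F) (A 1F 0F) (A 1F 1F) (A 1F 2F) (A 2F 0F) (A 2F 1F) (A 2F 2F)) A₁₁
  where
  e₀ : ∀ a b c d e f g h i →
    (1ℤ * a + (0ℤ * d + (0ℤ * g + 0ℤ))) * 1ℤ +
    ((1ℤ * b + (0ℤ * e + (0ℤ * h + 0ℤ))) * 0ℤ + ((1ℤ * c + (0ℤ * f + (0ℤ * i + 0ℤ))) * 0ℤ + 0ℤ)) ≡ a
  e₀ = solve-∀
  e₁ : ∀ a b c d e f g h i →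
    (1ℤ * a + (0ℤ * d + (0ℤ * g + 0ℤ))) * 0ℤ +
    ((1ℤ * b + (0ℤ * e + (0ℤ * h + 0ℤ))) * 1ℤ + ((1ℤ * c + (0ℤ * f + (0ℤ * i + 0ℤ))) * 0ℤ + 0ℤ)) ≡ b
  e₁ = solve-∀
  e₂ : ∀ a b c d e f g h i →
    (0ℤ * a + (1ℤ * d + (0ℤ * g + 0ℤ))) * 0ℤ +
    ((0ℤ * b + (1ℤ * e + (0ℤ * h + 0ℤ))) * 1ℤ + ((0ℤ * c + (1ℤ * f + (0ℤ * i + 0ℤ))) * 0ℤ + 0ℤ)) ≡ e
  e₂ = solve-∀

-- The shear adds multiples of the first two basis vectors to the third, so dually it subtracts
-- multiples of the last row and column of `F` from the others. As F₂₂ will be 2, the last column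
-- moves by even amounts.
shear-column : ∀ i j (F : Matrix 3 3) →
  congruence (cofactor (shear i j)) F 0F 2F ≡ F 0F 2F - i * F 2F 2F ×
  congruence (cofactor (shear i j)) F 1F 2F ≡ F 1F 2F - j * F 2F 2F
shear-column i j F =
  trans (explicit 0F 2F)
    (e₀ i (F 0F 0F) (F 0F 1F) (F 0F 2F) (F 1F 0F) (F 1F 1F) (F 1F 2F) (F 2F 0F) (F 2F 1F) (F 2F 2F)) ,
  trans (explicit 1F 2F)
    (e₁ j (F 0F 0F) (F 0F 1F) (F 0F 2F) (F 1F 0F) (F 1F 1F) (F 1F 2F) (F 2F 0F) (F 2F 1F) (F 2F 2F))
  where
  C : Matrix 3 3
  C = (1ℤ ∷ 0ℤ ∷ - i ∷ []) ∷ (0ℤ ∷ 1ℤ ∷ - j ∷ []) ∷ (0ℤ ∷ 0ℤ ∷ 1ℤ ∷ []) ∷ []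
  explicit : congruence (cofactor (shear i j)) F ≐ congruence C F
  explicit = ⊗-cong (⊗-congʳ F (cofactor-shear i j)) (ᵗ-cong (cofactor-shear i j))
  e₀ : ∀ s a b c d e f g h i →
    (1ℤ * a + (0ℤ * d + (- s * g + 0ℤ))) * 0ℤ +
    ((1ℤ * b + (0ℤ * e + (- s * h + 0ℤ))) * 0ℤ + ((1ℤ * c + (0ℤ * f + (- s * i + 0ℤ))) * 1ℤ + 0ℤ)) ≡ c - s * i
  e₀ = solve-∀
  e₁ : ∀ s a b c d e f g h i →
    (0ℤ * a + (1ℤ * d + (- s * g + 0ℤ))) * 0ℤ +
    ((0ℤ * b + (1ℤ * e + (- s * h + 0ℤ))) * 0ℤ + ((0ℤ * c + (1ℤ * f + (- s * i + 0ℤ))) * 1ℤ + 0ℤ)) ≡ f - s * i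
  e₁ = solve-∀

-- Common divisors of coefficients and cofactors

IsPrimitive : Matrix 3 3 → Set
IsPrimitive A = ∀ c → (∀ i j → c ∣ A i j) → c ∣ 1ℤ

gcds²-primitive : (A : Matrix 3 3) → IsPrimitive A → gcds (λ i → gcds (A i)) ≡ 1ℤ
gcds²-primitive A F-prim = gcds²-unique A 1 (F-prim _ (gcds²-∣ A)) λ i j → ∣ᵤ⇒∣ (ℕ.1∣ ∣ A i j ∣)

-- `k` divides the gcd, and the quotient divides every entry of the primitive `F`, so it is a unit.
-- The equation `k ≡ + n` says that k ≥ 0, as `gcds` is never negative.
gcds²-scaled : ∀ {k n} .{{_ : NonZero k}} → k ≡ + n → (C F : Matrix 3 3) → C ≐ k ∙ F → IsPrimitive F →
               gcds (λ i → gcds (C i)) ≡ k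
gcds²-scaled {k} {n} k≡n C F C≐kF F-prim =
  trans (gcds²-unique C n (subst (g ∣_) k≡n g∣k) λ i j → subst (_∣ C i j) k≡n (k∣C i j)) (sym k≡n)
  where
  g : ℤ
  g = gcds (λ i → gcds (C i))
  k∣C : ∀ i j → k ∣ C i j
  k∣C i j = divides (F i j) (trans (C≐kF i j) (ℤ.*-comm k (F i j)))
  k∣g : k ∣ g
  k∣g = gcds²-greatest C k∣C
  q∣F : ∀ i j → quotient k∣g ∣ F i j
  q∣F i j = *-cancelʳ-∣ k (subst₂ _∣_ (_∣_.equality k∣g)
    (trans (C≐kF i j) (ℤ.*-comm k (F i j))) (gcds²-∣ C i j))
  g∣k : g ∣ k
  g∣k = subst₂ _∣_ (sym (_∣_.equality k∣g)) (ℤ.*-identityˡ k) (*-monoˡ-∣ k (F-prim (quotient k∣g) q∣F))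

scaled-primitive : ∀ k .{{_ : NonZero k}} (C F : Matrix 3 3) → C ≐ k ∙ F →
                   gcds (λ i → gcds (C i)) ≡ k → IsPrimitive F
scaled-primitive k C F C≐kF g≡k c c∣F = *-cancelʳ-∣ k (subst (c * k ∣_) (trans g≡k (sym (ℤ.*-identityˡ k)))
  (gcds²-greatest C λ i j → subst (c * k ∣_) (trans (ℤ.*-comm (F i j) k) (sym (C≐kF i j))) (*-monoˡ-∣ k (c∣F i j))))

∣-* : ∀ {c x y} → c ∣ x → c ∣ y → c * c ∣ x * y
∣-* {c} (divides q refl) (divides r refl) = divides (q * r) (lemma q r c)
  where
  lemma : ∀ q r c → q * c * (r * c) ≡ q * r * (c * c)
  lemma = solve-∀

cofactor-∣ : ∀ {c} (A : Matrix 3 3) → (∀ i j → c ∣ A i j) → ∀ i j → c * c ∣ cofactor A i j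
cofactor-∣ {c} A c∣A i j = subst (c * c ∣_) (sym (cofactor-cyclic A i j))
  (∣m∣n⇒∣m-n (∣-* (c∣A _ _) (c∣A _ _)) (∣-* (c∣A _ _) (c∣A _ _)))

-- Generalising over C avoids an expensive unfolding of the cofactors.
Ω-scaled : ∀ {k n} .{{_ : NonZero k}} → k ≡ + n → ∀ f F → cofactor (matrix f) ≐ k ∙ F → IsPrimitive F → Ω f ≡ k
Ω-scaled {k} {n} k≡n f F r F-prim = unfold (scaled (cofactor (matrix f)) r)
  where
  scaled : ∀ C → C ≐ k ∙ F → gcds (λ i → gcds (C i)) ≡ k
  scaled C r = gcds²-scaled {k} {n} k≡n C F r F-prim
  unfold : gcds (λ i → gcds (cofactor (matrix f) i)) ≡ k → Ω f ≡ k
  unfold e = e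

Ω-∣ : ∀ {k} f {c} → Ω f ≡ k → (∀ i j → c ∣ matrix f i j) → c * c ∣ k
Ω-∣ f {c} Ω≡k c∣A = subst (c * c ∣_) Ω≡k (gcds²-greatest (cofactor (matrix f)) (cofactor-∣ (matrix f) c∣A))

primitive-Ω : ∀ {k} .{{_ : NonZero k}} f F → cofactor (matrix f) ≐ k ∙ F → Ω f ≡ k → IsPrimitive F
primitive-Ω {k} f F r Ω≡k = scaled (cofactor (matrix f)) r (unfold Ω≡k)
  where
  scaled : ∀ C → C ≐ k ∙ F → gcds (λ i → gcds (C i)) ≡ k → IsPrimitive F
  scaled C r = scaled-primitive k C F r
  unfold : Ω f ≡ k → gcds (λ i → gcds (cofactor (matrix f) i)) ≡ k
  unfold e = e

-- 2p is squarefree. This makes the constructed form primitive: a common divisor c of its entries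
-- has c² dividing every cofactor, hence Ω = 2p.
square∣2p : ∀ {p} → Prime p → 3 ≤ p → ∀ c → c * c ∣ + (2 ℕ.* p) → c ∣ 1ℤ
square∣2p {p} p-prime 3≤p c c²∣2p = c∣1 (p ℕ.∣? e)
  where
  instance
    p≢0 : ℕ.NonZero p
    p≢0 = prime⇒nonZero p-prime
  e : ℕ
  e = ∣ c ∣
  e²∣2p : e ℕ.* e ℕ.∣ 2 ℕ.* p
  e²∣2p = subst (ℕ._∣ 2 ℕ.* p) (ℤ.abs-* c c) (∣⇒∣ᵤ c²∣2p)
  2∤p : ¬ (2 ℕ.∣ p)
  2∤p 2∣p = 2∤prime p-prime 3≤p (∣ᵤ⇒∣ 2∣p)
  c∣1 : Dec (p ℕ.∣ e) → c ∣ 1ℤ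
  c∣1 (yes p∣e) = contradiction (∣ᵤ⇒∣ (ℕ.*-cancelʳ-∣ p (ℕ.∣-trans (ℕ.*-pres-∣ p∣e p∣e) e²∣2p))) (prime∤2 p-prime 3≤p)
  c∣1 (no p∤e) = case irreducible[2] e∣2 of λ where
      (inj₁ e≡1) → ∣c∣≡1⇒c∣1 c e≡1
      (inj₂ e≡2) → contradiction
        (ℕ.*-cancelˡ-∣ 2 (subst (λ d → d ℕ.* d ℕ.∣ 2 ℕ.* p) e≡2 e²∣2p)) 2∤p
    where
    e-coprime-p : ℕ.Coprime e p
    e-coprime-p {d} (d∣e , d∣p) with prime⇒irreducible p-prime d∣p
    ... | inj₁ d≡1  = d≡1
    ... | inj₂ refl = contradiction d∣e p∤e
    e∣2 : e ℕ.∣ 2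
    e∣2 = ℕ.coprime-divisor e-coprime-p (subst (e ℕ.∣_) (ℕ.*-comm 2 p) (ℕ.∣-trans (ℕ.m∣m*n e) e²∣2p))

firstColumns : Matrix 3 2
firstColumns = (1ℤ ∷ 0ℤ ∷ []) ∷ (0ℤ ∷ 1ℤ ∷ []) ∷ (0ℤ ∷ 0ℤ ∷ []) ∷ []

block⇒represents : ∀ {a t b} f → HasBlock a t b (matrix f) → ProperlyRepresents f (matrix₂ a t b)
block⇒represents (ternary a₁₁ a₂₂ a₃₃ a₂₃ a₁₃ a₁₂) (refl , refl , refl) = firstColumns , refl , λ where
    0F 0F → e₀ a₁₁ a₂₂ a₃₃ a₂₃ a₁₃ a₁₂
    0F 1F → e₁ a₁₁ a₂₂ a₃₃ a₂₃ a₁₃ a₁₂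
    1F 0F → e₂ a₁₁ a₂₂ a₃₃ a₂₃ a₁₃ a₁₂
    1F 1F → e₃ a₁₁ a₂₂ a₃₃ a₂₃ a₁₃ a₁₂
  where
  e₀ : ∀ a b c d e f →
    (1ℤ * a + (0ℤ * f + (0ℤ * e + 0ℤ))) * 1ℤ +
    ((1ℤ * f + (0ℤ * b + (0ℤ * d + 0ℤ))) * 0ℤ + ((1ℤ * e + (0ℤ * d + (0ℤ * c + 0ℤ))) * 0ℤ + 0ℤ)) ≡ a
  e₀ = solve-∀
  e₁ : ∀ a b c d e f →
    (1ℤ * a + (0ℤ * f + (0ℤ * e + 0ℤ))) * 0ℤ +
    ((1ℤ * f + (0ℤ * b + (0ℤ * d + 0ℤ))) * 1ℤ + ((1ℤ * e + (0ℤ * d + (0ℤ * c + 0ℤ))) * 0ℤ + 0ℤ)) ≡ f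
  e₁ = solve-∀
  e₂ : ∀ a b c d e f →
    (0ℤ * a + (1ℤ * f + (0ℤ * e + 0ℤ))) * 1ℤ +
    ((0ℤ * f + (1ℤ * b + (0ℤ * d + 0ℤ))) * 0ℤ + ((0ℤ * e + (1ℤ * d + (0ℤ * c + 0ℤ))) * 0ℤ + 0ℤ)) ≡ f
  e₂ = solve-∀
  e₃ : ∀ a b c d e f →
    (0ℤ * a + (1ℤ * f + (0ℤ * e + 0ℤ))) * 0ℤ +
    ((0ℤ * f + (1ℤ * b + (0ℤ * d + 0ℤ))) * 1ℤ + ((0ℤ * e + (1ℤ * d + (0ℤ * c + 0ℤ))) * 0ℤ + 0ℤ)) ≡ b
  e₃ = solve-∀

gcds-largest : ∀ {n} (v : Vector ℤ n) d .{{_ : ℕ.NonZero d}} → (∀ i → + d ∣ v i) →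
               (∀ c → (∀ i → c * + d ∣ v i) → c ∣ 1ℤ) → gcds v ≡ + d
gcds-largest v d d∣v largest = gcds-unique v d
  (subst₂ _∣_ (sym (_∣_.equality d∣g)) (ℤ.*-identityˡ (+ d)) (*-monoˡ-∣ (+ d)
    (largest (quotient d∣g) λ i → subst (_∣ v i) (_∣_.equality d∣g) (gcds-∣ v i))))
  d∣v
  where
  d∣g : + d ∣ gcds v
  d∣g = gcds-greatest v d∣v

-- If 2c divides all six coefficients, halving the doubled ones shows that c divides every matrix
-- entry, so c is a unit.
even-σ : ∀ f → IsPrimitive (matrix f) → (∀ i → + 2 ∣ matrix f i i) → σ f ≡ + 2
even-σ (ternary a₁₁ a₂₂ a₃₃ a₂₃ a₁₃ a₁₂) F-prim even =
  gcds-largest (a₁₁ ∷ a₂₂ ∷ a₃₃ ∷ + 2 * a₂₃ ∷ + 2 * a₁₃ ∷ + 2 * a₁₂ ∷ []) 2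
    (λ where
      zero                               → even 0F
      (suc zero)                         → even 1F
      (suc (suc zero))                   → even 2F
      (suc (suc (suc zero)))             → ∣m⇒∣m*n a₂₃ ∣-refl
      (suc (suc (suc (suc zero))))       → ∣m⇒∣m*n a₁₃ ∣-refl
      (suc (suc (suc (suc (suc zero))))) → ∣m⇒∣m*n a₁₂ ∣-refl)
    λ c c∣ → F-prim c λ where
      0F 0F → weaken (c∣ zero)
      1F 1F → weaken (c∣ (suc zero))
      2F 2F → weaken (c∣ (suc (suc zero)))
      1F 2F → halve (c∣ (suc (suc (suc zero))))
      2F 1F → halve (c∣ (suc (suc (suc zero))))
      0F 2F → halve (c∣ (suc (suc (suc (suc zero)))))
      2F 0F → halve (c∣ (suc (suc (suc (suc zero)))))
      0F 1F → halve (c∣ (suc (suc (suc (suc (suc zero))))))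
      1F 0F → halve (c∣ (suc (suc (suc (suc (suc zero))))))
  where
  weaken : ∀ {c x} → c * + 2 ∣ x → c ∣ x
  weaken = ∣-trans (∣m⇒∣m*n (+ 2) ∣-refl)
  halve : ∀ {c x} → c * + 2 ∣ + 2 * x → c ∣ x
  halve {c} {x} h = *-cancelʳ-∣ (+ 2) (subst (c * + 2 ∣_) (ℤ.*-comm (+ 2) x) h)

-- By symmetry the mixed terms of a diagonal entry pair up to an even number, so evenness of the
-- diagonal survives any change of basis.
congruence-even-diagonal : (P : Matrix 3 3) (F : Matrix 3 3) → Symmetric F →
  (∀ i → + 2 ∣ F i i) → ∀ i → + 2 ∣ congruence P F i i
congruence-even-diagonal P F F-sym even i =
  subst (+ 2 ∣_) (sym explicit)
    (∣m∣n⇒∣m+n (∣n⇒∣m*n (P i 0F * P i 0F) (even 0F))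
    (∣m∣n⇒∣m+n (∣n⇒∣m*n (P i 1F * P i 1F) (even 1F))
    (∣m∣n⇒∣m+n (∣n⇒∣m*n (P i 2F * P i 2F) (even 2F))
    (∣m⇒∣m*n (P i 0F * P i 1F * F 0F 1F + P i 0F * P i 2F * F 0F 2F + P i 1F * P i 2F * F 1F 2F) ∣-refl))))
  where
  lemma : ∀ x y z a b c d e f →
    (x * a + (y * d + (z * e + 0ℤ))) * x +
    ((x * d + (y * b + (z * f + 0ℤ))) * y + ((x * e + (y * f + (z * c + 0ℤ))) * z + 0ℤ))
    ≡ x * x * a + (y * y * b + (z * z * c + + 2 * (x * y * d + x * z * e + y * z * f)))
  lemma = solve-∀
  symmetrised : (P ⊗ F ⊗ P ᵗ) i i ≡ (P ⊗ matrix (form F) ⊗ P ᵗ) i i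
  symmetrised = ⊗-congʳ (P ᵗ) (⊗-congˡ P (≐-sym (matrix-form F-sym))) i i
  explicit = trans symmetrised
    (lemma (P i 0F) (P i 1F) (P i 2F) (F 0F 0F) (F 1F 1F) (F 2F 2F) (F 0F 1F) (F 0F 2F) (F 1F 2F))

IsPrimitive-cong : ∀ {A B} → A ≐ B → IsPrimitive A → IsPrimitive B
IsPrimitive-cong A≐B prim c c∣B = prim c λ i j → subst (c ∣_) (sym (A≐B i j)) (c∣B i j)

Reciprocal-cong : ∀ {k A A′ F} → A ≐ A′ → Reciprocal k A F → Reciprocal k A′ F
Reciprocal-cong {A = A} {A′} A≐A′ r = record
  { symmetric  = ≐-trans (ᵗ-cong {A = A′} {B = A} (≐-sym A≐A′)) (≐-trans symmetric A≐A′)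
  ; cofactor-A = ≐-trans (cofactor-cong (≐-sym A≐A′)) cofactor-A
  ; det-A      = trans (det-cong (≐-sym A≐A′)) det-A
  }
  where open Reciprocal r

-- The canonical reciprocal and reduction to it

module Canonical
  {p : ℕ} (p-prime : Prime p) (5≤p : 5 ≤ p) (x y z u v : ℤ)
  (ab-t²≡4p : (+ 4 * z - v * v) * (+ 4 * x - u * u) - (u * v - + 2 * y) * (u * v - + 2 * y) ≡ + 4 * + p)
  {k : ℤ} (k≡+2p : k ≡ + (2 ℕ.* p))
  where

  -- ρ is parametrised by the entries of `F₀`, so that the relations between the two become
  -- polynomial identities in five variables.
  a b t : ℤ
  a = + 4 * z - v * v
  b = + 4 * x - u * u
  t = u * v - + 2 * y

  Admissible : TernaryForm → Set
  Admissible f = Primitive f × HasInvariants f k 1ℤ × ProperlyRepresents f (matrix₂ a t b)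

  private
    3≤p : 3 ≤ p
    3≤p = ℕ.≤-trans (s≤s (s≤s (s≤s z≤n))) 5≤p

    k≡2p : k ≡ + 2 * + p
    k≡2p = trans k≡+2p (ℤ.pos-* 2 p)

    ab-t²≡2k : a * b - t * t ≡ + 2 * k
    ab-t²≡2k = trans ab-t²≡4p (trans (lemma (+ p)) (cong (+ 2 *_) (sym k≡2p)))
      where
      lemma : ∀ q → + 4 * q ≡ + 2 * (+ 2 * q)
      lemma = solve-∀

    instance
      p≢0 : ℕ.NonZero p
      p≢0 = prime⇒nonZero p-prime
      k≢0 : NonZero k
      k≢0 = subst NonZero (sym k≡+2p) (ℕ.m*n≢0 2 p)

  F₀ A₀ : Matrix 3 3
  F₀ = matrix (ternary (+ 2 * x) (+ 2 * z) (+ 2) v u y)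
  A₀ = cofactor F₀

  -- A 2 × 2 minor of the adjugate is the complementary entry times the determinant: ab - t² = 2 det
  -- F₀.
  det-F₀ : det F₀ ≡ k
  det-F₀ = ℤ.*-cancelˡ-≡ (+ 2) _ _ (trans (cong (+ 2 *_) (det-expand F₀)) (trans (lemma x y z u v) ab-t²≡2k))
    where
    lemma : ∀ x y z u v →
      + 2 * (+ 2 * x * (+ 2 * z * + 2 - v * v) + (y * (v * u - y * + 2) + u * (y * v - + 2 * z * u)))
      ≡ (+ 4 * z - v * v) * (+ 4 * x - u * u) - (u * v - + 2 * y) * (u * v - + 2 * y)
    lemma = solve-∀

  reciprocal₀ : Reciprocal k A₀ F₀
  reciprocal₀ = record
    { symmetric  = cofactor-sym (matrix-sym (ternary (+ 2 * x) (+ 2 * z) (+ 2) v u y))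
    ; cofactor-A = cofactor-A₀
    ; det-A      = det-A₀
    }
    where
    open ≡-Reasoning
    cofactor-A₀ : cofactor A₀ ≐ k ∙ F₀
    cofactor-A₀ i j = trans (cofactor-cofactor F₀ i j) (cong (_* F₀ i j) det-F₀)
    det-A₀ : det A₀ ≡ k * k
    det-A₀ = begin
      det A₀
        ≡⟨ ℤ.*-identityʳ (det A₀) ⟨
      det A₀ * 1ℤ
        ≡⟨ ⊗-cofactor A₀ 0F 0F ⟨
      Σℤ.sum (λ i → A₀ 0F i * cofactor A₀ 0F i)
        ≡⟨ Σℤ.sum-cong-≗ (λ i → trans (cong (A₀ 0F i *_) (cofactor-A₀ 0F i)) (lemma (A₀ 0F i) k (F₀ 0F i))) ⟩
      Σℤ.sum (λ i → k * (F₀ 0F i * A₀ 0F i))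
        ≡⟨ Σℤ.*-distribˡ-sum k (λ i → F₀ 0F i * A₀ 0F i) ⟨
      k * Σℤ.sum (λ i → F₀ 0F i * A₀ 0F i)
        ≡⟨ cong (k *_) (⊗-cofactor F₀ 0F 0F) ⟩
      k * (det F₀ * 1ℤ)
        ≡⟨ cong (k *_) (trans (ℤ.*-identityʳ (det F₀)) det-F₀) ⟩
      k * k ∎
      where
      lemma : ∀ c d e → c * (d * e) ≡ d * (e * c)
      lemma = solve-∀

  block₀ : HasBlock a t b A₀
  block₀ =
    trans (cofactor-cyclic F₀ 0F 0F) (lemma₀ z v) ,
    trans (cofactor-cyclic F₀ 0F 1F) (lemma₁ y u v) ,
    trans (cofactor-cyclic F₀ 1F 1F) (lemma₂ x u)
    where
    lemma₀ : ∀ z v → + 2 * z * + 2 - v * v ≡ + 4 * z - v * v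
    lemma₀ = solve-∀
    lemma₁ : ∀ y u v → v * u - y * + 2 ≡ u * v - + 2 * y
    lemma₁ = solve-∀
    lemma₂ : ∀ x u → + 2 * (+ 2 * x) - u * u ≡ + 4 * x - u * u
    lemma₂ = solve-∀

  reciprocal-exists : ∀ f → HasInvariants f k 1ℤ → Σ[ F ∈ Matrix 3 3 ] Reciprocal k (matrix f) F
  reciprocal-exists f (Ω≡k , det≡k²) = F , record
    { symmetric  = matrix-sym f
    ; cofactor-A = λ i j → trans (_∣_.equality (k∣cofactor i j)) (ℤ.*-comm (F i j) k)
    ; det-A      = trans det≡k² (lemma k)
    }
    where
    k∣cofactor : ∀ i j → k ∣ cofactor (matrix f) i j
    k∣cofactor i j = subst (_∣ cofactor (matrix f) i j) Ω≡k (gcds²-∣ (cofactor (matrix f)) i j)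
    F : Matrix 3 3
    F i j = quotient (k∣cofactor i j)
    lemma : ∀ c → 1ℤ * (c * (c * 1ℤ)) ≡ c * c
    lemma = solve-∀

  shear-canonical : ∀ {A G} → Reciprocal k A G → HasBlock a t b A → ∀ i j →
    G 0F 2F - i * G 2F 2F ≡ u → G 1F 2F - j * G 2F 2F ≡ v →
    congruence (cofactor (shear i j)) G ≐ F₀
  shear-canonical {A} {G} r block i j eᵤ eᵥ =
    reciprocal-unique ab-t²≡2k (reciprocal-congruence r (shear i j) (det-shear i j)) (shear-block i j {A} block)
      (matrix-sym (ternary (+ 2 * x) (+ 2 * z) (+ 2) v u y)) refl
      (lemma x u) (lemma z v) (lemma′ y u v)
      (trans (proj₁ (shear-column i j G)) eᵤ)
      (trans (proj₂ (shear-column i j G)) eᵥ)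
    where
    lemma : ∀ x u → + 2 * (+ 2 * x) ≡ (+ 4 * x - u * u) + u * u
    lemma = solve-∀
    lemma′ : ∀ y u v → + 2 * y ≡ u * v - (u * v - + 2 * y)
    lemma′ = solve-∀

  -- From 2G₀₀ = b + G₀₂² and b = 4x - u² it follows that G₀₂ and u have equal parity. Because G₂₂ =
  -- 2, half of their difference is the shear that carries one to the other; likewise for G₁₂ and v.
  exists-shear : ∀ {A G} → Reciprocal k A G → HasBlock a t b A →
                 ∃[ i ] ∃[ j ] congruence (cofactor (shear i j)) G ≐ F₀
  exists-shear {A} {G} r block = quotient 2∣₀ , quotient 2∣₁ ,
    shear-canonical r block (quotient 2∣₀) (quotient 2∣₁)
      (shifted (G 0F 2F) u (quotient 2∣₀) (_∣_.equality 2∣₀))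
      (shifted (G 1F 2F) v (quotient 2∣₁) (_∣_.equality 2∣₁))
    where
    sameParity : ∀ g c d e → + 2 * g ≡ (+ 4 * c - d * d) + e * e → + 2 ∣ e - d
    sameParity g c d e eq = even-difference e d (divides (g - + 2 * c) (begin
      e * e - d * d                                ≡⟨ lemma c d e ⟩
      (+ 4 * c - d * d) + e * e - + 4 * c          ≡⟨ cong (_- + 4 * c) eq ⟨
      + 2 * g - + 4 * c                            ≡⟨ lemma′ g c ⟩
      (g - + 2 * c) * + 2                          ∎))
      where
      open ≡-Reasoning
      lemma : ∀ c d e → e * e - d * d ≡ (+ 4 * c - d * d) + e * e - + 4 * c
      lemma = solve-∀
      lemma′ : ∀ g c → + 2 * g - + 4 * c ≡ (g - + 2 * c) * + 2
      lemma′ = solve-∀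
    2∣₀ : + 2 ∣ G 0F 2F - u
    2∣₀ = sameParity (G 0F 0F) x u (G 0F 2F) (reciprocal-00 ab-t²≡2k r block)
    2∣₁ : + 2 ∣ G 1F 2F - v
    2∣₁ = sameParity (G 1F 1F) z v (G 1F 2F) (reciprocal-11 ab-t²≡2k r block)
    shifted : ∀ e d q → e - d ≡ q * + 2 → e - q * G 2F 2F ≡ d
    shifted e d q eq = trans (cong (λ c → e - q * c) (reciprocal-22 ab-t²≡2k r block))
      (trans (cong (λ c → e - c) (sym eq)) (lemma e d))
      where
      lemma : ∀ e d → e - (e - d) ≡ d
      lemma = solve-∀

  module _ {A F : Matrix 3 3} (is-reciprocal : Reciprocal k A F) where
    -- A change of basis `Q` taking `F` to `F₀`, and hence `A` to `A₀`. Since det Q = 1, its inverse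
    -- is `cofactor Q ᵗ`; this is how `recover-F` and `recover-A` go back, and how two normal forms
    -- are composed into an equivalence.
    record NormalForm : Set where
      field
        Q      : Matrix 3 3
        det-Q  : det Q ≡ 1ℤ
        normal : congruence (cofactor Q) F ≐ F₀

      recover-F : F ≐ congruence (Q ᵗ) F₀
      recover-F = begin
        F                                            ≈⟨ congruence-𝟙 F ⟨
        congruence 𝟙 F
          ≈⟨ ⊗-cong (⊗-congʳ F unimodular) (ᵗ-cong unimodular) ⟨
        congruence (Q ᵗ ⊗ cofactor Q) F              ≈⟨ congruence-∘ (Q ᵗ) (cofactor Q) F ⟩
        congruence (Q ᵗ) (congruence (cofactor Q) F) ≈⟨ congruence-cong (Q ᵗ) normal ⟩
        congruence (Q ᵗ) F₀                          ∎
        where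
        open ≐-Reasoning
        unimodular : Q ᵗ ⊗ cofactor Q ≐ 𝟙
        unimodular i j = trans (ᵗ-⊗-cofactor Q i j) (trans (cong (_* 𝟙 i j) det-Q) (ℤ.*-identityˡ (𝟙 i j)))

      normal-A : congruence Q A ≐ A₀
      normal-A = begin
        congruence Q A
          ≈⟨ reciprocal-cofactor (reciprocal-congruence is-reciprocal Q det-Q) ⟨
        cofactor (congruence (cofactor Q) F)         ≈⟨ cofactor-cong normal ⟩
        A₀                                           ∎
        where open ≐-Reasoning

      det-inverse : det (cofactor Q ᵗ) ≡ 1ℤ
      det-inverse = begin
        det (cofactor Q ᵗ)                ≡⟨ det-ᵗ (cofactor Q) ⟩
        det (cofactor Q)                  ≡⟨ ℤ.*-identityˡ _ ⟨
        1ℤ * det (cofactor Q)             ≡⟨ cong (_* det (cofactor Q)) (trans (det-ᵗ Q) det-Q) ⟨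
        det (Q ᵗ) * det (cofactor Q)      ≡⟨ det-⊗ (Q ᵗ) (cofactor Q) ⟨
        det (Q ᵗ ⊗ cofactor Q)            ≡⟨ det-cong (ᵗ-⊗-cofactor Q) ⟩
        det (det Q ∙ 𝟙)
          ≡⟨ det-cong {det Q ∙ 𝟙} {𝟙} (λ i j → trans (cong (_* 𝟙 i j) det-Q) (ℤ.*-identityˡ (𝟙 i j))) ⟩
        det 𝟙                             ∎
        where open ≡-Reasoning

      recover-A : A ≐ congruence (cofactor Q ᵗ) A₀
      recover-A = begin
        A                                            ≈⟨ congruence-𝟙 A ⟨
        congruence 𝟙 A
          ≈⟨ ⊗-cong (⊗-congʳ A unimodular) (ᵗ-cong unimodular) ⟨
        congruence (cofactor Q ᵗ ⊗ Q) A              ≈⟨ congruence-∘ (cofactor Q ᵗ) Q A ⟩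
        congruence (cofactor Q ᵗ) (congruence Q A)   ≈⟨ congruence-cong (cofactor Q ᵗ) normal-A ⟩
        congruence (cofactor Q ᵗ) A₀                 ∎
        where
        open ≐-Reasoning
        unimodular : cofactor Q ᵗ ⊗ Q ≐ 𝟙
        unimodular = begin
          cofactor Q ᵗ ⊗ Q       ≈⟨ ᵗ-⊗ (Q ᵗ) (cofactor Q) ⟨
          (Q ᵗ ⊗ cofactor Q) ᵗ   ≈⟨ ᵗ-cong (ᵗ-⊗-cofactor Q) ⟩
          (det Q ∙ 𝟙) ᵗ
            ≈⟨ (λ i j → trans (cong (_* 𝟙 j i) det-Q) (ℤ.*-identityˡ (𝟙 j i))) ⟩
          𝟙 ᵗ                    ≈⟨ 𝟙-sym ⟩
          𝟙                      ∎

    composite : ∀ S P → det S ≡ 1ℤ → det P ≡ 1ℤ →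
                congruence (cofactor S) (congruence (cofactor P) F) ≐ F₀ → NormalForm
    composite S P det-S det-P canonical = record
      { Q      = S ⊗ P
      ; det-Q  = trans (det-⊗ S P) (cong₂ _*_ det-S det-P)
      ; normal = begin
          congruence (cofactor (S ⊗ P)) F
            ≈⟨ ⊗-cong (⊗-congʳ F (cofactor-⊗ S P)) (ᵗ-cong (cofactor-⊗ S P)) ⟩
          congruence (cofactor S ⊗ cofactor P) F
            ≈⟨ congruence-∘ (cofactor S) (cofactor P) F ⟩
          congruence (cofactor S) (congruence (cofactor P) F) ≈⟨ canonical ⟩
          F₀                                                  ∎
      }
      where open ≐-Reasoning

    block⇒normalForm : ∀ P → det P ≡ 1ℤ → HasBlock a t b (congruence P A) → NormalForm
    block⇒normalForm P det-P block =
      finish (exists-shear (reciprocal-congruence is-reciprocal P det-P) block)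
      where
      finish : (∃[ i ] ∃[ j ] congruence (cofactor (shear i j)) (congruence (cofactor P) F) ≐ F₀) → NormalForm
      finish (i , j , canonical) = composite (shear i j) P (det-shear i j) det-P canonical

    normalForm : (M : Matrix 3 2) → gcds {3} (λ i → det (deleteRow i M)) ≡ 1ℤ →
                 M ᵗ ⊗ A ⊗ M ≐ matrix₂ a t b → NormalForm
    normalForm M coprime represents = finish (extend M coprime)
      where
      finish : (Σ[ r ∈ Vector ℤ 3 ] det ((λ i → M i 0F) ∷ (λ i → M i 1F) ∷ r ∷ []) ≡ 1ℤ) → NormalForm
      -- The first two rows of the matrix are the columns of `M`, so the upper left block of the
      -- congruence is definitionally `M ᵗ ⊗ A ⊗ M`.
      finish (r , det-P) = block⇒normalForm ((λ i → M i 0F) ∷ (λ i → M i 1F) ∷ r ∷ []) det-P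
        (represents 0F 0F , represents 0F 1F , represents 1F 1F)

  normalForms⇒equivalent : ∀ {A F A′ F′} {r : Reciprocal k A F} {r′ : Reciprocal k A′ F′} →
    NormalForm r → NormalForm r′ →
    Σ[ U ∈ Matrix 3 3 ] (det U ≡ 1ℤ ⊎ det U ≡ -1ℤ) × A′ ≐ congruence U A
  normalForms⇒equivalent {A} {A′ = A′} m n =
    cofactor n′.Q ᵗ ⊗ m′.Q ,
    inj₁ (trans (det-⊗ (cofactor n′.Q ᵗ) m′.Q) (cong₂ _*_ n′.det-inverse m′.det-Q)) ,
    (begin
      A′                                              ≈⟨ n′.recover-A ⟩
      congruence (cofactor n′.Q ᵗ) A₀
        ≈⟨ congruence-cong (cofactor n′.Q ᵗ) m′.normal-A ⟨
      congruence (cofactor n′.Q ᵗ) (congruence m′.Q A)  ≈⟨ congruence-∘ (cofactor n′.Q ᵗ) m′.Q A ⟨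
      congruence (cofactor n′.Q ᵗ ⊗ m′.Q) A             ∎)
    where
    module m′ = NormalForm m
    module n′ = NormalForm n
    open ≐-Reasoning

  admissible⇒normalForm : ∀ f → Admissible f →
    Σ[ F ∈ Matrix 3 3 ] Σ[ r ∈ Reciprocal k (matrix f) F ] NormalForm r
  admissible⇒normalForm f (_ , invariants , M , coprime , represents) = finish (reciprocal-exists f invariants)
    where
    finish : (Σ[ F ∈ Matrix 3 3 ] Reciprocal k (matrix f) F) →
             Σ[ F ∈ Matrix 3 3 ] Σ[ r ∈ Reciprocal k (matrix f) F ] NormalForm r
    finish (F , r) = F , r , normalForm r M coprime represents

  unique : ∀ f g → Admissible f → Admissible g → Equivalent f g
  unique f g admissible-f admissible-g =
    finish (admissible⇒normalForm f admissible-f) (admissible⇒normalForm g admissible-g)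
    where
    finish : (Σ[ F ∈ Matrix 3 3 ] Σ[ r ∈ Reciprocal k (matrix f) F ] NormalForm r) →
             (Σ[ F ∈ Matrix 3 3 ] Σ[ r ∈ Reciprocal k (matrix g) F ] NormalForm r) → Equivalent f g
    finish (_ , _ , m) (_ , _ , n) = normalForms⇒equivalent m n

  -- A common divisor divides the corner entry 2. Were it ±2, then y, u, v would be even, each of a,
  -- t, b divisible by 4, and 16 would divide ab - t² = 4p.
  F₀-primitive : IsPrimitive F₀
  F₀-primitive c c∣F₀ = case ∣2⇒ c (c∣F₀ 2F 2F) of λ where
      (inj₁ ∣c∣≡1) → ∣c∣≡1⇒c∣1 c ∣c∣≡1
      (inj₂ ∣c∣≡2) → contradiction (2∣p (2∣ ∣c∣≡2 (c∣F₀ 0F 1F)) (2∣ ∣c∣≡2 (c∣F₀ 0F 2F)) (2∣ ∣c∣≡2 (c∣F₀ 1F 2F)))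
                                   (2∤prime p-prime 3≤p)
    where
    2∣ : ∀ {w} → ∣ c ∣ ≡ 2 → c ∣ w → + 2 ∣ w
    2∣ ∣c∣≡2 c∣w = ∣-trans (∣ᵤ⇒∣ (ℕ.∣-reflexive (sym ∣c∣≡2))) c∣w
    2∣p : + 2 ∣ y → + 2 ∣ u → + 2 ∣ v → + 2 ∣ + p
    2∣p (divides y′ refl) (divides u′ refl) (divides v′ refl) =
      divides (+ 2 * ((z - v′ * v′) * (x - u′ * u′) - (u′ * v′ - y′) * (u′ * v′ - y′)))
        (ℤ.*-cancelˡ-≡ (+ 4) _ _ (trans (sym ab-t²≡4p) (lemma x y′ z u′ v′)))
      where
      lemma : ∀ x y z u v →
        (+ 4 * z - v * + 2 * (v * + 2)) * (+ 4 * x - u * + 2 * (u * + 2)) -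
        (u * + 2 * (v * + 2) - + 2 * (y * + 2)) * (u * + 2 * (v * + 2) - + 2 * (y * + 2))
        ≡ + 4 * (+ 2 * ((z - v * v) * (x - u * u) - (u * v - y) * (u * v - y)) * + 2)
      lemma = solve-∀

  reciprocal⇒admissible : ∀ f {F} → Reciprocal k (matrix f) F → IsPrimitive F →
                          HasBlock a t b (matrix f) → Admissible f
  reciprocal⇒admissible f {F} r F-prim block = f-primitive , (Ω≡k , det≡k²) , block⇒represents f block
    where
    Ω≡k : Ω f ≡ k
    Ω≡k = Ω-scaled k≡+2p f F (Reciprocal.cofactor-A r) F-prim
    det≡k² : det (matrix f) ≡ 1ℤ * k ℤ.^ 2
    det≡k² = trans (Reciprocal.det-A r) (lemma k)
      where
      lemma : ∀ c → c * c ≡ 1ℤ * (c * (c * 1ℤ))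
      lemma = solve-∀
    f-primitive : Primitive f
    f-primitive = gcds²-primitive (matrix f) λ c c∣A → square∣2p p-prime 3≤p c
      (Ω-∣ f (trans Ω≡k k≡+2p) c∣A)

  f₀ : TernaryForm
  f₀ = form A₀

  admissible₀ : Admissible f₀
  admissible₀ = reciprocal⇒admissible f₀ {F₀}
    (Reciprocal-cong (≐-sym (matrix-form (Reciprocal.symmetric reciprocal₀))) reciprocal₀) F₀-primitive block₀

  normalForm⇒even : ∀ {A F} {r : Reciprocal k A F} → NormalForm r → ∀ i → + 2 ∣ F i i
  normalForm⇒even {F = F} m i = subst (+ 2 ∣_) (sym (recover-F i i))
    (congruence-even-diagonal (Q ᵗ) F₀ (reciprocal-sym reciprocal₀) even i)
    where
    open NormalForm m
    even : ∀ i → + 2 ∣ F₀ i i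
    even = λ where
      0F → ∣m⇒∣m*n x ∣-refl
      1F → ∣m⇒∣m*n z ∣-refl
      2F → ∣-refl

  reciprocal-form : ∀ f → Admissible f →
    ∃[ F ] F IsReciprocalOf f × ImproperlyPrimitive F × discriminant F ≡ + p ℚ./ 1
  reciprocal-form f admissible@(_ , (Ω≡k , _) , _) = finish (admissible⇒normalForm f admissible)
    where
    finish : (Σ[ F ∈ Matrix 3 3 ] Σ[ r ∈ Reciprocal k (matrix f) F ] NormalForm r) →
      ∃[ F ] F IsReciprocalOf f × ImproperlyPrimitive F × discriminant F ≡ + p ℚ./ 1
    finish (F , r , m) = form F , isReciprocal ,
      (gcds²-primitive (matrix (form F)) prim , even-σ (form F) prim even) , disc
      where
      F≐ : matrix (form F) ≐ F
      F≐ = matrix-form (reciprocal-sym r)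
      isReciprocal : form F IsReciprocalOf f
      isReciprocal i j = trans (cong₂ _*_ Ω≡k (F≐ i j)) (sym (Reciprocal.cofactor-A r i j))
      prim : IsPrimitive (matrix (form F))
      prim = IsPrimitive-cong (≐-sym F≐) (primitive-Ω f F (Reciprocal.cofactor-A r) Ω≡k)
      even : ∀ i → + 2 ∣ matrix (form F) i i
      even i = subst (+ 2 ∣_) (sym (F≐ i i)) (normalForm⇒even m i)
      halve : + 2 * + p ℚ./ 2 ≡ + p ℚ./ 1
      halve = ℚ.fromℚᵘ-cong {mkℚᵘ (+ 2 * + p) 1} {mkℚᵘ (+ p) 0} (*≡* (lemma (+ p)))
        where
        lemma : ∀ q → + 2 * q * 1ℤ ≡ q * + 2
        lemma = solve-∀
      disc : discriminant (form F) ≡ + p ℚ./ 1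
      disc = trans (cong (ℚ._/ 2) (trans (trans (det-cong F≐) (reciprocal-det r)) (trans k≡+2p (ℤ.pos-* 2 p)))) halve

-- Quadratic reciprocity

sgn : Sign → ℤ
sgn s = s ◃ 1

sgn-* : ∀ s t → sgn (s Sign.* t) ≡ sgn s * sgn t
sgn-* Sign.+ Sign.+ = refl
sgn-* Sign.+ Sign.- = refl
sgn-* Sign.- Sign.+ = refl
sgn-* Sign.- Sign.- = refl

sgn-square : ∀ s → sgn s * sgn s ≡ 1ℤ
sgn-square Sign.+ = refl
sgn-square Sign.- = refl

module Modulo (M : ℤ) where

  infix 4 _≈_

  -- A record and not a synonym for `M ∣ x - y`: the two sides can then be inferred from the type,
  -- which a difference does not allow.
  record _≈_ (x y : ℤ) : Set where
    constructor mod
    field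
      difference : M ∣ x - y
  open _≈_ public

  private
    lift : ∀ {x y z} → M ∣ z → z ≡ x - y → x ≈ y
    lift d refl = mod d

  ≈-reflexive : ∀ {x y} → x ≡ y → x ≈ y
  ≈-reflexive {x} refl = mod (divides 0ℤ (ℤ.+-inverseʳ x))

  ≈-refl : ∀ {x} → x ≈ x
  ≈-refl = ≈-reflexive refl

  ≈-sym : ∀ {x y} → x ≈ y → y ≈ x
  ≈-sym {x} {y} (mod d) = lift (∣m⇒∣-m d) (lemma x y)
    where
    lemma : ∀ x y → - (x - y) ≡ y - x
    lemma = solve-∀

  ≈-trans : ∀ {x y z} → x ≈ y → y ≈ z → x ≈ z
  ≈-trans {x} {y} {z} (mod d) (mod e) = lift (∣m∣n⇒∣m+n d e) (lemma x y z)
    where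
    lemma : ∀ x y z → (x - y) + (y - z) ≡ x - z
    lemma = solve-∀

  ≈-setoid : Setoid _ _
  ≈-setoid = record
    { Carrier = ℤ
    ; _≈_ = _≈_
    ; isEquivalence = record { refl = ≈-refl ; sym = ≈-sym ; trans = ≈-trans }
    }

  module ≈-Reasoning = SetoidReasoning ≈-setoid

  *-cong : ∀ {x y z w} → x ≈ y → z ≈ w → x * z ≈ y * w
  *-cong {x} {y} {z} {w} (mod d) (mod e) =
    lift (∣m∣n⇒∣m+n (∣m⇒∣m*n z d) (∣n⇒∣m*n y e)) (lemma x y z w)
    where
    lemma : ∀ x y z w → (x - y) * z + y * (z - w) ≡ x * z - y * w
    lemma = solve-∀

  *-congˡ : ∀ x {y z} → y ≈ z → x * y ≈ x * z
  *-congˡ x = *-cong (≈-refl {x})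

  *-congʳ : ∀ {x y} z → x ≈ y → x * z ≈ y * z
  *-congʳ z e = *-cong e (≈-refl {z})

  +-cong : ∀ {x y z w} → x ≈ y → z ≈ w → x + z ≈ y + w
  +-cong {x} {y} {z} {w} (mod d) (mod e) = lift (∣m∣n⇒∣m+n d e) (lemma x y z w)
    where
    lemma : ∀ x y z w → (x - y) + (z - w) ≡ (x + z) - (y + w)
    lemma = solve-∀

  ∣⇒≈0 : ∀ {x} → M ∣ x → x ≈ 0ℤ
  ∣⇒≈0 {x} d = lift d (sym (ℤ.+-identityʳ x))

  ≈0⇒∣ : ∀ {x} → x ≈ 0ℤ → M ∣ x
  ≈0⇒∣ {x} (mod d) = subst (M ∣_) (ℤ.+-identityʳ x) d

  Inverse : ℤ → ℤ → Set
  Inverse x y = x * y ≈ 1ℤ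

  inverse-sym : ∀ {x y} → Inverse x y → Inverse y x
  inverse-sym {x} {y} = ≈-trans (≈-reflexive (ℤ.*-comm y x))

-- In ∏ n f the index runs from 1 to n.
module Product {c ℓ} (C : CommutativeMonoid c ℓ) where
  open CommutativeMonoid C using (Carrier) renaming (_≈_ to _≋_; trans to ≋-trans; sym to ≋-sym)
  open Summation C public using (sum; sum-cong-≗; ∑-distrib-+; ∑-comm; sum-permute)

  ∏ : ℕ → (ℕ → Carrier) → Carrier
  ∏ n f = sum {n} λ i → f (suc (toℕ i))

  Range : ℕ → ℕ → Set
  Range n k = 0 < k × k ≤ n

  ∏-permute : ∀ n (π π⁻¹ : ℕ → ℕ) →
    (∀ {k} → Range n k → Range n (π k)) → (∀ {k} → Range n k → Range n (π⁻¹ k)) →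
    (∀ {k} → Range n k → π⁻¹ (π k) ≡ k) → (∀ {k} → Range n k → π (π⁻¹ k) ≡ k) →
    ∀ f → ∏ n (f ∘ π) ≋ ∏ n f
  ∏-permute n π π⁻¹ range range⁻¹ left right f = ≋-sym (≋-trans (sum-permute (λ i → f (suc (toℕ i))) perm)
    (CommutativeMonoid.reflexive C (sum-cong-≗ λ i → cong f (suc-toℕ-index (range (in-range i))))))
    where
    in-range : (i : Fin n) → Range n (suc (toℕ i))
    in-range i = s≤s z≤n , Fin.toℕ<n i
    index : ∀ {k} → Range n k → Fin n
    index {suc k} (_ , k<n) = fromℕ< k<n
    suc-toℕ-index : ∀ {k} (r : Range n k) → suc (toℕ (index r)) ≡ k
    suc-toℕ-index {suc k} (_ , k<n) = cong suc (Fin.toℕ-fromℕ< k<n)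
    to from : Fin n → Fin n
    to   i = index (range (in-range i))
    from i = index (range⁻¹ (in-range i))
    round : ∀ (σ τ : ℕ → ℕ) (rσ : ∀ {k} → Range n k → Range n (σ k)) (rτ : ∀ {k} → Range n k → Range n (τ k)) →
      (∀ {k} → Range n k → σ (τ k) ≡ k) → ∀ i → index (rσ (in-range (index (rτ (in-range i))))) ≡ i
    round σ τ rσ rτ inv i = Fin.toℕ-injective (ℕ.suc-injective (begin
      suc (toℕ (index (rσ (in-range (index (rτ (in-range i)))))))
        ≡⟨ suc-toℕ-index (rσ (in-range (index (rτ (in-range i))))) ⟩
      σ (suc (toℕ (index (rτ (in-range i)))))
        ≡⟨ cong σ (suc-toℕ-index (rτ (in-range i))) ⟩
      σ (τ (suc (toℕ i)))                                           ≡⟨ inv (in-range i) ⟩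
      suc (toℕ i)                                                   ∎))
      where open ≡-Reasoning
    perm : Permutation′ n
    perm = permutation to from
      (round π π⁻¹ range range⁻¹ right) (round π⁻¹ π range⁻¹ range left)

module ∏± = Product Sign.*-commutativeMonoid
module ∏ℤ = Product ℤ.*-1-commutativeMonoid

open ∏± using (∏; Range; ∑-distrib-+; ∑-comm)

∣<⇒≡0 : ∀ {m n} → m ℕ.∣ n → n < m → n ≡ 0
∣<⇒≡0 {n = zero}  m∣n n<m = refl
∣<⇒≡0 {n = suc n} m∣n n<m = contradiction (ℕ.∣⇒≤ m∣n) (ℕ.<⇒≱ n<m)

-- Absolutely least residues and Gauss's signs for an odd modulus

module LeastResidue (h : ℕ) where

  N : ℕ
  N = suc (h ℕ.+ h)

  open Modulo (+ N)

  private
    ≤h⇒<N : ∀ {a} → a ≤ h → a < N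
    ≤h⇒<N a≤h = s≤s (ℕ.≤-trans a≤h (ℕ.m≤m+n h h))

  difference-small : ∀ {a b} → a ≤ h → b ≤ h → + N ∣ + a - + b → a ≡ b
  difference-small {a} {b} a≤h b≤h d = ℤ.+-injective (ℤ.i-j≡0⇒i≡j (+ a) (+ b) (ℤ.∣i∣≡0⇒i≡0
    (∣<⇒≡0 (∣⇒∣ᵤ d) (ℕ.≤-<-trans bound (≤h⇒<N (ℕ.⊔-lub a≤h b≤h))))))
    where
    bound : ∣ + a - + b ∣ ≤ a ℕ.⊔ b
    bound = subst (λ x → ∣ x ∣ ≤ a ℕ.⊔ b) (sym (ℤ.m-n≡m⊖n a b)) (ℤ.∣m⊝n∣≤m⊔n a b)

  sum-small : ∀ {a b} → a ≤ h → b ≤ h → + N ∣ + a + + b → a ≡ 0 × b ≡ 0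
  sum-small {a} {b} a≤h b≤h d = ℕ.m+n≡0⇒m≡0 a a+b≡0 , ℕ.m+n≡0⇒n≡0 a a+b≡0
    where
    a+b≡0 : a ℕ.+ b ≡ 0
    a+b≡0 = ∣<⇒≡0 (∣⇒∣ᵤ d) (s≤s (ℕ.+-mono-≤ a≤h b≤h))

  -- Two integers of absolute value at most h differ by at most 2h < N, so congruence is equality;
  -- only 0 can be written with both signs.
  signed-unique : ∀ s t {a b} → a ≤ h → b ≤ h → sgn s * + a ≈ sgn t * + b → a ≡ b × (a ≢ 0 → s ≡ t)
  signed-unique Sign.+ Sign.+ {a} {b} a≤h b≤h (mod d) =
    difference-small a≤h b≤h (subst (+ N ∣_) (cong₂ _-_ (ℤ.*-identityˡ (+ a)) (ℤ.*-identityˡ (+ b))) d) , λ _ → refl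
  signed-unique Sign.- Sign.- {a} {b} a≤h b≤h (mod d) =
    sym (difference-small b≤h a≤h (subst (+ N ∣_) (lemma (+ a) (+ b)) d)) , λ _ → refl
    where
    lemma : ∀ x y → -1ℤ * x - -1ℤ * y ≡ y - x
    lemma = solve-∀
  signed-unique Sign.+ Sign.- {a} {b} a≤h b≤h (mod d) =
    let a≡0 , b≡0 = sum-small a≤h b≤h (subst (+ N ∣_) (lemma (+ a) (+ b)) d)
    in trans a≡0 (sym b≡0) , contradiction a≡0
    where
    lemma : ∀ x y → 1ℤ * x - -1ℤ * y ≡ x + y
    lemma = solve-∀
  signed-unique Sign.- Sign.+ {a} {b} a≤h b≤h (mod d) =
    let a≡0 , b≡0 = sum-small a≤h b≤h (subst (+ N ∣_) (lemma (+ a) (+ b)) (∣m⇒∣-m d))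
    in trans a≡0 (sym b≡0) , contradiction a≡0
    where
    lemma : ∀ x y → - (-1ℤ * x - 1ℤ * y) ≡ x + y
    lemma = solve-∀

  fold : ℕ → Sign × ℕ
  fold r with r ℕ.≤? h
  ... | yes _ = Sign.+ , r
  ... | no  _ = Sign.- , N ∸ r

  fold-≤h : ∀ {r} → r < N → proj₂ (fold r) ≤ h
  fold-≤h {r} r<N with r ℕ.≤? h
  ... | yes r≤h = r≤h
  ... | no  r≰h = ℕ.≤-trans (ℕ.∸-monoʳ-≤ N (ℕ.≰⇒> r≰h)) (ℕ.≤-reflexive (ℕ.m+n∸m≡n h h))

  fold-≈ : ∀ {r} → r < N → + r ≈ sgn (proj₁ (fold r)) * + proj₂ (fold r)
  fold-≈ {r} r<N with r ℕ.≤? h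
  ... | yes _ = ≈-reflexive (sym (ℤ.*-identityˡ (+ r)))
  ... | no  _ = mod (divides 1ℤ (trans (cong (λ x → + r - -1ℤ * x)
                  (trans (sym (ℤ.⊖-≥ (ℕ.<⇒≤ r<N))) (sym (ℤ.m-n≡m⊖n N r))))
                                (lemma (+ N) (+ r))))
    where
    lemma : ∀ n r → r - -1ℤ * (n - r) ≡ 1ℤ * n
    lemma = solve-∀

  -- Sign and absolute value of the residue of `z` in the interval from -h to h.
  ε : ℤ → Sign
  ε z = proj₁ (fold (z %ℕ N))

  ρ : ℤ → ℕ
  ρ z = proj₂ (fold (z %ℕ N))

  ρ-≤h : ∀ z → ρ z ≤ h
  ρ-≤h z = fold-≤h (ℤ.n%ℕd<d z N)

  ερ-≈ : ∀ z → z ≈ sgn (ε z) * + ρ z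
  ερ-≈ z = ≈-trans (mod (divides (z /ℕ N)
      (trans (cong (_- + (z %ℕ N)) (ℤ.a≡a%ℕn+[a/ℕn]*n z N)) (lemma (+ (z %ℕ N)) (z /ℕ N * + N)))))
                   (fold-≈ (ℤ.n%ℕd<d z N))
    where
    lemma : ∀ x y → x + y - x ≡ y
    lemma = solve-∀

  ρ-unique : ∀ z s {a} → a ≤ h → z ≈ sgn s * + a → ρ z ≡ a
  ρ-unique z s a≤h e = proj₁ (signed-unique (ε z) s (ρ-≤h z) a≤h (≈-trans (≈-sym (ερ-≈ z)) e))

  ε-unique : ∀ z s {a} → a ≤ h → z ≈ sgn s * + a → a ≢ 0 → ε z ≡ s
  ε-unique z s a≤h e a≢0 = proj₂ (signed-unique (ε z) s (ρ-≤h z) a≤h (≈-trans (≈-sym (ερ-≈ z)) e))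
    (λ ρ≡0 → a≢0 (trans (sym (ρ-unique z s a≤h e)) ρ≡0))

  -- Gauss's lemma turned into a definition. For `m` prime to `N` this is the Jacobi symbol (m / N),
  -- and `N` may be composite.
  χ : ℤ → Sign
  χ m = ∏ h λ k → ε (m * + k)

  -- Multiplication by a unit permutes the classes of 1, …, h up to sign.
  module _ {m m⁻¹ : ℤ} (inverse : Inverse m m⁻¹) where

    ρ-inverse : ∀ {k} → k ≤ h → ρ (m⁻¹ * + ρ (m * + k)) ≡ k
    ρ-inverse {k} k≤h = ρ-unique (m⁻¹ * + ρ (m * + k)) (ε (m * + k)) k≤h (begin
      m⁻¹ * + ρ (m * + k)                    ≡⟨ ℤ.*-identityˡ _ ⟨
      1ℤ * (m⁻¹ * + ρ (m * + k))             ≡⟨ cong (_* (m⁻¹ * + ρ (m * + k))) (sgn-square s) ⟨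
      sgn s * sgn s * (m⁻¹ * + ρ (m * + k))  ≡⟨ lemma (sgn s) m⁻¹ (+ ρ (m * + k)) ⟩
      sgn s * m⁻¹ * (sgn s * + ρ (m * + k))  ≈⟨ *-congˡ (sgn s * m⁻¹) (ερ-≈ (m * + k)) ⟨
      sgn s * m⁻¹ * (m * + k)                ≡⟨ lemma′ (sgn s) m⁻¹ m (+ k) ⟩
      sgn s * + k * (m * m⁻¹)                ≈⟨ *-congˡ (sgn s * + k) inverse ⟩
      sgn s * + k * 1ℤ                       ≡⟨ ℤ.*-identityʳ _ ⟩
      sgn s * + k                            ∎)
      where
      open ≈-Reasoning
      s = ε (m * + k)
      lemma : ∀ s m r → s * s * (m * r) ≡ s * m * (s * r)
      lemma = solve-∀
      lemma′ : ∀ s m n k → s * m * (n * k) ≡ s * k * (n * m)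
      lemma′ = solve-∀

    ρ-range : ∀ {k} → Range h k → Range h (ρ (m * + k))
    ρ-range {k} (0<k , k≤h) = ℕ.n≢0⇒n>0 ρ≢0 , ρ-≤h (m * + k)
      where
      ρ0≡0 : ρ (m⁻¹ * + 0) ≡ 0
      ρ0≡0 = ρ-unique (m⁻¹ * + 0) Sign.+ z≤n (≈-reflexive (ℤ.*-zeroʳ m⁻¹))
      ρ≢0 : ρ (m * + k) ≢ 0
      ρ≢0 ρ≡0 = ℕ.<⇒≢ 0<k (trans (sym ρ0≡0) (trans (cong (λ r → ρ (m⁻¹ * + r)) (sym ρ≡0)) (ρ-inverse k≤h)))

  module _ {c ℓ} (C : CommutativeMonoid c ℓ) where
    private module P = Product C

    -- Stated over any commutative monoid because it serves both products of signs, in reciprocity,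
    -- and products of integers, in Euler's criterion.
    ∏-ρ : ∀ {m m⁻¹} → Inverse m m⁻¹ → ∀ f →
          CommutativeMonoid._≈_ C (P.∏ h λ k → f (ρ (m * + k))) (P.∏ h f)
    ∏-ρ {m} {m⁻¹} inverse = P.∏-permute h (λ k → ρ (m * + k)) (λ k → ρ (m⁻¹ * + k))
      (ρ-range {m} inverse) (ρ-range {m⁻¹} inverse⁻¹)
      (λ r → ρ-inverse {m} inverse (proj₂ r)) (λ r → ρ-inverse {m⁻¹} inverse⁻¹ (proj₂ r))
      where
      inverse⁻¹ : Inverse m⁻¹ m
      inverse⁻¹ = inverse-sym {m} inverse

-- Eisenstein's lattice points

parity : ℕ → Sign
parity zero    = Sign.+
parity (suc n) = Sign.opposite (parity n)

opposite-* : ∀ s t → Sign.opposite s Sign.* t ≡ Sign.opposite (s Sign.* t)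
opposite-* Sign.+ Sign.+ = refl
opposite-* Sign.+ Sign.- = refl
opposite-* Sign.- Sign.+ = refl
opposite-* Sign.- Sign.- = refl

parity-+ : ∀ m n → parity (m ℕ.+ n) ≡ parity m Sign.* parity n
parity-+ zero    n = refl
parity-+ (suc m) n = trans (cong Sign.opposite (parity-+ m n)) (sym (opposite-* (parity m) (parity n)))

parity-double : ∀ n → parity (n ℕ.+ n) ≡ Sign.+
parity-double n = trans (parity-+ n n) (Sign.s*s≡+ (parity n))

parity-odd-* : ∀ h n → parity (suc (h ℕ.+ h) ℕ.* n) ≡ parity n
parity-odd-* h n = begin
  parity (n ℕ.+ (h ℕ.+ h) ℕ.* n)                    ≡⟨ parity-+ n _ ⟩
  parity n Sign.* parity ((h ℕ.+ h) ℕ.* n)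
    ≡⟨ cong (λ d → parity n Sign.* parity d) (ℕ.*-distribʳ-+ n h h) ⟩
  parity n Sign.* parity (h ℕ.* n ℕ.+ h ℕ.* n)
    ≡⟨ cong (parity n Sign.*_) (parity-double (h ℕ.* n)) ⟩
  parity n Sign.* Sign.+                            ≡⟨ Sign.*-identityʳ (parity n) ⟩
  parity n                                          ∎
  where open ≡-Reasoning

∏-const : ∀ n s → ∏ (n ℕ.+ n) (λ _ → s) ≡ Sign.+
∏-const n s = trans (∏-+ n n) (Sign.s*s≡+ (∏ n (λ _ → s)))
  where
  ∏-+ : ∀ m n → ∏ (m ℕ.+ n) (λ _ → s) ≡ ∏ m (λ _ → s) Sign.* ∏ n (λ _ → s)
  ∏-+ zero    n = refl
  ∏-+ (suc m) n = trans (cong (s Sign.*_) (∏-+ m n)) (sym (Sign.*-assoc s (∏ m (λ _ → s)) (∏ n (λ _ → s))))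

-- The sign - when x ≤ y and + otherwise.
below : ℕ → ℕ → Sign
below zero    y       = Sign.-
below (suc x) zero    = Sign.+
below (suc x) (suc y) = below x y

below-≤ : ∀ {x y} → x ≤ y → below x y ≡ Sign.-
below-≤ z≤n       = refl
below-≤ (s≤s x≤y) = below-≤ x≤y

below-> : ∀ {x y} → y < x → below x y ≡ Sign.+
below-> {suc x} {zero}  _         = refl
below-> {suc x} {suc y} (s≤s y<x) = below-> y<x

below-swap : ∀ {x y} → x ≢ y → below x y ≡ Sign.- Sign.* below y x
below-swap {x} {y} x≢y with ℕ.<-cmp x y
... | tri< x<y _ _ = trans (below-≤ (ℕ.<⇒≤ x<y)) (cong (Sign.- Sign.*_) (sym (below-> x<y)))
... | tri≈ _ x≡y _ = contradiction x≡y x≢y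
... | tri> _ _ y<x = trans (below-> y<x) (cong (Sign.- Sign.*_) (sym (below-≤ (ℕ.<⇒≤ y<x))))

-- Exactly q of the numbers 1, ..., H are at most q, each contributing one minus sign.
∏-below : ∀ H {q} → q ≤ H → ∏ H (λ j → below j q) ≡ parity q
∏-below zero    {zero}  z≤n       = refl
∏-below (suc H) {zero}  z≤n       = ∏-below H {zero} z≤n
∏-below (suc H) {suc q} (s≤s q≤H) = cong Sign.opposite (∏-below H q≤H)

∏-cong : ∀ n {f g : ℕ → Sign} → (∀ {k} → Range n k → f k ≡ g k) → ∏ n f ≡ ∏ n g
∏-cong n e = ∏±.sum-cong-≗ λ i → e (s≤s z≤n , Fin.toℕ<n i)

module Eisenstein (h : ℕ) where
  open LeastResidue h
  open Modulo (+ N)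

  -- `N` is odd, so r and N - r have opposite parity; the sign of the fold records just that.
  fold-parity : ∀ {r} → r < N → parity r ≡ proj₁ (fold r) Sign.* parity (proj₂ (fold r))
  fold-parity {r} r<N with r ℕ.≤? h
  ... | yes _ = refl
  ... | no  _ = trans (lemma (parity (N ∸ r)) (parity r)) (cong (Sign._* parity (N ∸ r)) odd)
    where
    lemma : ∀ s t → t ≡ s Sign.* t Sign.* s
    lemma Sign.+ Sign.+ = refl
    lemma Sign.+ Sign.- = refl
    lemma Sign.- Sign.+ = refl
    lemma Sign.- Sign.- = refl
    odd : parity (N ∸ r) Sign.* parity r ≡ Sign.-
    odd = trans (sym (parity-+ (N ∸ r) r))
      (trans (cong parity (ℕ.m∸n+n≡m (ℕ.<⇒≤ r<N))) (cong Sign.opposite (parity-double h)))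

  module _ (H : ℕ) where

    private
      m : ℕ
      m = suc (H ℕ.+ H)

    -- Read mk = qN + r modulo 2. As m and N are odd, k ≡ q + r, and `fold-parity` expresses the
    -- parity of r through the sign and the absolute residue; solve for the sign.
    ε-floor : ∀ k → ε (+ m * + k) ≡ parity (m ℕ.* k ℕ./ N) Sign.* (parity k Sign.* parity (ρ (+ m * + k)))
    -- The rewriting makes the argument of `ε` a natural number, whose integer remainder then
    -- computes to the natural one.
    ε-floor k rewrite sym (ℤ.pos-* m k) = trans (lemma s (parity (proj₂ (fold r))) (parity q))
      (cong (λ t → parity q Sign.* (t Sign.* parity (proj₂ (fold r)))) (sym parity-k))
      where
      open ≡-Reasoning
      r = m ℕ.* k ℕ.% N
      q = m ℕ.* k ℕ./ N
      s = proj₁ (fold r)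
      parity-k : parity k ≡ s Sign.* parity (proj₂ (fold r)) Sign.* parity q
      parity-k = begin
        parity k                                            ≡⟨ parity-odd-* H k ⟨
        parity (m ℕ.* k)
          ≡⟨ cong parity (ℕ.m≡m%n+[m/n]*n (m ℕ.* k) N) ⟩
        parity (r ℕ.+ q ℕ.* N)                              ≡⟨ parity-+ r (q ℕ.* N) ⟩
        parity r Sign.* parity (q ℕ.* N)
          ≡⟨ cong₂ Sign._*_ (fold-parity (ℕ.m%n<n (m ℕ.* k) N))
               (trans (cong parity (ℕ.*-comm q N)) (parity-odd-* h q)) ⟩
        s Sign.* parity (proj₂ (fold r)) Sign.* parity q    ∎
      lemma : ∀ s t u → s ≡ u Sign.* (s Sign.* t Sign.* u Sign.* t)
      lemma Sign.+ Sign.+ Sign.+ = refl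
      lemma Sign.+ Sign.+ Sign.- = refl
      lemma Sign.+ Sign.- Sign.+ = refl
      lemma Sign.+ Sign.- Sign.- = refl
      lemma Sign.- Sign.+ Sign.+ = refl
      lemma Sign.- Sign.+ Sign.- = refl
      lemma Sign.- Sign.- Sign.+ = refl
      lemma Sign.- Sign.- Sign.- = refl

    -- As k runs through 1, ..., h, so does ρ(mk); the parities of both therefore cancel and only
    -- the quotients remain.
    χ-floor : ∀ {m⁻¹} → Inverse (+ m) m⁻¹ → χ (+ m) ≡ ∏ h (λ k → parity (m ℕ.* k ℕ./ N))
    χ-floor inverse = begin
      χ (+ m)
        ≡⟨ ∏-cong h (λ {k} _ → ε-floor k) ⟩
      ∏ h (λ k → parity (m ℕ.* k ℕ./ N) Sign.* (parity k Sign.* parity (ρ (+ m * + k))))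
        ≡⟨ ∑-distrib-+ {h} (λ i → parity (m ℕ.* suc (toℕ i) ℕ./ N))
             (λ i → parity (suc (toℕ i)) Sign.* parity (ρ (+ m * + suc (toℕ i)))) ⟩
      F Sign.* ∏ h (λ k → parity k Sign.* parity (ρ (+ m * + k)))
        ≡⟨ cong (F Sign.*_) (∑-distrib-+ {h} (λ i → parity (suc (toℕ i))) (λ i → parity (ρ (+ m * + suc (toℕ i))))) ⟩
      F Sign.* (∏ h parity Sign.* ∏ h (λ k → parity (ρ (+ m * + k))))
        ≡⟨ cong (λ s → F Sign.* (∏ h parity Sign.* s)) (∏-ρ Sign.*-commutativeMonoid {+ m} inverse parity) ⟩
      F Sign.* (∏ h parity Sign.* ∏ h parity)
        ≡⟨ cong (F Sign.*_) (Sign.s*s≡+ (∏ h parity)) ⟩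
      F Sign.* Sign.+
        ≡⟨ Sign.*-identityʳ F ⟩
      F ∎
      where
      open ≡-Reasoning
      F = ∏ h (λ k → parity (m ℕ.* k ℕ./ N))

    -- The quotient counts the j ≥ 1 with Nj ≤ mk. Since k ≤ h is less than N/2, such j are less
    -- than m/2, so stopping at H loses none.
    parity-floor : ∀ {k} → k ≤ h → parity (m ℕ.* k ℕ./ N) ≡ ∏ H (λ j → below (N ℕ.* j) (m ℕ.* k))
    parity-floor {k} k≤h = trans (sym (∏-below H q≤H)) (∏-cong H λ {j} _ → agree j)
      where
      q = m ℕ.* k ℕ./ N
      q≤H : q ≤ H
      q≤H = ℕ.≤-pred (ℕ.m<n*o⇒m/o<n {m ℕ.* k} {suc H} {N} (ℕ.≤-<-trans (ℕ.*-monoʳ-≤ m k≤h) bound))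
        where
        bound : m ℕ.* h < suc H ℕ.* N
        bound = ℕ.≤-trans (ℕ.m≤m+n (suc (m ℕ.* h)) (h ℕ.+ H)) (ℕ.≤-reflexive (lemma H h))
          where
          lemma : ∀ H h → suc (suc (H ℕ.+ H) ℕ.* h) ℕ.+ (h ℕ.+ H) ≡ suc H ℕ.* suc (h ℕ.+ h)
          lemma = ℕ-solve-∀
      agree : ∀ j → below j q ≡ below (N ℕ.* j) (m ℕ.* k)
      agree j with j ℕ.≤? q
      ... | yes j≤q = trans (below-≤ j≤q) (sym (below-≤ (ℕ.≤-trans (ℕ.≤-reflexive (ℕ.*-comm N j))
                        (ℕ.≤-trans (ℕ.*-monoˡ-≤ N j≤q) (ℕ.m/n*n≤m (m ℕ.* k) N)))))
      ... | no  j≰q = trans (below-> (ℕ.≰⇒> j≰q)) (sym (below-> (ℕ.≰⇒> λ Nj≤mk →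
                        j≰q (ℕ.≤-trans (ℕ.≤-reflexive (sym (ℕ.m*n/n≡m j N)))
                          (ℕ./-monoˡ-≤ N (ℕ.≤-trans (ℕ.≤-reflexive (ℕ.*-comm j N)) Nj≤mk))))))

    χ-lattice : ∀ {m⁻¹} → Inverse (+ m) m⁻¹ → χ (+ m) ≡ ∏ h (λ k → ∏ H (λ j → below (N ℕ.* j) (m ℕ.* k)))
    χ-lattice inverse = trans (χ-floor inverse) (∏-cong h λ r → parity-floor (proj₂ r))

    -- A point on the diagonal would be counted on both sides. It would force N ∣ mk, hence N ∣ k
    -- because `m` is a unit, against 0 < k ≤ h.
    no-lattice-point : ∀ {m⁻¹} → Inverse (+ m) m⁻¹ → ∀ {j k} → Range h k → N ℕ.* j ≢ m ℕ.* k
    no-lattice-point {m⁻¹} inverse {j} {k} (0<k , k≤h) Nj≡mk =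
      contradiction (∣<⇒≡0 (∣⇒∣ᵤ (≈0⇒∣ k≈0)) (s≤s (ℕ.≤-trans k≤h (ℕ.m≤m+n h h)))) (ℕ.<⇒≢ 0<k ∘ sym)
      where
      open ≈-Reasoning
      lemma : ∀ m n k → m * n * k ≡ n * (m * k)
      lemma = solve-∀
      k≈0 : + k ≈ 0ℤ
      k≈0 = begin
        + k                   ≡⟨ ℤ.*-identityˡ (+ k) ⟨
        1ℤ * + k              ≈⟨ *-congʳ (+ k) inverse ⟨
        + m * m⁻¹ * + k       ≡⟨ lemma (+ m) m⁻¹ (+ k) ⟩
        m⁻¹ * (+ m * + k)
          ≡⟨ cong (m⁻¹ *_) (trans (sym (ℤ.pos-* m k)) (trans (cong +_ (sym Nj≡mk)) (ℤ.pos-* N j))) ⟩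
        m⁻¹ * (+ N * + j)     ≈⟨ *-congˡ m⁻¹ (∣⇒≈0 (∣m⇒∣m*n (+ j) ∣-refl)) ⟩
        m⁻¹ * 0ℤ              ≡⟨ ℤ.*-zeroʳ m⁻¹ ⟩
        0ℤ                    ∎

-- The two symbols count the points of an h × H rectangle on the two sides of its diagonal. Passing
-- from one side to the other costs (-1)^(hH), which is + because h = 2g.
reciprocity : ∀ g H {x y} (let h = g ℕ.+ g; n = suc (h ℕ.+ h); m = suc (H ℕ.+ H)) →
  Modulo.Inverse (+ n) (+ m) x → Modulo.Inverse (+ m) (+ n) y →
  LeastResidue.χ h (+ m) ≡ LeastResidue.χ H (+ n)
reciprocity g H inverse-m inverse-n = begin
  LeastResidue.χ h (+ m)
    ≡⟨ Eisenstein.χ-lattice h H inverse-m ⟩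
  ∏ h (λ k → ∏ H (λ j → below (n ℕ.* j) (m ℕ.* k)))
    ≡⟨ ∏-cong h swapped ⟩
  ∏ h (λ k → ∏ H (λ j → Sign.- Sign.* below (m ℕ.* k) (n ℕ.* j)))
    ≡⟨ ∏-cong h (λ {k} _ → ∑-distrib-+ {H} (λ _ → Sign.-) (λ i → below (m ℕ.* k) (n ℕ.* suc (toℕ i)))) ⟩
  ∏ h (λ k → c Sign.* ∏ H (λ j → below (m ℕ.* k) (n ℕ.* j)))
    ≡⟨ ∑-distrib-+ {h} (λ _ → c) (λ i → ∏ H (λ j → below (m ℕ.* suc (toℕ i)) (n ℕ.* j))) ⟩
  ∏ h (λ _ → c) Sign.* ∏ h (λ k → ∏ H (λ j → below (m ℕ.* k) (n ℕ.* j)))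
    ≡⟨ cong₂ Sign._*_ (∏-const g c) (∑-comm {h} {H} (λ i j → below (m ℕ.* suc (toℕ i)) (n ℕ.* suc (toℕ j)))) ⟩
  ∏ H (λ j → ∏ h (λ k → below (m ℕ.* k) (n ℕ.* j)))
    ≡⟨ Eisenstein.χ-lattice H h inverse-n ⟨
  LeastResidue.χ H (+ n) ∎
  where
  open ≡-Reasoning
  h = g ℕ.+ g
  n = suc (h ℕ.+ h)
  m = suc (H ℕ.+ H)
  c = ∏ H (λ _ → Sign.-)
  swapped : ∀ {k} → Range h k → ∏ H (λ j → below (n ℕ.* j) (m ℕ.* k)) ≡
                                ∏ H (λ j → Sign.- Sign.* below (m ℕ.* k) (n ℕ.* j))
  swapped {k} r = ∏-cong H λ {j} _ → below-swap (Eisenstein.no-lattice-point h H inverse-m {j} {k} r)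

-- The symbol of a negated square

module NegatedSquare (g : ℕ) where

  private
    h : ℕ
    h = g ℕ.+ g

  open LeastResidue h
  open Modulo (+ N)

  -- Multiplying k by s twice gives -s²k ≡ -ε(sk) ε(s π(k)) π(π(k)), with π(k) = ρ(sk). Taking the
  -- product over k, the h = 2g minus signs cancel, and both remaining products equal χ(s) because π
  -- permutes 1, ..., h.
  χ-negated-square : ∀ {s s⁻¹ q} → Inverse s s⁻¹ → q ≈ - (s * s) → χ q ≡ Sign.+
  χ-negated-square {s} {s⁻¹} {q} inverse q≈-s² = begin
    χ q
      ≡⟨ ∏-cong h term ⟩
    ∏ h (λ k → Sign.- Sign.* (ε (s * + k) Sign.* ε (s * + π k)))
      ≡⟨ ∑-distrib-+ {h} (λ _ → Sign.-) (λ i → ε (s * + suc (toℕ i)) Sign.* ε (s * + π (suc (toℕ i)))) ⟩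
    ∏ h (λ _ → Sign.-) Sign.* ∏ h (λ k → ε (s * + k) Sign.* ε (s * + π k))
      ≡⟨ cong₂ Sign._*_ (∏-const g Sign.-)
           (∑-distrib-+ {h} (λ i → ε (s * + suc (toℕ i))) (λ i → ε (s * + π (suc (toℕ i))))) ⟩
    χ s Sign.* ∏ h (λ k → ε (s * + π k))
      ≡⟨ cong (χ s Sign.*_) (∏-ρ Sign.*-commutativeMonoid {s} inverse (λ k → ε (s * + k))) ⟩
    χ s Sign.* χ s
      ≡⟨ Sign.s*s≡+ (χ s) ⟩
    Sign.+ ∎
    where
    open ≡-Reasoning
    π : ℕ → ℕ
    π k = ρ (s * + k)
    term : ∀ {k} → Range h k → ε (q * + k) ≡ Sign.- Sign.* (ε (s * + k) Sign.* ε (s * + π k))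
    term {k} r = ε-unique (q * + k) (Sign.- Sign.* (e₁ Sign.* e₂)) (ρ-≤h (s * + π k)) expansion
      (ℕ.<⇒≢ (proj₁ (ρ-range {s} inverse (ρ-range {s} inverse r))) ∘ sym)
      where
      e₁ = ε (s * + k)
      e₂ = ε (s * + π k)
      lemma : ∀ s k → - (s * s) * k ≡ -1ℤ * s * (s * k)
      lemma = solve-∀
      lemma′ : ∀ s e r → -1ℤ * s * (e * r) ≡ -1ℤ * e * (s * r)
      lemma′ = solve-∀
      lemma″ : ∀ e e′ r → -1ℤ * e * (e′ * r) ≡ -1ℤ * (e * e′) * r
      lemma″ = solve-∀
      expansion : q * + k ≈ sgn (Sign.- Sign.* (e₁ Sign.* e₂)) * + π (π k)
      expansion = M.begin
        q * + k                                          M.≈⟨ *-congʳ (+ k) q≈-s² ⟩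
        - (s * s) * + k                                  M.≡⟨ lemma s (+ k) ⟩
        -1ℤ * s * (s * + k)                              M.≈⟨ *-congˡ (-1ℤ * s) (ερ-≈ (s * + k)) ⟩
        -1ℤ * s * (sgn e₁ * + π k)                       M.≡⟨ lemma′ s (sgn e₁) (+ π k) ⟩
        -1ℤ * sgn e₁ * (s * + π k)
          M.≈⟨ *-congˡ (-1ℤ * sgn e₁) (ερ-≈ (s * + π k)) ⟩
        -1ℤ * sgn e₁ * (sgn e₂ * + π (π k))              M.≡⟨ lemma″ (sgn e₁) (sgn e₂) (+ π (π k)) ⟩
        -1ℤ * (sgn e₁ * sgn e₂) * + π (π k)
          M.≡⟨ cong (_* + π (π k)) (trans (cong (-1ℤ *_) (sym (sgn-* e₁ e₂))) (sym (sgn-* Sign.- (e₁ Sign.* e₂)))) ⟩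
        sgn (Sign.- Sign.* (e₁ Sign.* e₂)) * + π (π k)   M.∎
        where module M = ≈-Reasoning

bézout-inverse : ∀ x n → gcd x n ≡ 1ℤ → ∃[ y ] Modulo.Inverse n x y
bézout-inverse x n coprime with y , z , eq ← bézout x n =
  y , mod (divides (- z) (trans (cong (λ d → x * y - d) (trans (sym coprime) (sym eq))) (lemma x y z n)))
  where
  open Modulo n
  lemma : ∀ x y z n → x * y - (y * x + z * n) ≡ - z * n
  lemma = solve-∀

prime∤⇒gcd≡1 : ∀ {p} → Prime p → ∀ x → ¬ (+ p ∣ x) → gcd x (+ p) ≡ 1ℤ
prime∤⇒gcd≡1 {p} p-prime x p∤x with prime⇒irreducible p-prime (ℕ.gcd[m,n]∣n ∣ x ∣ p)
... | inj₁ g≡1 = cong +_ g≡1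
... | inj₂ g≡p = contradiction (∣ᵤ⇒∣ (subst (ℕ._∣ ∣ x ∣) g≡p (ℕ.gcd[m,n]∣m ∣ x ∣ p))) p∤x

-- Polynomial roots modulo a prime and Euler's criterion

module PrimeModulus {p : ℕ} (p-prime : Prime p) where
  open Modulo (+ p)

  *-cancel : ∀ {x y z} → ¬ (+ p ∣ z) → x * z ≈ y * z → x ≈ y
  *-cancel {x} {y} {z} p∤z (mod d) with euclid p-prime (x - y) z (subst (+ p ∣_) (lemma x y z) d)
    where
    lemma : ∀ x y z → x * z - y * z ≡ (x - y) * z
    lemma = solve-∀
  ... | inj₁ e = mod e
  ... | inj₂ e = contradiction e p∤z

  -- The monic polynomial of degree n with the given lower coefficients, constant term first.
  monic : ∀ {n} → Vec ℤ n → ℤ → ℤ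
  monic Vec.[]       x = 1ℤ
  monic (c Vec.∷ cs) x = c + x * monic cs x

  -- Horner's scheme: the coefficients of the quotient by x - r are the values at r of the
  -- successive tails. The leading 1 stays implicit.
  quotientBy : ∀ {n} → ℤ → Vec ℤ (suc n) → Vec ℤ n
  quotientBy r (c Vec.∷ Vec.[])          = Vec.[]
  quotientBy r (c Vec.∷ cs@(_ Vec.∷ _))  = monic cs r Vec.∷ quotientBy r cs

  monic-division : ∀ {n} r (cs : Vec ℤ (suc n)) x →
                   monic cs x ≡ (x - r) * monic (quotientBy r cs) x + monic cs r
  monic-division r (c Vec.∷ Vec.[]) x = lemma r c x
    where
    lemma : ∀ r c x → c + x * 1ℤ ≡ (x - r) * 1ℤ + (c + r * 1ℤ)
    lemma = solve-∀
  monic-division r (c Vec.∷ cs@(_ Vec.∷ _)) x =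
    trans (cong (λ e → c + x * e) (monic-division r cs x)) (lemma r c x (monic (quotientBy r cs) x) (monic cs r))
    where
    lemma : ∀ r c x q e → c + x * ((x - r) * q + e) ≡ (x - r) * (e + x * q) + (c + r * e)
    lemma = solve-∀

  1≉0 : ¬ (1ℤ ≈ 0ℤ)
  1≉0 1≈0 with refl ← ℕ.∣1⇒≡1 (∣⇒∣ᵤ (≈0⇒∣ 1≈0)) = ¬prime[1] p-prime

  -- Lagrange's bound. Modulo a prime the other roots are roots of the quotient by x - r₀, again
  -- monic; in degree 0 the polynomial is 1.
  too-many-roots : ∀ {n} (cs : Vec ℤ n) (r : Fin (suc n) → ℤ) →
    (∀ i j → r i ≈ r j → i ≡ j) → ¬ (∀ i → monic cs (r i) ≈ 0ℤ)
  too-many-roots Vec.[]           r distinct root = 1≉0 (root zero)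
  too-many-roots cs@(_ Vec.∷ _) r distinct root =
    too-many-roots (quotientBy (r zero) cs) (r ∘ suc)
      (λ i j e → Fin.suc-injective (distinct (suc i) (suc j) e)) quotient-root
    where
    q : ℤ → ℤ
    q = monic (quotientBy (r zero) cs)
    quotient-root : ∀ i → q (r (suc i)) ≈ 0ℤ
    quotient-root i = [ (λ d → contradiction (distinct (suc i) zero (mod d)) λ ()) , ∣⇒≈0 ]′
      (euclid p-prime (r (suc i) - r zero) (q (r (suc i))) (≈0⇒∣ product≈0))
      where
      open ≈-Reasoning
      product≈0 : (r (suc i) - r zero) * q (r (suc i)) ≈ 0ℤ
      product≈0 = begin
        (r (suc i) - r zero) * q (r (suc i))                         ≡⟨ ℤ.+-identityʳ _ ⟨
        (r (suc i) - r zero) * q (r (suc i)) + 0ℤ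
          ≈⟨ +-cong (≈-refl {(r (suc i) - r zero) * q (r (suc i))}) (root zero) ⟨
        (r (suc i) - r zero) * q (r (suc i)) + monic cs (r zero)
          ≡⟨ monic-division (r zero) cs (r (suc i)) ⟨
        monic cs (r (suc i))                                         ≈⟨ root (suc i) ⟩
        0ℤ                                                           ∎

  monic-power : ∀ n x → monic (replicate n 0ℤ) x ≡ x ^ n
  monic-power zero    x = refl
  monic-power (suc n) x = trans (ℤ.+-identityˡ _) (cong (x *_) (monic-power n x))

  prime∤∏ : ∀ {n} (f : Fin n → ℤ) → (∀ i → ¬ (+ p ∣ f i)) → ¬ (+ p ∣ ∏ℤ.sum f)
  prime∤∏ {zero}  f p∤f p∣1 = 1≉0 (∣⇒≈0 p∣1)
  prime∤∏ {suc n} f p∤f p∣∏ with euclid p-prime (f zero) _ p∣∏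
  ... | inj₁ d = p∤f zero d
  ... | inj₂ d = prime∤∏ (f ∘ suc) (p∤f ∘ suc) d

^-distrib-* : ∀ x y n → (x * y) ^ n ≡ x ^ n * y ^ n
^-distrib-* x y zero    = refl
^-distrib-* x y (suc n) = trans (cong (x * y *_) (^-distrib-* x y n)) (lemma x y (x ^ n) (y ^ n))
  where
  lemma : ∀ x y a b → x * y * (a * b) ≡ x * a * (y * b)
  lemma = solve-∀

∏-scale : ∀ {n} m (f : Fin n → ℤ) → ∏ℤ.sum (λ i → m * f i) ≡ m ^ n * ∏ℤ.sum f
∏-scale {zero}  m f = refl
∏-scale {suc n} m f = trans (cong (m * f zero *_) (∏-scale m (f ∘ suc)))
  (lemma m (f zero) (m ^ n) (∏ℤ.sum (f ∘ suc)))
  where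
  lemma : ∀ m x a b → m * x * (a * b) ≡ m * a * (x * b)
  lemma = solve-∀

∏-signs : ∀ {n} (s : Fin n → Sign) (f : Fin n → ℤ) →
          ∏ℤ.sum (λ i → sgn (s i) * f i) ≡ sgn (∏±.sum s) * ∏ℤ.sum f
∏-signs {zero}  s f = refl
∏-signs {suc n} s f = trans (cong (sgn (s zero) * f zero *_) (∏-signs (s ∘ suc) (f ∘ suc)))
  (trans (lemma (sgn (s zero)) (f zero) (sgn (∏±.sum (s ∘ suc))) (∏ℤ.sum (f ∘ suc)))
  (cong (_* (f zero * ∏ℤ.sum (f ∘ suc))) (sym (sgn-* (s zero) (∏±.sum (s ∘ suc))))))
  where
  lemma : ∀ m x a b → m * x * (a * b) ≡ m * a * (x * b)
  lemma = solve-∀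

∏-≈ : ∀ {M n} (f g : Fin n → ℤ) → (∀ i → Modulo._≈_ M (f i) (g i)) → Modulo._≈_ M (∏ℤ.sum f) (∏ℤ.sum g)
∏-≈ {M} {zero}  f g e = Modulo.≈-refl M
∏-≈ {M} {suc n} f g e = Modulo.*-cong M (e zero) (∏-≈ (f ∘ suc) (g ∘ suc) (e ∘ suc))

module Euler (h : ℕ) (N-prime : Prime (LeastResidue.N h)) where
  open LeastResidue h
  open Modulo (+ N)
  open PrimeModulus N-prime

  private
    unit : Fin h → ℤ
    unit i = + suc (toℕ i)

    N∤unit : ∀ i → ¬ (+ N ∣ unit i)
    N∤unit i d = case ∣<⇒≡0 (∣⇒∣ᵤ d) (s≤s (ℕ.≤-trans (Fin.toℕ<n i) (ℕ.m≤m+n h h))) of λ ()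

  -- The product of m, 2m, ..., hm is m^h h!, and by least residues also χ(m) h!. The factor h!
  -- cancels because the prime `N` does not divide it.
  euler : ∀ {m m⁻¹} → Inverse m m⁻¹ → m ^ h ≈ sgn (χ m)
  euler {m} inverse = *-cancel (prime∤∏ unit N∤unit) (begin
    m ^ h * ∏ℤ.sum unit                                              ≡⟨ ∏-scale m unit ⟨
    ∏ℤ.sum (λ i → m * unit i)
      ≈⟨ ∏-≈ {n = h} _ _ (λ i → ερ-≈ (m * unit i)) ⟩
    ∏ℤ.sum (λ i → sgn (ε (m * unit i)) * + ρ (m * unit i))
      ≡⟨ ∏-signs {h} (λ i → ε (m * unit i)) (λ i → + ρ (m * unit i)) ⟩
    sgn (χ m) * ∏ℤ.∏ h (λ k → + ρ (m * + k))
      ≡⟨ cong (sgn (χ m) *_) (∏-ρ ℤ.*-1-commutativeMonoid {m} inverse (λ k → + k)) ⟩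
    sgn (χ m) * ∏ℤ.sum unit                                          ∎)
    where open ≈-Reasoning

  private
    -- Fermat's theorem, obtained from `euler`: the power i^h is a sign, and its square is 1.
    square-power : ∀ i → (unit i * unit i) ^ h ≈ 1ℤ
    square-power i = begin
      (unit i * unit i) ^ h                   ≡⟨ ^-distrib-* (unit i) (unit i) h ⟩
      unit i ^ h * unit i ^ h                 ≈⟨ *-cong e e ⟩
      sgn (χ (unit i)) * sgn (χ (unit i))     ≡⟨ sgn-square (χ (unit i)) ⟩
      1ℤ                                        ∎
      where
      open ≈-Reasoning
      e : unit i ^ h ≈ sgn (χ (unit i))
      e = euler (proj₂ (bézout-inverse (unit i) (+ N) (prime∤⇒gcd≡1 N-prime (unit i) (N∤unit i))))

    square-injective : ∀ i j → unit i * unit i ≈ unit j * unit j → i ≡ j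
    square-injective i j (mod d) =
      [ (λ e → Fin.toℕ-injective (ℕ.suc-injective (difference-small (Fin.toℕ<n i) (Fin.toℕ<n j) e)))
      , (λ e → case proj₁ (sum-small (Fin.toℕ<n i) (Fin.toℕ<n j) e) of λ ())
      ]′ (euclid N-prime (unit i - unit j) (unit i + unit j) (subst (+ N ∣_) (lemma (unit i) (unit j)) d))
      where
      lemma : ∀ x y → x * x - y * y ≡ (x - y) * (x + y)
      lemma = solve-∀

  module _ {m : ℤ} (m^h≈1 : m ^ h ≈ 1ℤ) where
    private
      roots : Fin (suc h) → ℤ
      roots zero    = m
      roots (suc i) = unit i * unit i

      power : ∀ i → roots i ^ h ≈ 1ℤ
      power zero    = m^h≈1
      power (suc i) = square-power i

      distinct : (∀ i → ¬ (m ≈ unit i * unit i)) → ∀ i j → roots i ≈ roots j → i ≡ j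
      distinct m≉ zero    zero    e = refl
      distinct m≉ zero    (suc j) e = contradiction e (m≉ j)
      distinct m≉ (suc i) zero    e = contradiction (≈-sym e) (m≉ i)
      distinct m≉ (suc i) (suc j) e = cong suc (square-injective i j e)

      -- The degree is a variable of its own so that it can be split, `h` being a parameter; degree
      -- 0 would mean N = 1. The polynomial is x^n - 1.
      impossible : ∀ n (r : Fin (suc n) → ℤ) → (∀ i → r i ^ n ≈ 1ℤ) → n ≡ h → ¬ (∀ i j → r i ≈ r j → i ≡ j)
      impossible zero    r r^n≈1 refl distinct = ¬prime[1] N-prime
      impossible (suc n) r r^n≈1 _    distinct = too-many-roots (-1ℤ Vec.∷ replicate n 0ℤ) r distinct λ i → (begin
        -1ℤ + r i * monic (replicate n 0ℤ) (r i)
          ≡⟨ cong (λ e → -1ℤ + r i * e) (monic-power n (r i)) ⟩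
        -1ℤ + r i ^ suc n                          ≈⟨ +-cong (≈-refl { -1ℤ}) (r^n≈1 i) ⟩
        0ℤ                                         ∎)
        where open ≈-Reasoning

    -- The squares of 1, ..., h are h distinct roots of x^h - 1. If `m` were none of them, it would
    -- be one root too many.
    power≈1⇒square : ∃[ c ] m ≈ c * c
    power≈1⇒square = decide (Fin.any? λ i → + N ∣? m - unit i * unit i)
      where
      decide : Dec (∃[ i ] + N ∣ m - unit i * unit i) → ∃[ c ] m ≈ c * c
      decide (yes (i , d)) = unit i , mod d
      decide (no  none)    = contradiction (distinct λ i e → none (i , difference e)) (impossible h roots power refl)

  χ≡+⇒square : ∀ {m m⁻¹} → Inverse m m⁻¹ → χ m ≡ Sign.+ → ∃[ c ] m ≈ c * c
  χ≡+⇒square inverse χ≡+ = power≈1⇒square (≈-trans (euler inverse) (≈-reflexive (cong sgn χ≡+)))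

square-reciprocity : ∀ g H (let h = g ℕ.+ g; n = suc (h ℕ.+ h); p = suc (H ℕ.+ H)) → Prime p →
  ∀ s → + n ∣ s * s + + p → ¬ (+ p ∣ + n) → ∃[ c ] + p ∣ + n - c * c
square-reciprocity g H p-prime s n∣s²+p p∤n =
  finish (bézout-inverse (+ n) (+ p) coprime) (bézout-inverse (+ p) (+ n) (trans (gcd-comm (+ p) (+ n)) coprime))
  where
  h = g ℕ.+ g
  n = suc (h ℕ.+ h)
  p = suc (H ℕ.+ H)
  module n = Modulo (+ n)
  module p = Modulo (+ p)
  coprime : gcd (+ n) (+ p) ≡ 1ℤ
  coprime = prime∤⇒gcd≡1 p-prime (+ n) p∤n
  p≈-s² : + p n.≈ - (s * s)
  p≈-s² = n.mod (subst (+ n ∣_) (lemma s (+ p)) n∣s²+p)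
    where
    lemma : ∀ s p → s * s + p ≡ p - - (s * s)
    lemma = solve-∀
  finish : (∃[ x ] p.Inverse (+ n) x) → (∃[ y ] n.Inverse (+ p) y) → ∃[ c ] + p ∣ + n - c * c
  finish (x , inverse-n) (y , inverse-p) =
    extract (Euler.χ≡+⇒square H p-prime {+ n} {x} inverse-n χ≡+)
    where
    extract : (∃[ c ] + n p.≈ c * c) → ∃[ c ] + p ∣ + n - c * c
    extract (c , e) = c , p.difference e
    -- `s` is a unit because -s² ≡ p is one: its inverse is -s/p.
    inverse-s : n.Inverse s (- (s * y))
    inverse-s = begin
      s * - (s * y)     ≡⟨ lemma s y ⟩
      - (s * s) * y     ≈⟨ n.*-congʳ y p≈-s² ⟨
      + p * y           ≈⟨ inverse-p ⟩
      1ℤ                ∎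
      where
      open n.≈-Reasoning
      lemma : ∀ s y → s * - (s * y) ≡ - (s * s) * y
      lemma = solve-∀
    χ≡+ : LeastResidue.χ H (+ n) ≡ Sign.+
    χ≡+ = trans (sym (reciprocity g H {y} {x} inverse-p inverse-n))
                (NegatedSquare.χ-negated-square g {s} { - (s * y)} {+ p} inverse-s p≈-s²)

-- Genera of binary forms

even-or-odd : ∀ i → (∃[ q ] i ≡ q * + 2) ⊎ (∃[ q ] i ≡ q * + 2 + 1ℤ)
even-or-odd i = split (i %ℕ 2) (ℤ.n%ℕd<d i 2) (ℤ.a≡a%ℕn+[a/ℕn]*n i 2)
  where
  q : ℤ
  q = i /ℕ 2
  split : ∀ r → r < 2 → i ≡ + r + q * + 2 → (∃[ q ] i ≡ q * + 2) ⊎ (∃[ q ] i ≡ q * + 2 + 1ℤ)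
  split 0 _ eq = inj₁ (q , trans eq (ℤ.+-identityˡ (q * + 2)))
  split 1 _ eq = inj₂ (q , trans eq (ℤ.+-comm 1ℤ (q * + 2)))
  split (suc (suc _)) (s≤s (s≤s ())) _

odd-split : ∀ i → ¬ (+ 2 ∣ i) → ∃[ q ] i ≡ q * + 2 + 1ℤ
odd-split i 2∤i with even-or-odd i
... | inj₁ (q , eq) = contradiction (divides q eq) 2∤i
... | inj₂ odd      = odd

oddPrime-half : ∀ {p} → Prime p → 3 ≤ p → ∃[ H ] p ≡ suc (H ℕ.+ H)
oddPrime-half {p} p-prime 3≤p = p ℕ./ 2 , split (p ℕ.% 2) (ℕ.m%n<n p 2) (ℕ.m≡m%n+[m/n]*n p 2)
  where
  q : ℕ
  q = p ℕ./ 2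
  double : q ℕ.* 2 ≡ q ℕ.+ q
  double = trans (ℕ.*-comm q 2) (cong (q ℕ.+_) (ℕ.+-identityʳ q))
  split : ∀ r → r < 2 → p ≡ r ℕ.+ q ℕ.* 2 → p ≡ suc (q ℕ.+ q)
  split 0 _ eq = contradiction (∣ᵤ⇒∣ (ℕ.divides q eq)) (2∤prime p-prime 3≤p)
  split 1 _ eq = trans eq (cong suc double)
  split (suc (suc _)) (s≤s (s≤s ())) _

-- An odd number is its own inverse mod 4.
cancel-odd : ∀ H k → + 4 ∣ (H * + 2 + 1ℤ) * k → + 4 ∣ k
cancel-odd H k d = subst (+ 4 ∣_) (lemma H k)
  (∣m∣n⇒∣m-n (∣n⇒∣m*n (H * + 2 + 1ℤ) d) (∣m⇒∣m*n ((H * H + H) * k) ∣-refl))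
  where
  lemma : ∀ H k → (H * + 2 + 1ℤ) * ((H * + 2 + 1ℤ) * k) - + 4 * ((H * H + H) * k) ≡ k
  lemma = solve-∀

odd-square : ∀ i → ¬ (+ 2 ∣ i) → + 4 ∣ i * i - 1ℤ
odd-square i 2∤i with odd-split i 2∤i
... | q , refl = divides (q * q + q) (lemma q)
  where
  lemma : ∀ q → (q * + 2 + 1ℤ) * (q * + 2 + 1ℤ) - 1ℤ ≡ (q * q + q) * + 4
  lemma = solve-∀

-- Unit values of the principal form modulo 16p

module PrincipalForm (H : ℤ) where

  private
    p M : ℤ
    p = H * + 2 + 1ℤ
    M = + 16 * p

  -- Replacing x by x ± 2p changes (r - x²)/4p by 2 modulo 4.
  private
    adjust : ∀ e r l d j y → r - (e * + 2 + 1ℤ) * (e * + 2 + 1ℤ) ≡ + 4 * p * (d + l * + 4) →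
      + 4 ∣ y * y - (d - j * (e * + 2 + 1ℤ) - p * (j * j)) →
      M ∣ (e * + 2 + 1ℤ + + 2 * p * j) * (e * + 2 + 1ℤ + + 2 * p * j) + + 4 * p * (y * y) - r
    adjust e r l d j y eq (divides c eq′) = divides (c - l) (begin
      (x + + 2 * p * j) * (x + + 2 * p * j) + + 4 * p * (y * y) - r
        ≡⟨ lemma x p j y r d ⟩
      + 4 * p * (y * y - (d - j * x - p * (j * j))) + + 4 * p * d - (r - x * x)
        ≡⟨ cong₂ (λ s t → + 4 * p * s + + 4 * p * d - t) eq′ eq ⟩
      + 4 * p * (c * + 4) + + 4 * p * d - + 4 * p * (d + l * + 4)
        ≡⟨ lemma′ p c l d ⟩
      (c - l) * (+ 16 * p) ∎)
      where
      open ≡-Reasoning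
      x = e * + 2 + 1ℤ
      lemma : ∀ x p j y r d → (x + + 2 * p * j) * (x + + 2 * p * j) + + 4 * p * (y * y) - r
        ≡ + 4 * p * (y * y - (d - j * x - p * (j * j))) + + 4 * p * d - (r - x * x)
      lemma = solve-∀
      lemma′ : ∀ p c l d → + 4 * p * (c * + 4) + + 4 * p * d - + 4 * p * (d + l * + 4) ≡ (c - l) * (+ 16 * p)
      lemma′ = solve-∀

    Representation : ℤ → Set
    Representation r = ∃[ x ] ∃[ y ] M ∣ x * x + + 4 * p * (y * y) - r

    represent : ∀ e r w → r - (e * + 2 + 1ℤ) * (e * + 2 + 1ℤ) ≡ + 4 * p * w → Representation r
    represent e r w eq =
      split (w %ℕ 4) (ℤ.n%ℕd<d w 4) (trans eq (cong (+ 4 * p *_) (ℤ.a≡a%ℕn+[a/ℕn]*n w 4))) (even-or-odd (e + H))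
      where
      x l : ℤ
      x = e * + 2 + 1ℤ
      l = w /ℕ 4
      split : ∀ d → d < 4 → r - x * x ≡ + 4 * p * (+ d + l * + 4) →
        (∃[ f ] e + H ≡ f * + 2) ⊎ (∃[ f ] e + H ≡ f * + 2 + 1ℤ) → Representation r
      split 0 _ eq _ = x + + 2 * p * 0ℤ , 0ℤ , adjust e r l (+ 0) 0ℤ 0ℤ eq (divides 0ℤ (lemma e H))
        where
        lemma : ∀ e H → 0ℤ * 0ℤ - (+ 0 - 0ℤ * (e * + 2 + 1ℤ) - (H * + 2 + 1ℤ) * (0ℤ * 0ℤ)) ≡ 0ℤ * + 4
        lemma = solve-∀
      split 1 _ eq _ = x + + 2 * p * 0ℤ , 1ℤ , adjust e r l (+ 1) 0ℤ 1ℤ eq (divides 0ℤ (lemma e H))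
        where
        lemma : ∀ e H → 1ℤ * 1ℤ - (+ 1 - 0ℤ * (e * + 2 + 1ℤ) - (H * + 2 + 1ℤ) * (0ℤ * 0ℤ)) ≡ 0ℤ * + 4
        lemma = solve-∀
      -- 2 and 3 are not squares mod 4, so w must move by 2. With p = 2H + 1 and x = 2e + 1, the
      -- shift j = 1 changes w by -2(e + H + 1), and j = -1 by 2(e - H); the parity of e + H tells
      -- which is 2 mod 4.
      split 2 _ eq (inj₁ (f , e+H≡2f)) = x + + 2 * p * 1ℤ , 0ℤ , adjust e r l (+ 2) 1ℤ 0ℤ eq
        (divides f (trans (lemma e H) (trans (cong (λ c → c * + 2) e+H≡2f) (ℤ.*-assoc f (+ 2) (+ 2)))))
        where
        lemma : ∀ e H → 0ℤ * 0ℤ - (+ 2 - 1ℤ * (e * + 2 + 1ℤ) - (H * + 2 + 1ℤ) * (1ℤ * 1ℤ)) ≡ (e + H) * + 2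
        lemma = solve-∀
      split 3 _ eq (inj₁ (f , e+H≡2f)) = x + + 2 * p * 1ℤ , 1ℤ , adjust e r l (+ 3) 1ℤ 1ℤ eq
        (divides f (trans (lemma e H) (trans (cong (λ c → c * + 2) e+H≡2f) (ℤ.*-assoc f (+ 2) (+ 2)))))
        where
        lemma : ∀ e H → 1ℤ * 1ℤ - (+ 3 - 1ℤ * (e * + 2 + 1ℤ) - (H * + 2 + 1ℤ) * (1ℤ * 1ℤ)) ≡ (e + H) * + 2
        lemma = solve-∀
      split 2 _ eq (inj₂ (f , e+H≡2f+1)) = x + + 2 * p * -1ℤ , 0ℤ , adjust e r l (+ 2) -1ℤ 0ℤ eq
        (divides (H - f - 1ℤ) (trans (lemma e H)
          (trans (cong (λ c → (+ 2 * H - c - 1ℤ) * + 2) e+H≡2f+1) (lemma′ H f))))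
        where
        lemma : ∀ e H → 0ℤ * 0ℤ - (+ 2 - -1ℤ * (e * + 2 + 1ℤ) - (H * + 2 + 1ℤ) * (-1ℤ * -1ℤ))
          ≡ (+ 2 * H - (e + H) - 1ℤ) * + 2
        lemma = solve-∀
        lemma′ : ∀ H f → (+ 2 * H - (f * + 2 + 1ℤ) - 1ℤ) * + 2 ≡ (H - f - 1ℤ) * + 4
        lemma′ = solve-∀
      split 3 _ eq (inj₂ (f , e+H≡2f+1)) = x + + 2 * p * -1ℤ , 1ℤ , adjust e r l (+ 3) -1ℤ 1ℤ eq
        (divides (H - f - 1ℤ) (trans (lemma e H)
          (trans (cong (λ c → (+ 2 * H - c - 1ℤ) * + 2) e+H≡2f+1) (lemma′ H f))))
        where
        lemma : ∀ e H → 1ℤ * 1ℤ - (+ 3 - -1ℤ * (e * + 2 + 1ℤ) - (H * + 2 + 1ℤ) * (-1ℤ * -1ℤ))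
          ≡ (+ 2 * H - (e + H) - 1ℤ) * + 2
        lemma = solve-∀
        lemma′ : ∀ H f → (+ 2 * H - (f * + 2 + 1ℤ) - 1ℤ) * + 2 ≡ (H - f - 1ℤ) * + 4
        lemma′ = solve-∀
      split (suc (suc (suc (suc _)))) (s≤s (s≤s (s≤s (s≤s ())))) _ _

    -- Adding the odd number p to a root changes its parity.
    odd-root : ∀ {r} c → p ∣ r - c * c → ∃[ e ] p ∣ r - (e * + 2 + 1ℤ) * (e * + 2 + 1ℤ)
    odd-root {r} c p∣ with even-or-odd c
    ... | inj₂ (q , refl) = q , p∣
    ... | inj₁ (q , refl) = q + H , subst (p ∣_) (lemma r q H)
      (∣m∣n⇒∣m-n p∣ (∣m⇒∣m*n (q * + 4 + (H * + 2 + 1ℤ)) (∣-refl {p})))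
      where
      lemma : ∀ r q H → r - q * + 2 * (q * + 2) - (H * + 2 + 1ℤ) * (q * + 4 + (H * + 2 + 1ℤ))
        ≡ r - ((q + H) * + 2 + 1ℤ) * ((q + H) * + 2 + 1ℤ)
      lemma = solve-∀

  -- With an odd root x, both 4 and p divide r - x², hence so does 4p; the quotient is then made a
  -- square mod 4 by `represent`.
  principal-represents : ∀ {r} c → + 4 ∣ r - 1ℤ → p ∣ r - c * c →
                         ∃[ x ] ∃[ y ] M ∣ x * x + + 4 * p * (y * y) - r
  principal-represents {r} c 4∣r-1 p∣ = finish (odd-root {r} c p∣)
    where
    finish : (∃[ e ] p ∣ r - (e * + 2 + 1ℤ) * (e * + 2 + 1ℤ)) → Representation r
    finish (e , divides k eq) = finish′ (cancel-odd H k (subst (+ 4 ∣_) (trans eq (ℤ.*-comm k p)) 4∣r-x²))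
      where
      lemma : ∀ r e → r - 1ℤ - + 4 * (e * e + e) ≡ r - (e * + 2 + 1ℤ) * (e * + 2 + 1ℤ)
      lemma = solve-∀
      4∣r-x² : + 4 ∣ r - (e * + 2 + 1ℤ) * (e * + 2 + 1ℤ)
      4∣r-x² = subst (+ 4 ∣_) (lemma r e) (∣m∣n⇒∣m-n 4∣r-1 (∣m⇒∣m*n (e * e + e) (∣-refl {+ 4})))
      lemma′ : ∀ w p → w * + 4 * p ≡ + 4 * p * w
      lemma′ = solve-∀
      finish′ : + 4 ∣ k → Representation r
      finish′ (divides w k≡4w) = represent e r w (trans eq (trans (cong (_* p) k≡4w) (lemma′ w p)))

  principal-values : ∀ {r} x y → ¬ (+ 2 ∣ r) → M ∣ x * x + + 4 * p * (y * y) - r →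
                     (+ 4 ∣ r - 1ℤ) × (p ∣ r - x * x)
  principal-values {r} x y 2∤r M∣ =
    subst (+ 4 ∣_) (lemma x y r p)
      (∣m∣n⇒∣m-n (∣m∣n⇒∣m+n (odd-square x 2∤x) (∣m⇒∣m*n (p * (y * y)) (∣-refl {+ 4}))) 4∣) ,
    subst (p ∣_) (lemma′ x y r p)
      (∣m∣n⇒∣m-n (∣n⇒∣m*n (+ 4 * (y * y)) (∣-refl {p})) (∣-trans (∣n⇒∣m*n (+ 16) ∣-refl) M∣))
    where
    4∣ : + 4 ∣ x * x + + 4 * p * (y * y) - r
    4∣ = ∣-trans (divides (+ 4 * p) (lemma₄ p)) M∣
      where
      lemma₄ : ∀ p → + 16 * p ≡ + 4 * p * + 4
      lemma₄ = solve-∀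
    2∤x : ¬ (+ 2 ∣ x)
    2∤x 2∣x = 2∤r (subst (+ 2 ∣_) (lemma₂ x y r p) (∣m∣n⇒∣m-n
      (∣m∣n⇒∣m+n (∣m⇒∣m*n x 2∣x) (∣m⇒∣m*n (+ 2 * p * (y * y)) (∣-refl {+ 2}))) (∣-trans (divides (+ 2) refl) 4∣)))
      where
      lemma₂ : ∀ x y r p → x * x + + 2 * (+ 2 * p * (y * y)) - (x * x + + 4 * p * (y * y) - r) ≡ r
      lemma₂ = solve-∀
    lemma : ∀ x y r p → x * x - 1ℤ + + 4 * (p * (y * y)) - (x * x + + 4 * p * (y * y) - r) ≡ r - 1ℤ
    lemma = solve-∀
    lemma′ : ∀ x y r p → + 4 * (y * y) * p - (x * x + + 4 * p * (y * y) - r) ≡ r - x * x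
    lemma′ = solve-∀

-- Comparison with the principal form through one value of ρ

module Genus
  {p : ℕ} (p-prime : Prime p) (H : ℤ) (p≡2H+1 : + p ≡ H * + 2 + 1ℤ)
  {a t b : ℤ} (ab-t²≡4p : a * b - t * t ≡ + 4 * + p)
  (e f : ℤ)
  (4∣m-1 : + 4 ∣ value (binary a (+ 2 * t) b) e f - 1ℤ)
  (p∤m : ¬ (+ p ∣ value (binary a (+ 2 * t) b) e f))
  (c : ℤ) (p∣m-c² : + p ∣ value (binary a (+ 2 * t) b) e f - c * c)
  where

  private
    m : ℤ
    m = a * e * e + + 2 * t * e * f + b * f * f

    V : ℤ → ℤ → ℤ
    V x y = a * x * x + + 2 * t * x * y + b * y * y

    M : ℤ
    M = + 16 * + p

    represents : ∀ {r} c → + 4 ∣ r - 1ℤ → + p ∣ r - c * c →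
                 ∃[ x ] ∃[ y ] M ∣ x * x + + 4 * + p * (y * y) - r
    -- `+ p` is not a variable, so the equation can be matched only after generalising it to `q`.
    represents = along p≡2H+1
      where
      along : ∀ {q} → q ≡ H * + 2 + 1ℤ → ∀ {r} c → + 4 ∣ r - 1ℤ → q ∣ r - c * c →
              ∃[ x ] ∃[ y ] + 16 * q ∣ x * x + + 4 * q * (y * y) - r
      along refl {r} = PrincipalForm.principal-represents H {r}

    values : ∀ {r} x y → ¬ (+ 2 ∣ r) → M ∣ x * x + + 4 * + p * (y * y) - r →
             (+ 4 ∣ r - 1ℤ) × (+ p ∣ r - x * x)
    values = along p≡2H+1
      where
      along : ∀ {q} → q ≡ H * + 2 + 1ℤ → ∀ {r} x y → ¬ (+ 2 ∣ r) →
              + 16 * q ∣ x * x + + 4 * q * (y * y) - r → (+ 4 ∣ r - 1ℤ) × (q ∣ r - x * x)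
      along refl {r} = PrincipalForm.principal-values H {r}

    L K : ℤ → ℤ → ℤ
    L x y = (a * e + t * f) * x + (t * e + b * f) * y
    K x y = e * y - f * x

    -- Composition with the vector (e, f): `L` is its inner product with (x, y) under ρ, `K` their
    -- determinant. Thus m times any value of ρ is a value of the principal form.
    mV≡ : ∀ x y → m * V x y ≡ L x y * L x y + + 4 * + p * (K x y * K x y)
    mV≡ x y = trans (lemma a t b e f x y) (cong (λ q → L x y * L x y + q * (K x y * K x y)) ab-t²≡4p)
      where
      lemma : ∀ a t b e f x y →
        (a * e * e + + 2 * t * e * f + b * f * f) * (a * x * x + + 2 * t * x * y + b * y * y)
        ≡ ((a * e + t * f) * x + (t * e + b * f) * y) * ((a * e + t * f) * x + (t * e + b * f) * y) +
          (a * b - t * t) * ((e * y - f * x) * (e * y - f * x))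
      lemma = solve-∀

    p∣M : + p ∣ M
    p∣M = ∣n⇒∣m*n (+ 16) ∣-refl

    4∣M : + 4 ∣ M
    4∣M = ∣m⇒∣m*n (+ p) (divides (+ 4) refl)

    module p = Modulo (+ p)
    module M = Modulo M

    c-inverse : ∃[ c⁻¹ ] p.Inverse c c⁻¹
    c-inverse = bézout-inverse c (+ p) (prime∤⇒gcd≡1 p-prime c p∤c)
      where
      lemma : ∀ m c → m - c * c + c * c ≡ m
      lemma = solve-∀
      p∤c : ¬ (+ p ∣ c)
      p∤c p∣c = p∤m (subst (+ p ∣_) (lemma m c) (∣m∣n⇒∣m+n p∣m-c² (∣m⇒∣m*n c p∣c)))

    4∣combine : ∀ {v r n} → + 4 ∣ n - 1ℤ → + 4 ∣ v - r → + 4 ∣ n * v - r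
    4∣combine {v} {r} {n} d d′ = subst (+ 4 ∣_) (lemma n v r) (∣m∣n⇒∣m+n (∣m⇒∣m*n v d) d′)
      where
      lemma : ∀ n v r → (n - 1ℤ) * v + (v - r) ≡ n * v - r
      lemma = solve-∀

  -- Modulo 4, r ≡ mV ≡ L², and an odd square is 1.
  values-mod-4 : ∀ {r} x y → ¬ (+ 2 ∣ r) → M ∣ V x y - r → + 4 ∣ r - 1ℤ
  values-mod-4 {r} x y 2∤r M∣ =
    subst (+ 4 ∣_) (lemma (L x y) (K x y) (+ p) r)
      (∣m∣n⇒∣m-n (∣m∣n⇒∣m+n (odd-square (L x y) 2∤L) (∣m⇒∣m*n (+ p * (K x y * K x y)) (∣-refl {+ 4}))) 4∣)
    where
    4∣ : + 4 ∣ L x y * L x y + + 4 * + p * (K x y * K x y) - r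
    4∣ = subst (λ s → + 4 ∣ s - r) (mV≡ x y) (4∣combine {V x y} {r} {m} 4∣m-1 (∣-trans 4∣M M∣))
    lemma : ∀ l k p r → l * l - 1ℤ + + 4 * (p * (k * k)) - (l * l + + 4 * p * (k * k) - r) ≡ r - 1ℤ
    lemma = solve-∀
    2∤L : ¬ (+ 2 ∣ L x y)
    2∤L 2∣L = 2∤r (subst (+ 2 ∣_) (lemma₂ (L x y) (K x y) (+ p) r)
      (∣m∣n⇒∣m-n (∣m∣n⇒∣m+n (∣m⇒∣m*n (L x y) 2∣L) (∣m⇒∣m*n (+ 2 * + p * (K x y * K x y)) (∣-refl {+ 2})))
                 (∣-trans (divides (+ 2) refl) 4∣)))
      where
      lemma₂ : ∀ l k p r → l * l + + 2 * (+ 2 * p * (k * k)) - (l * l + + 4 * p * (k * k) - r) ≡ r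
      lemma₂ = solve-∀

  -- Modulo p, c²r ≡ mV ≡ L², and c is a unit since p does not divide m.
  values-mod-p : ∀ {r} x y → M ∣ V x y - r → ∃[ d ] + p ∣ r - d * d
  values-mod-p {r} x y M∣ = square c-inverse
    where
    square : (∃[ c⁻¹ ] p.Inverse c c⁻¹) → ∃[ d ] + p ∣ r - d * d
    square (c⁻¹ , inverse) = c⁻¹ * L x y , p.difference (begin
      r                                                ≡⟨ lemma₁ r ⟩
      1ℤ * 1ℤ * r                                      ≈⟨ p.*-congʳ r (p.*-cong inverse inverse) ⟨
      c * c⁻¹ * (c * c⁻¹) * r                          ≡⟨ lemma₂ c c⁻¹ r ⟩
      c⁻¹ * c⁻¹ * (c * c * r)
        ≈⟨ p.*-congˡ (c⁻¹ * c⁻¹) (p.*-cong (p.mod {m} {c * c} p∣m-c²) (p.mod {V x y} {r} (∣-trans p∣M M∣))) ⟨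
      c⁻¹ * c⁻¹ * (m * V x y)                          ≡⟨ cong (c⁻¹ * c⁻¹ *_) (mV≡ x y) ⟩
      c⁻¹ * c⁻¹ * (L x y * L x y + + 4 * + p * (K x y * K x y))
        ≈⟨ p.*-congˡ (c⁻¹ * c⁻¹) (p.mod {L x y * L x y + + 4 * + p * (K x y * K x y)} {L x y * L x y}
             (divides (+ 4 * (K x y * K x y)) (lemma₃ (L x y) (K x y) (+ p)))) ⟩
      c⁻¹ * c⁻¹ * (L x y * L x y)                      ≡⟨ lemma₄ c⁻¹ (L x y) ⟩
      c⁻¹ * L x y * (c⁻¹ * L x y)                      ∎)
      where
      open p.≈-Reasoning
      lemma₁ : ∀ r → r ≡ 1ℤ * 1ℤ * r
      lemma₁ = solve-∀
      lemma₂ : ∀ c d r → c * d * (c * d) * r ≡ d * d * (c * c * r)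
      lemma₂ = solve-∀
      lemma₃ : ∀ l k p → l * l + + 4 * p * (k * k) - l * l ≡ + 4 * (k * k) * p
      lemma₃ = solve-∀
      lemma₄ : ∀ d l → d * d * (l * l) ≡ d * l * (d * l)
      lemma₄ = solve-∀

  principal-represents-value : ∀ {r} x y → ¬ (+ 2 ∣ r) → M ∣ V x y - r →
                               ∃[ x ] ∃[ y ] M ∣ x * x + + 4 * + p * (y * y) - r
  principal-represents-value {r} x y 2∤r M∣ = finish (values-mod-p {r} x y M∣)
    where
    finish : (∃[ d ] + p ∣ r - d * d) → ∃[ x ] ∃[ y ] M ∣ x * x + + 4 * + p * (y * y) - r
    finish (d , p∣) = represents {r} d (values-mod-4 {r} x y 2∤r M∣) p∣

  -- m is congruent to 1 mod 4, so (1 - m)² vanishes mod 16, and 1 - m m′ vanishes mod p for some m′.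
  m-inverse : ∃[ μ ] M.Inverse m μ
  m-inverse = build (bézout-inverse m (+ p) (prime∤⇒gcd≡1 p-prime m p∤m)) 4∣m-1
    where
    build : (∃[ m′ ] p.Inverse m m′) → + 4 ∣ m - 1ℤ → ∃[ μ ] M.Inverse m μ
    build (m′ , p.mod (divides q eq)) (divides s eq′) =
      m′ + (+ 2 - m) - m * m′ * (+ 2 - m) ,
      M.mod (divides (q * s * s) (trans (lemma m m′)
        (trans (cong₂ (λ x y → x * (y * y)) eq eq′) (lemma′ q s (+ p)))))
      where
      lemma : ∀ m n → m * (n + (+ 2 - m) - m * n * (+ 2 - m)) - 1ℤ ≡ (m * n - 1ℤ) * ((m - 1ℤ) * (m - 1ℤ))
      lemma = solve-∀
      lemma′ : ∀ q s p → q * p * (s * + 4 * (s * + 4)) ≡ q * s * s * (+ 16 * p)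
      lemma′ = solve-∀

  -- The product mr is again 1 mod 4 and a square mod p, so the principal form represents it as w² +
  -- 4pk². Solving L = w, K = k modulo 16p then gives mV ≡ mr, and m cancels.
  represents-principal-value : ∀ {r} x y → ¬ (+ 2 ∣ r) → M ∣ x * x + + 4 * + p * (y * y) - r →
                               ∃[ x ] ∃[ y ] M ∣ V x y - r
  represents-principal-value {r} x₀ y₀ 2∤r M∣ =
    finish (values {r} x₀ y₀ 2∤r M∣)
    where
    lift : ∀ {w k} → M ∣ w * w + + 4 * + p * (k * k) - m * r → (∃[ μ ] M.Inverse m μ) → ∃[ x ] ∃[ y ] M ∣ V x y - r
    lift {w} {k} M∣ (μ , inverse) = x , y , M.difference (begin
      V x y                                                   ≡⟨ ℤ.*-identityˡ (V x y) ⟨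
      1ℤ * V x y                                              ≈⟨ M.*-congʳ (V x y) inverse ⟨
      m * μ * V x y                                           ≡⟨ lemma₁ m μ (V x y) ⟩
      μ * (m * V x y)                                         ≡⟨ cong (μ *_) (mV≡ x y) ⟩
      μ * (L x y * L x y + + 4 * + p * (K x y * K x y))
        ≡⟨ cong₂ (λ l k → μ * (l * l + + 4 * + p * (k * k))) (L≡ a t b e f w k μ) (K≡ a t b e f w k μ) ⟩
      μ * (m * μ * w * (m * μ * w) + + 4 * + p * (m * μ * k * (m * μ * k)))
                                                              ≡⟨ lemma₂ μ m w k (+ p) ⟩
      μ * (m * μ * (m * μ)) * (w * w + + 4 * + p * (k * k))
        ≈⟨ M.*-cong (M.*-congˡ μ (M.*-cong inverse inverse)) (M.mod {w * w + + 4 * + p * (k * k)} {m * r} M∣) ⟩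
      μ * (1ℤ * 1ℤ) * (m * r)                                 ≡⟨ lemma₃ μ m r ⟩
      m * μ * r                                               ≈⟨ M.*-congʳ r inverse ⟩
      1ℤ * r                                                  ≡⟨ ℤ.*-identityˡ r ⟩
      r                                                       ∎)
      where
      open M.≈-Reasoning
      x y : ℤ
      -- Cramer's rule for L = w, K = k: the linear map (x, y) ↦ (L, K) has determinant m, and μ is
      -- an inverse of m mod 16p.
      x = μ * (e * w - (t * e + b * f) * k)
      y = μ * (f * w + (a * e + t * f) * k)
      lemma₁ : ∀ m n v → m * n * v ≡ n * (m * v)
      lemma₁ = solve-∀
      L≡ : ∀ a t b e f w k μ →
        (a * e + t * f) * (μ * (e * w - (t * e + b * f) * k)) + (t * e + b * f) * (μ * (f * w + (a * e + t * f) * k))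
        ≡ (a * e * e + + 2 * t * e * f + b * f * f) * μ * w
      L≡ = solve-∀
      K≡ : ∀ a t b e f w k μ →
        e * (μ * (f * w + (a * e + t * f) * k)) - f * (μ * (e * w - (t * e + b * f) * k))
        ≡ (a * e * e + + 2 * t * e * f + b * f * f) * μ * k
      K≡ = solve-∀
      lemma₂ : ∀ n m w k p → n * (m * n * w * (m * n * w) + + 4 * p * (m * n * k * (m * n * k)))
        ≡ n * (m * n * (m * n)) * (w * w + + 4 * p * (k * k))
      lemma₂ = solve-∀
      lemma₃ : ∀ n m r → n * (1ℤ * 1ℤ) * (m * r) ≡ m * n * r
      lemma₃ = solve-∀
    finish : (+ 4 ∣ r - 1ℤ) × (+ p ∣ r - x₀ * x₀) → ∃[ x ] ∃[ y ] M ∣ V x y - r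
    finish (4∣r-1 , p∣r-x²) = finish′ (represents {m * r} (c * x₀) (4∣combine {r} {1ℤ} {m} 4∣m-1 4∣r-1)
      (subst (+ p ∣_) (lemma m r c x₀) (∣m∣n⇒∣m+n (∣m⇒∣m*n r p∣m-c²) (∣n⇒∣m*n (c * c) p∣r-x²))))
      where
      lemma : ∀ m r c x → (m - c * c) * r + c * c * (r - x * x) ≡ m * r - c * x * (c * x)
      lemma = solve-∀
      finish′ : (∃[ w ] ∃[ k ] M ∣ w * w + + 4 * + p * (k * k) - m * r) → ∃[ x ] ∃[ y ] M ∣ V x y - r
      finish′ (w , k , d) = lift {w} {k} d m-inverse

positive-1-mod-4 : ∀ {m} → 0ℤ ℤ.< m → + 4 ∣ m - 1ℤ → ∃[ g ] m ≡ + suc ((g ℕ.+ g) ℕ.+ (g ℕ.+ g))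
positive-1-mod-4 {m} 0<m (divides q eq) = split q (trans (lemma m) (cong (_+ 1ℤ) eq))
  where
  lemma : ∀ m → m ≡ m - 1ℤ + 1ℤ
  lemma = solve-∀
  lemma′ : ∀ x → x * + 4 + 1ℤ ≡ 1ℤ + ((x + x) + (x + x))
  lemma′ = solve-∀
  split : ∀ q → m ≡ q * + 4 + 1ℤ → ∃[ g ] m ≡ + suc ((g ℕ.+ g) ℕ.+ (g ℕ.+ g))
  split (+ g)      m≡ = g , trans m≡ (lemma′ (+ g))
  split (-[1+ g ]) m≡ = contradiction (subst (0ℤ ℤ.<_) m≡ 0<m) λ ()

-- A value 1 mod 4 forces the principal genus

module _
  {p : ℕ} (p-prime : Prime p) (3≤p : 3 ≤ p) {a t b : ℤ}
  (positive : PositiveDefinite (binary a (+ 2 * t) b))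
  (disc : discriminant₂ (binary a (+ 2 * t) b) ≡ - (+ (16 ℕ.* p)))
  where

  private
    ρ : BinaryForm
    ρ = binary a (+ 2 * t) b

    disc′ : discriminant₂ ρ ≡ - (+ 16 * + p)
    disc′ = trans disc (cong -_ (ℤ.pos-* 16 p))

  ab-t²≡4p : a * b - t * t ≡ + 4 * + p
  ab-t²≡4p = ℤ.*-cancelˡ-≡ (+ 4) _ _ (begin
    + 4 * (a * b - t * t)                ≡⟨ lemma a b t ⟩
    - (+ 2 * t * (+ 2 * t) - + 4 * a * b) ≡⟨ cong -_ disc′ ⟩
    - - (+ 16 * + p)                     ≡⟨ lemma′ (+ p) ⟩
    + 4 * (+ 4 * + p)                    ∎)
    where
    open ≡-Reasoning
    lemma : ∀ a b t → + 4 * (a * b - t * t) ≡ - (+ 2 * t * (+ 2 * t) - + 4 * a * b)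
    lemma = solve-∀
    lemma′ : ∀ p → - - (+ 16 * p) ≡ + 4 * (+ 4 * p)
    lemma′ = solve-∀

  module _ (e f g h : ℤ) (eh-fg≡1 : e * h - f * g ≡ 1ℤ) where
    private
      m T n : ℤ
      m = value ρ e f
      n = value ρ g h
      T = a * e * g + t * (e * h + f * g) + b * f * h

      mn≡T²+4p : m * n ≡ T * T + + 4 * + p
      mn≡T²+4p = trans (lemma a t b e f g h)
        (trans (cong₂ (λ x y → T * T + x * (y * y)) ab-t²≡4p eh-fg≡1)
               (cong (λ x → T * T + x) (ℤ.*-identityʳ (+ 4 * + p))))
        where
        lemma : ∀ a t b e f g h →
          (a * e * e + + 2 * t * e * f + b * f * f) * (a * g * g + + 2 * t * g * h + b * h * h)
          ≡ (a * e * g + t * (e * h + f * g) + b * f * h) * (a * e * g + t * (e * h + f * g) + b * f * h) +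
            (a * b - t * t) * ((e * h - f * g) * (e * h - f * g))
        lemma = solve-∀

      -- From T² ≡ -4p mod m it remains to divide by 4. First m ∣ 4X for X = s² + p; then X = mX -
      -- 4qX shows m ∣ X.
      -p-square : ∀ {m} → m * n ≡ T * T + + 4 * + p → + 4 ∣ m - 1ℤ → ∃[ s ] m ∣ s * s + + p
      -p-square {m} mn≡ (divides q m-1≡4q) = s , divides (X - q * (n + T * T * (m + + 2))) (begin
        X                                              ≡⟨ lemma₁ X q ⟩
        (1ℤ + q * + 4) * X - q * (+ 4 * X)
          ≡⟨ cong₂ (λ x y → x * X - q * y) (sym m≡) 4X≡ ⟩
        m * X - q * (m * (n + T * T * (m + + 2)))      ≡⟨ lemma₂ m X q (n + T * T * (m + + 2)) ⟩
        (X - q * (n + T * T * (m + + 2))) * m          ∎)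
        where
        open ≡-Reasoning
        s X : ℤ
        -- As m = 4q + 1, the number 2q + 1 = (m + 1)/2 is an inverse of 2 mod m, and s stands for
        -- T/2.
        s = T * (+ 2 * q + 1ℤ)
        X = s * s + + p
        m≡ : m ≡ 1ℤ + q * + 4
        m≡ = trans (lemma m) (cong (λ x → 1ℤ + x) m-1≡4q)
          where
          lemma : ∀ m → m ≡ 1ℤ + (m - 1ℤ)
          lemma = solve-∀
        lemma₁ : ∀ X q → X ≡ (1ℤ + q * + 4) * X - q * (+ 4 * X)
        lemma₁ = solve-∀
        lemma₂ : ∀ m X q y → m * X - q * (m * y) ≡ (X - q * y) * m
        lemma₂ = solve-∀
        4X≡ : + 4 * X ≡ m * (n + T * T * (m + + 2))
        4X≡ = begin
          + 4 * X                                            ≡⟨ lemma₃ T q (+ p) ⟩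
          T * T * ((1ℤ + q * + 4 + 1ℤ) * (1ℤ + q * + 4 + 1ℤ)) + + 4 * + p
            ≡⟨ cong (λ x → T * T * ((x + 1ℤ) * (x + 1ℤ)) + + 4 * + p) (sym m≡) ⟩
          T * T * ((m + 1ℤ) * (m + 1ℤ)) + + 4 * + p          ≡⟨ lemma₄ T m (+ p) ⟩
          T * T + + 4 * + p + T * T * (m * (m + + 2))
            ≡⟨ cong (λ x → x + T * T * (m * (m + + 2))) (sym mn≡) ⟩
          m * n + T * T * (m * (m + + 2))                    ≡⟨ lemma₅ T m n ⟩
          m * (n + T * T * (m + + 2))                        ∎
          where
          lemma₃ : ∀ T q p → + 4 * (T * (+ 2 * q + 1ℤ) * (T * (+ 2 * q + 1ℤ)) + p)
            ≡ T * T * ((1ℤ + q * + 4 + 1ℤ) * (1ℤ + q * + 4 + 1ℤ)) + + 4 * p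
          lemma₃ = solve-∀
          lemma₄ : ∀ T m p → T * T * ((m + 1ℤ) * (m + 1ℤ)) + + 4 * p ≡ T * T + + 4 * p + T * T * (m * (m + + 2))
          lemma₄ = solve-∀
          lemma₅ : ∀ T m n → m * n + T * T * (m * (m + + 2)) ≡ m * (n + T * T * (m + + 2))
          lemma₅ = solve-∀

      0<m : 0ℤ ℤ.< m
      0<m = positive e f λ where (refl , refl) → case eh-fg≡1 of λ ()

    module _ (4∣m-1 : + 4 ∣ m - 1ℤ) (p∤m : ¬ (+ p ∣ m)) where

      value-square-mod-p : ∃[ c ] + p ∣ m - c * c
      value-square-mod-p = finish (positive-1-mod-4 0<m 4∣m-1) (oddPrime-half p-prime 3≤p) (-p-square mn≡T²+4p 4∣m-1)
        where
        finish : (∃[ k ] m ≡ + suc ((k ℕ.+ k) ℕ.+ (k ℕ.+ k))) → (∃[ H ] p ≡ suc (H ℕ.+ H)) →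
                 (∃[ s ] m ∣ s * s + + p) → ∃[ c ] + p ∣ m - c * c
        finish (k , m≡) (H , p≡) (s , m∣) = transport m≡ p≡ m∣ p∤m p-prime
          where
          transport : ∀ {m p} → m ≡ + suc ((k ℕ.+ k) ℕ.+ (k ℕ.+ k)) → p ≡ suc (H ℕ.+ H) →
            m ∣ s * s + + p → ¬ (+ p ∣ m) → Prime p → ∃[ c ] + p ∣ m - c * c
          transport refl refl m∣ p∤m p-prime = square-reciprocity k H p-prime s m∣ p∤m

      inPrincipalGenus : InPrincipalGenus p ρ
      inPrincipalGenus = trans disc′ (trans (lemma (+ p))
          (cong (λ x → 0ℤ * 0ℤ - + 4 * 1ℤ * x) (sym (ℤ.pos-* 4 p)))) ,
        λ r coprime → mk⇔
          (λ where (x , y , d) → forward (2∤r coprime) (oddPrime-half p-prime 3≤p) value-square-mod-p x y d)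
          (λ where (x , y , d) → backward (2∤r coprime) (oddPrime-half p-prime 3≤p) value-square-mod-p x y d)
        where
        D M : ℤ
        D = discriminant₂ ρ
        M = + 16 * + p
        lemma : ∀ p → - (+ 16 * p) ≡ 0ℤ * 0ℤ - + 4 * 1ℤ * (+ 4 * p)
        lemma = solve-∀
        D≡-M : D ≡ - M
        D≡-M = disc′
        principal : BinaryForm
        principal = binary 1ℤ 0ℤ (+ (4 ℕ.* p))
        M∣D : M ∣ D
        M∣D = subst (M ∣_) (sym D≡-M) (∣m⇒∣-m ∣-refl)
        D∣M : D ∣ M
        D∣M = subst (_∣ M) (sym D≡-M) (divides -1ℤ (lemma₁ M))
          where
          lemma₁ : ∀ x → x ≡ -1ℤ * - x
          lemma₁ = solve-∀
        principal-value : ∀ x y → value principal x y ≡ x * x + + 4 * + p * (y * y)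
        principal-value x y = trans (cong (λ q → 1ℤ * x * x + 0ℤ * x * y + q * y * y) (ℤ.pos-* 4 p))
                                    (lemma₁ x y (+ p))
          where
          lemma₁ : ∀ x y p → 1ℤ * x * x + 0ℤ * x * y + + 4 * p * y * y ≡ x * x + + 4 * p * (y * y)
          lemma₁ = solve-∀
        2∤r : ∀ {r} → Coprime r D → ¬ (+ 2 ∣ r)
        2∤r coprime 2∣r = case coprime (∣⇒∣ᵤ 2∣r , ∣⇒∣ᵤ (∣-trans 2∣M M∣D)) of λ ()
          where
          2∣M : + 2 ∣ M
          2∣M = ∣m⇒∣m*n (+ p) (divides (+ 8) refl)
        half : ∀ {H} → p ≡ suc (H ℕ.+ H) → + p ≡ + H * + 2 + 1ℤ
        half {H} refl = lemma₁ (+ H)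
          where
          lemma₁ : ∀ x → 1ℤ + (x + x) ≡ x * + 2 + 1ℤ
          lemma₁ = solve-∀
        forward : ∀ {r} → ¬ (+ 2 ∣ r) → (∃[ H ] p ≡ suc (H ℕ.+ H)) → (∃[ c ] + p ∣ m - c * c) →
                  ∀ x y → D Unsigned.∣ value ρ x y - r → RepresentsMod D principal r
        forward {r} 2∤r (H , p≡) (c , p∣m-c²) x y d =
          finish (Genus.principal-represents-value p-prime (+ H) (half {H} p≡) {a} {t} {b}
                    ab-t²≡4p e f 4∣m-1 p∤m c p∣m-c² {r} x y 2∤r
                    (∣-trans M∣D (∣ᵤ⇒∣ d)))
          where
          finish : (∃[ x ] ∃[ y ] M ∣ x * x + + 4 * + p * (y * y) - r) → RepresentsMod D principal r
          finish (x , y , d) = x , y , ∣⇒∣ᵤ (∣-trans D∣M (subst (λ v → M ∣ v - r) (sym (principal-value x y)) d))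
        backward : ∀ {r} → ¬ (+ 2 ∣ r) → (∃[ H ] p ≡ suc (H ℕ.+ H)) → (∃[ c ] + p ∣ m - c * c) →
                   ∀ x y → D Unsigned.∣ value principal x y - r → RepresentsMod D ρ r
        backward {r} 2∤r (H , p≡) (c , p∣m-c²) x y d =
          finish (Genus.represents-principal-value p-prime (+ H) (half {H} p≡) {a} {t} {b}
                    ab-t²≡4p e f 4∣m-1 p∤m c p∣m-c² {r} x y 2∤r
                    (subst (λ v → M ∣ v - r) (principal-value x y) (∣-trans M∣D (∣ᵤ⇒∣ d))))
          where
          finish : (∃[ x ] ∃[ y ] M ∣ value ρ x y - r) → RepresentsMod D ρ r
          finish (x , y , d) = x , y , ∣⇒∣ᵤ (∣-trans D∣M d)

-- Solving for the coefficients of an even reciprocal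

Canonical-coefficients : (a t b : ℤ) → Set
Canonical-coefficients a t b = ∃[ x ] ∃[ y ] ∃[ z ] ∃[ u ] ∃[ v ]
  a ≡ + 4 * z - v * v × b ≡ + 4 * x - u * u × t ≡ u * v - + 2 * y

canonical-swap : ∀ {a t b} → Canonical-coefficients b t a → Canonical-coefficients a t b
canonical-swap (x , y , z , u , v , a≡ , b≡ , t≡) =
  z , y , x , v , u , b≡ , a≡ , trans t≡ (cong (_- + 2 * y) (ℤ.*-comm u v))

-- The vector (e, f) comes with a completion to a unimodular matrix because the second row supplies
-- the n and T with mn = T² + 4p.
Values≡3mod4 : ℕ → (a t b : ℤ) → Set
Values≡3mod4 p a t b = ∀ e f g h → e * h - f * g ≡ 1ℤ →
  let m = value (binary a (+ 2 * t) b) e f in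
  ¬ (+ 2 ∣ m) → ¬ (+ p ∣ m) → + 4 ∣ m + 1ℤ

Values≡3mod4-swap : ∀ {p a t b} → Values≡3mod4 p a t b → Values≡3mod4 p b t a
Values≡3mod4-swap {p} {a} {t} {b} H e f g h eh-fg≡1 2∤m p∤m =
  subst (λ m → + 4 ∣ m + 1ℤ) (sym swapped)
    -- Exchanging the variables reverses the determinant; negating the second vector restores it.
    (H f e (- h) (- g) (trans (lemma e f g h) eh-fg≡1)
      (2∤m ∘ subst (+ 2 ∣_) (sym swapped)) (p∤m ∘ subst (+ p ∣_) (sym swapped)))
  where
  lemma : ∀ e f g h → f * - g - e * - h ≡ e * h - f * g
  lemma = solve-∀
  lemma′ : ∀ a t b e f → b * e * e + + 2 * t * e * f + a * f * f ≡ a * f * f + + 2 * t * f * e + b * e * e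
  lemma′ = solve-∀
  swapped : value (binary b (+ 2 * t) a) e f ≡ value (binary a (+ 2 * t) b) f e
  swapped = lemma′ a t b e f

odd-mod-4 : ∀ m → ¬ (+ 2 ∣ m) → (+ 4 ∣ m - 1ℤ) ⊎ (+ 4 ∣ m + 1ℤ)
odd-mod-4 m 2∤m = case odd-split m 2∤m of λ where
    (q , m≡) → half q m≡ (even-or-odd q)
  where
  half : ∀ q → m ≡ q * + 2 + 1ℤ → (∃[ r ] q ≡ r * + 2) ⊎ (∃[ r ] q ≡ r * + 2 + 1ℤ) →
         (+ 4 ∣ m - 1ℤ) ⊎ (+ 4 ∣ m + 1ℤ)
  half q m≡ (inj₁ (r , q≡)) =
    inj₁ (divides r (trans (cong (_- 1ℤ) (trans m≡ (cong (λ x → x * + 2 + 1ℤ) q≡))) (lemma r)))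
    where
    lemma : ∀ r → r * + 2 * + 2 + 1ℤ - 1ℤ ≡ r * + 4
    lemma = solve-∀
  half q m≡ (inj₂ (r , q≡)) =
    inj₂ (divides (r + 1ℤ) (trans (cong (_+ 1ℤ) (trans m≡ (cong (λ x → x * + 2 + 1ℤ) q≡))) (lemma r)))
    where
    lemma : ∀ r → (r * + 2 + 1ℤ) * + 2 + 1ℤ + 1ℤ ≡ (r + 1ℤ) * + 4
    lemma = solve-∀

2∣square : ∀ i → + 2 ∣ i * i → + 2 ∣ i
2∣square i d = ⊎.reduce (euclid prime[2] i i d)

4∣odd*⇒ : ∀ a b → ¬ (+ 2 ∣ a) → + 4 ∣ a * b → + 4 ∣ b
4∣odd*⇒ a b 2∤a d = case odd-split a 2∤a of λ where
  (q , a≡) → cancel-odd q b (subst (λ x → + 4 ∣ x * b) a≡ d)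

module _ {p : ℕ} (p-prime : Prime p) (5≤p : 5 ≤ p) where
  private
    3≤p : 3 ≤ p
    3≤p = ℕ.≤-trans (s≤s (s≤s (s≤s z≤n))) 5≤p

    p∤4 : ¬ (+ p ∣ + 4)
    p∤4 d = ℕ.<⇒≱ 5≤p (ℕ.∣⇒≤ (∣⇒∣ᵤ d))

  module _ {a t b : ℤ} (ab-t²≡4p : a * b - t * t ≡ + 4 * + p) where

    p∣a⇒p∣t : + p ∣ a → + p ∣ t
    p∣a⇒p∣t p∣a = ⊎.reduce (euclid p-prime t t
      (subst (+ p ∣_) (trans (cong (λ s → a * b - s) (sym ab-t²≡4p)) (lemma (a * b) (t * t)))
        (∣m∣n⇒∣m-n (∣m⇒∣m*n b p∣a) (∣n⇒∣m*n (+ 4) (∣-refl {+ p})))))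
      where
      lemma : ∀ x y → x - (x - y) ≡ y
      lemma = solve-∀

    -- Otherwise p ∣ t as well and p² ∣ ab - t² = 4p, impossible for p ≥ 5. Hence some value of ρ
    -- prime to p is always at hand.
    not-both-divisible : + p ∣ a → ¬ (+ p ∣ b)
    not-both-divisible (divides a′ refl) (divides b′ refl) = p∤4 (*-cancelʳ-∣ (+ p) p²∣4p)
      where
      instance
        p≢0 : ℤ.NonZero (+ p)
        p≢0 = prime⇒nonZero p-prime
      p²∣4p : + p * + p ∣ + 4 * + p
      p²∣4p = finish (p∣a⇒p∣t (∣n⇒∣m*n a′ ∣-refl))
        where
        finish : + p ∣ t → + p * + p ∣ + 4 * + p
        finish (divides t′ t≡) = divides (a′ * b′ - t′ * t′)
          (trans (sym ab-t²≡4p) (trans (cong (λ s → a′ * + p * (b′ * + p) - s * s) t≡) (lemma a′ b′ t′ (+ p))))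
          where
          lemma : ∀ a b t p → a * p * (b * p) - t * p * (t * p) ≡ (a * b - t * t) * (p * p)
          lemma = solve-∀

    module _ (values : Values≡3mod4 p a t b) where

      -- Since ab = t² + 4p, an even b makes t even and then 4 ∣ b, so u = 0; and v = 1 needs a ≡ 3
      -- mod 4. If p ∣ a, the value a + 2t + b replaces a: it is congruent to a mod 4, and prime to
      -- p because p ∣ t but p does not divide b.
      odd-even : ¬ (+ 2 ∣ a) → ∀ {b′} → b ≡ b′ * + 2 → Canonical-coefficients a t b
      odd-even 2∤a {b′} b≡ = finish 2∣t
        where
        t²≡ : a * b - + 4 * + p ≡ t * t
        t²≡ = trans (cong (λ s → a * b - s) (sym ab-t²≡4p)) (lemma′ (a * b) (t * t))
          where
          lemma′ : ∀ x y → x - (x - y) ≡ y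
          lemma′ = solve-∀
        2∣t : + 2 ∣ t
        2∣t = 2∣square t (divides (a * b′ - + 2 * + p) (trans (sym t²≡)
          (trans (cong (λ s → a * s - + 4 * + p) b≡) (lemma″ a b′ (+ p)))))
          where
          lemma″ : ∀ a b p → a * (b * + 2) - + 4 * p ≡ (a * b - + 2 * p) * + 2
          lemma″ = solve-∀
        finish : + 2 ∣ t → Canonical-coefficients a t b
        finish (divides t′ t≡) = conclude 4∣a+1 4∣b
          where
          4∣b : + 4 ∣ b
          4∣b = 4∣odd*⇒ a b 2∤a (divides (t′ * t′ + + p) (trans (lemma₁ (a * b) (+ 4 * + p))
            (trans (cong (_+ + 4 * + p) (trans t²≡ (cong (λ s → s * s) t≡))) (lemma₂ t′ (+ p)))))
            where
            lemma₁ : ∀ x y → x ≡ x - y + y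
            lemma₁ = solve-∀
            lemma₂ : ∀ t p → t * + 2 * (t * + 2) + + 4 * p ≡ (t * t + p) * + 4
            lemma₂ = solve-∀
          value₁₀ : value (binary a (+ 2 * t) b) 1ℤ 0ℤ ≡ a
          value₁₀ = lemma₁ a t b
            where
            lemma₁ : ∀ a t b → a * 1ℤ * 1ℤ + + 2 * t * 1ℤ * 0ℤ + b * 0ℤ * 0ℤ ≡ a
            lemma₁ = solve-∀
          value₁₁ : value (binary a (+ 2 * t) b) 1ℤ 1ℤ ≡ a + (+ 2 * t + b)
          value₁₁ = lemma₁ a t b
            where
            lemma₁ : ∀ a t b → a * 1ℤ * 1ℤ + + 2 * t * 1ℤ * 1ℤ + b * 1ℤ * 1ℤ ≡ a + (+ 2 * t + b)
            lemma₁ = solve-∀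
          4∣2t+b : + 4 ∣ + 2 * t + b
          4∣2t+b = ∣m∣n⇒∣m+n (divides t′ (trans (cong (+ 2 *_) t≡) (lemma₁ t′))) 4∣b
            where
            lemma₁ : ∀ t → + 2 * (t * + 2) ≡ t * + 4
            lemma₁ = solve-∀
          4∣a+1 : + 4 ∣ a + 1ℤ
          4∣a+1 with + p ∣? a
          ... | no p∤a = subst (λ m → + 4 ∣ m + 1ℤ) value₁₀ (values 1ℤ 0ℤ 0ℤ 1ℤ refl
                  (2∤a ∘ subst (+ 2 ∣_) value₁₀) (p∤a ∘ subst (+ p ∣_) value₁₀))
          ... | yes p∣a = subst (+ 4 ∣_) (lemma₁ a (+ 2 * t + b)) (∣m∣n⇒∣m-n
                  (subst (λ m → + 4 ∣ m + 1ℤ) value₁₁ (values 1ℤ 1ℤ 0ℤ 1ℤ refl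
                    (2∤a ∘ (λ d → ∣m+n∣n⇒∣m {+ 2} {a} {+ 2 * t + b} d (∣-trans (divides (+ 2) refl) 4∣2t+b))
                      ∘ subst (+ 2 ∣_) value₁₁)
                    (not-both-divisible p∣a ∘ (λ d → ∣m+n∣m⇒∣n {+ p} {+ 2 * t} {b}
                        (∣m+n∣m⇒∣n {+ p} {a} {+ 2 * t + b} d p∣a) (∣n⇒∣m*n (+ 2) (p∣a⇒p∣t p∣a)))
                      ∘ subst (+ p ∣_) value₁₁))) 4∣2t+b)
            where
            lemma₁ : ∀ a s → a + s + 1ℤ - s ≡ a + 1ℤ
            lemma₁ = solve-∀
          conclude : + 4 ∣ a + 1ℤ → + 4 ∣ b → Canonical-coefficients a t b
          conclude (divides z a+1≡4z) (divides x b≡4x) = x , - t′ , z , 0ℤ , 1ℤ ,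
            trans (lemma₁ a) (trans (cong (_- 1ℤ) a+1≡4z) (lemma₂ z)) ,
            trans b≡4x (lemma₃ x) ,
            trans t≡ (lemma₄ t′)
            where
            lemma₁ : ∀ a → a ≡ a + 1ℤ - 1ℤ
            lemma₁ = solve-∀
            lemma₂ : ∀ z → z * + 4 - 1ℤ ≡ + 4 * z - 1ℤ * 1ℤ
            lemma₂ = solve-∀
            lemma₃ : ∀ x → x * + 4 ≡ + 4 * x - 0ℤ * 0ℤ
            lemma₃ = solve-∀
            lemma₄ : ∀ t → t * + 2 ≡ 0ℤ * 1ℤ - + 2 * - t
            lemma₄ = solve-∀

      -- Here t is odd and ab ≡ t² ≡ 1 mod 4, so a ≡ 3 forces b ≡ 3, and u = v = 1. When p ∣ a, the
      -- caller exchanges a and b.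
      odd-odd : ¬ (+ 2 ∣ a) → ¬ (+ 2 ∣ b) → ¬ (+ p ∣ a) → Canonical-coefficients a t b
      odd-odd 2∤a 2∤b p∤a = case odd-split t 2∤t of λ where
          (t′ , t≡) → conclude t′ t≡ 4∣a+1 (4∣b+1 t′ t≡ 4∣a+1)
        where
        ab≡ : a * b ≡ t * t + + 4 * + p
        ab≡ = trans (lemma₁ (a * b) (t * t)) (cong (λ s → t * t + s) ab-t²≡4p)
          where
          lemma₁ : ∀ x y → x ≡ y + (x - y)
          lemma₁ = solve-∀
        2∤t : ¬ (+ 2 ∣ t)
        2∤t 2∣t = [ 2∤a , 2∤b ]′ (euclid prime[2] a b (subst (+ 2 ∣_) (sym ab≡)
          (∣m∣n⇒∣m+n (∣m⇒∣m*n t 2∣t) (∣m⇒∣m*n (+ p) (divides (+ 2) refl)))))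
        value₁₀ : value (binary a (+ 2 * t) b) 1ℤ 0ℤ ≡ a
        value₁₀ = lemma₁ a t b
          where
          lemma₁ : ∀ a t b → a * 1ℤ * 1ℤ + + 2 * t * 1ℤ * 0ℤ + b * 0ℤ * 0ℤ ≡ a
          lemma₁ = solve-∀
        4∣a+1 : + 4 ∣ a + 1ℤ
        4∣a+1 = subst (λ m → + 4 ∣ m + 1ℤ) value₁₀ (values 1ℤ 0ℤ 0ℤ 1ℤ refl
                  (2∤a ∘ subst (+ 2 ∣_) value₁₀) (p∤a ∘ subst (+ p ∣_) value₁₀))
        4∣b+1 : ∀ t′ → t ≡ t′ * + 2 + 1ℤ → + 4 ∣ a + 1ℤ → + 4 ∣ b + 1ℤ
        4∣b+1 t′ t≡ d = subst (+ 4 ∣_) (lemma₁ a b) (∣m∣n⇒∣m-n (∣m⇒∣m*n b d)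
          (divides (t′ * t′ + t′ + + p) (trans (cong (_- 1ℤ) (trans ab≡ (cong (λ s → s * s + + 4 * + p) t≡)))
            (lemma₂ t′ (+ p)))))
          where
          lemma₁ : ∀ a b → (a + 1ℤ) * b - (a * b - 1ℤ) ≡ b + 1ℤ
          lemma₁ = solve-∀
          lemma₂ : ∀ t p → (t * + 2 + 1ℤ) * (t * + 2 + 1ℤ) + + 4 * p - 1ℤ ≡ (t * t + t + p) * + 4
          lemma₂ = solve-∀
        conclude : ∀ t′ → t ≡ t′ * + 2 + 1ℤ → + 4 ∣ a + 1ℤ → + 4 ∣ b + 1ℤ → Canonical-coefficients a t b
        conclude t′ t≡ (divides z a+1≡4z) (divides x b+1≡4x) = x , - t′ , z , 1ℤ , 1ℤ ,
          trans (lemma₁ a) (trans (cong (_- 1ℤ) a+1≡4z) (lemma₂ z)) ,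
          trans (lemma₁ b) (trans (cong (_- 1ℤ) b+1≡4x) (lemma₂ x)) ,
          trans t≡ (lemma₄ t′)
          where
          lemma₁ : ∀ a → a ≡ a + 1ℤ - 1ℤ
          lemma₁ = solve-∀
          lemma₂ : ∀ z → z * + 4 - 1ℤ ≡ + 4 * z - 1ℤ * 1ℤ
          lemma₂ = solve-∀
          lemma₄ : ∀ t → t * + 2 + 1ℤ ≡ 1ℤ * 1ℤ - + 2 * - t
          lemma₄ = solve-∀

  primitive⇒canonical : ∀ {a t b} → a * b - t * t ≡ + 4 * + p → Values≡3mod4 p a t b →
                        ¬ ((+ 2 ∣ a) × (+ 2 ∣ b)) → Canonical-coefficients a t b
  primitive⇒canonical {a} {t} {b} ab-t²≡4p values not-both-even =
    split (+ 2 ∣? a) (+ 2 ∣? b) (+ p ∣? a)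
    where
    ba-t²≡4p : b * a - t * t ≡ + 4 * + p
    ba-t²≡4p = trans (cong (_- t * t) (ℤ.*-comm b a)) ab-t²≡4p
    values′ : Values≡3mod4 p b t a
    values′ = Values≡3mod4-swap {p} {a} {t} {b} values
    split : Dec (+ 2 ∣ a) → Dec (+ 2 ∣ b) → Dec (+ p ∣ a) → Canonical-coefficients a t b
    split (yes 2∣a)             (yes 2∣b)             _         = contradiction (2∣a , 2∣b) not-both-even
    split (no 2∤a)              (yes (divides b′ b≡)) _         = odd-even ab-t²≡4p values 2∤a {b′} b≡
    split (yes (divides a′ a≡)) (no 2∤b)              _         = canonical-swap (odd-even ba-t²≡4p values′ 2∤b {a′} a≡)
    split (no 2∤a)              (no 2∤b)              (no p∤a)  = odd-odd ab-t²≡4p values 2∤a 2∤b p∤a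
    split (no 2∤a)              (no 2∤b)              (yes p∣a) =
      canonical-swap (odd-odd ba-t²≡4p values′ 2∤b 2∤a (not-both-divisible {a} {t} {b} ab-t²≡4p p∣a))

primitive⇒not-both-even : ∀ {a t b} → Primitive₂ (binary a (+ 2 * t) b) → ¬ ((+ 2 ∣ a) × (+ 2 ∣ b))
primitive⇒not-both-even {a} {t} {b} gcd≡1 (2∣a , 2∣b) =
  contradiction (ℕ.∣1⇒≡1 (∣⇒∣ᵤ (subst (+ 2 ∣_) gcd≡1 (gcds-greatest (a ∷ + 2 * t ∷ b ∷ []) divides-all)))) λ ()
  where
  divides-all : ∀ i → + 2 ∣ (a ∷ + 2 * t ∷ b ∷ []) i
  divides-all zero             = 2∣a
  divides-all (suc zero)       = ∣m⇒∣m*n t ∣-refl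
  divides-all (suc (suc zero)) = 2∣b

module _ {p : ℕ} (p-prime : Prime p) (5≤p : 5 ≤ p) {a t b : ℤ}
  (positive : PositiveDefinite (binary a (+ 2 * t) b))
  (disc : discriminant₂ (binary a (+ 2 * t) b) ≡ - (+ (16 ℕ.* p)))
  where

  private
    ρ : BinaryForm
    ρ = binary a (+ 2 * t) b
    3≤p : 3 ≤ p
    3≤p = ℕ.≤-trans (s≤s (s≤s (s≤s z≤n))) 5≤p

  notPrincipal⇒values≡3mod4 : ¬ InPrincipalGenus p ρ → Values≡3mod4 p a t b
  notPrincipal⇒values≡3mod4 notPrincipal e f g h eh-fg≡1 2∤m p∤m =
    [ (λ 4∣m-1 → contradiction
        (inPrincipalGenus p-prime 3≤p {a} {t} {b} positive disc e f g h eh-fg≡1 4∣m-1 p∤m) notPrincipal)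
    , id
    ]′ (odd-mod-4 (value ρ e f) 2∤m)

  scaled⇒canonical : (∃[ ρ′ ] Primitive₂ ρ′ × ρ ≡ scale ρ′ (+ 4)) → Canonical-coefficients a t b
  scaled⇒canonical (binary α β γ , _ , ρ≡) = γ , - β , α , 0ℤ , 0ℤ ,
    trans (cong BinaryForm.α ρ≡) (lemma α) ,
    trans (cong BinaryForm.γ ρ≡) (lemma γ) ,
    ℤ.*-cancelˡ-≡ (+ 2) _ _ (trans (cong BinaryForm.β ρ≡) (lemma′ β))
    where
    lemma : ∀ x → + 4 * x ≡ + 4 * x - 0ℤ * 0ℤ
    lemma = solve-∀
    lemma′ : ∀ x → + 4 * x ≡ + 2 * (0ℤ * 0ℤ - + 2 * - x)
    lemma′ = solve-∀

  canonical-coefficients :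
    (Primitive₂ ρ × ¬ InPrincipalGenus p ρ) ⊎ (∃[ ρ′ ] Primitive₂ ρ′ × ρ ≡ scale ρ′ (+ 4)) →
    Canonical-coefficients a t b
  canonical-coefficients (inj₁ (ρ-primitive , notPrincipal)) =
    primitive⇒canonical p-prime 5≤p {a} {t} {b} (ab-t²≡4p p-prime 3≤p {a} {t} {b} positive disc)
      (notPrincipal⇒values≡3mod4 notPrincipal) (primitive⇒not-both-even {a} {t} {b} ρ-primitive)
  canonical-coefficients (inj₂ scaled) = scaled⇒canonical scaled

mainTheorem3 :
    (p : ℕ) → Prime p → 5 ≤ p →
    (a t b : ℤ) →
    let ρ = binary a (+ 2 * t) b
        Admissible : TernaryForm → Set
        Admissible = λ f → Primitive f × HasInvariants f (+ (2 ℕ.* p)) 1ℤ × ProperlyRepresents f (matrix₂ a t b)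
    in
    PositiveDefinite ρ →
    discriminant₂ ρ ≡ - (+ (16 ℕ.* p)) →
    (Primitive₂ ρ × ¬ InPrincipalGenus p ρ) ⊎ (∃[ ρ′ ] Primitive₂ ρ′ × ρ ≡ scale ρ′ (+ 4)) →
    (∃[ f ] Admissible f) ×
    (∀ f g → Admissible f → Admissible g → Equivalent f g) ×
    (∀ f → Admissible f →
      ∃[ F ] F IsReciprocalOf f × ImproperlyPrimitive F × discriminant F ≡ + p ℚ./ 1)
mainTheorem3 p p-prime 5≤p a t b positive disc kind =
  conclude (ab-t²≡4p p-prime 3≤p {a} {t} {b} positive disc)
           (canonical-coefficients p-prime 5≤p {a} {t} {b} positive disc kind) {+ (2 ℕ.* p)} refl
  where
  3≤p : 3 ≤ p
  3≤p = ℕ.≤-trans (s≤s (s≤s (s≤s z≤n))) 5≤p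
  -- With a, t, b as variables the canonical equations can be matched by `refl`; a variable `k`
  -- keeps the invariant 2p from unfolding.
  conclude : ∀ {a t b} → a * b - t * t ≡ + 4 * + p → Canonical-coefficients a t b → ∀ {k} → k ≡ + (2 ℕ.* p) →
    let Admissible : TernaryForm → Set
        Admissible = λ f → Primitive f × HasInvariants f k 1ℤ × ProperlyRepresents f (matrix₂ a t b)
    in
    (∃[ f ] Admissible f) ×
    (∀ f g → Admissible f → Admissible g → Equivalent f g) ×
    (∀ f → Admissible f →
      ∃[ F ] F IsReciprocalOf f × ImproperlyPrimitive F × discriminant F ≡ + p ℚ./ 1)
  conclude ab-t²≡4p (x , y , z , u , v , refl , refl , refl) k≡2p =
    (C.f₀ , C.admissible₀) , C.unique , C.reciprocal-form
    where
    module C = Canonical p-prime 5≤p x y z u v ab-t²≡4p k≡2p
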